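{- Let $\widetilde{G}$ be a mixed graph with underlying graph $G$. Then $rk(\widetilde{G})-r(G)=-2d(G)$ if and only if all of the following hold: (i) the mixed cycles (if any) of $\widetilde{G}$ are pairwise vertex-disjoint; (ii) for each mixed cycle $\widetilde{C}_l$ of $\widetilde{G}$ (of length $l$), $l\equiv 2\pmod 4$ and $\eta(\widetilde{C}_l)\equiv 2\pmod 4$; (iii) a series of $\delta$-transformations can switch $G$ to a crucial subgraph which is the disjoint union of $d(G)$ induced cycles together with some isolated vertices.
   Context: All graphs are finite and simple. A mixed graph $\widetilde{G}$ is obtained from a simple graph $G$ (its underlying graph) by orienting some of its edges. The Hermitian adjacency matrix $H(\widetilde{G})=(h_{uv})$ has $h_{uv}=1$ for an undirected edge $\{u,v\}$, $h_{uv}=i$ for an arc $(u,v)$, $h_{uv}=-i$ for an arc $(v,u)$, $0$ otherwise; $rk(\widetilde{G})$ is its rank and $r(G)$ is the rank of the adjacency matrix of $G$. $d(G)=|E_G|-|V_G|+\omega(G)$ with $\omega(G)$ the number of components. A mixed cycle of $\widetilde{G}$ is a cycle of $G$ with the orientations/non-orientations its edges have in $\widetilde{G}$. The signature $\eta(\widetilde{C})$ of a mixed cycle is $|f-b|$, where, traversing the cycle in one direction, $f$ is the number of arcs oriented forward and $b$ the number oriented backward (undirected edges are not counted). A pendant vertex is a vertex of degree one. A $\delta$-transformation on a graph with a pendant vertex deletes a pendant vertex together with its neighbour. For a graph whose cycles are pairwise vertex-disjoint, one repeatedly applies $\delta$-transformations until an induced subgraph without pendant vertices is obtained; this resulting induced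 subgraph is called a crucial subgraph. -}

module Defs where

open import Level using (0ℓ)
open import Data.Bool using (Bool; true; false; _∧_; not; if_then_else_)
open import Data.Nat using (ℕ; zero; suc; _+_; _*_; _∸_; _<_; _≤_; _%_; ∣_-_∣)
open import Data.Nat.Properties using (_<?_)
open import Data.Fin using (Fin; zero; suc; toℕ; punchIn)
open import Data.Product using (Σ; ∃; ∃-syntax; _×_; _,_)
open import Data.Sum using (_⊎_)
open import Relation.Nullary using (¬_; does)
open import Relation.Binary.PropositionalEquality using (_≡_; _≢_)
open import Relation.Binary.Construct.Closure.ReflexiveTransitive using (Star)
open import Function.Definitions using (Injective; Surjective)
open import Function.Bundles using (_⇔_)
open import Algebra.Bundles.Raw using (RawRing)
open import Data.Rational using (ℚ; 0ℚ; 1ℚ)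
import Data.Rational as Q

count : ∀ {m} → (Fin m → Bool) → ℕ
count {zero}  p = 0
count {suc m} p = (if p zero then 1 else 0) + count (λ i → p (suc i))

sumF : ∀ {m} → (Fin m → ℕ) → ℕ
sumF {zero}  f = 0
sumF {suc m} f = f zero + sumF (λ i → f (suc i))

-- Determinant (Laplace expansion along the first row) and rank
-- over a ring whose equality is propositional equality.

module RingDet (R : RawRing 0ℓ 0ℓ) where
  open RawRing R renaming (_+_ to _⊕_; _*_ to _⊗_; -_ to ⊖_)

  altSum : ∀ {m} → (Fin m → Carrier) → Carrier
  altSum {zero}  f = 0#
  altSum {suc m} f = f zero ⊕ (⊖ altSum (λ i → f (suc i)))

  det : ∀ {m} → (Fin m → Fin m → Carrier) → Carrier
  det {zero}  A = 1#
  det {suc m} A =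
    altSum (λ j → A zero j ⊗ det (λ i k → A (suc i) (punchIn j k)))

  HasNonsingularMinor : ∀ {n} → (Fin n → Fin n → Carrier) → ℕ → Set
  HasNonsingularMinor {n} A k =
    Σ (Fin k → Fin n) λ f → Σ (Fin k → Fin n) λ g →
      Injective _≡_ _≡_ f × Injective _≡_ _≡_ g ×
      ¬ (det (λ i j → A (f i) (g j)) ≡ 0#)

  IsRank : ∀ {n} → (Fin n → Fin n → Carrier) → ℕ → Set
  IsRank A r = HasNonsingularMinor A r × (∀ k → HasNonsingularMinor A k → k ≤ r)

-- Gaussian rationals ℚ(i) (a subfield of ℂ containing all entries of H)

record ℚi : Set where
  constructor _+i_
  field re im : ℚ

ℚi-rawRing : RawRing 0ℓ 0ℓ
ℚi-rawRing = record
  { Carrier = ℚi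
  ; _≈_ = _≡_
  ; _+_ = λ { (a +i b) (c +i d) → (a Q.+ c) +i (b Q.+ d) }
  ; _*_ = λ { (a +i b) (c +i d) → ((a Q.* c) Q.- (b Q.* d)) +i ((a Q.* d) Q.+ (b Q.* c)) }
  ; -_  = λ { (a +i b) → (Q.- a) +i (Q.- b) }
  ; 0#  = 0ℚ +i 0ℚ
  ; 1#  = 1ℚ +i 0ℚ
  }

module ℚDet  = RingDet Q.+-*-rawRing
module ℚiDet = RingDet ℚi-rawRing

-- entry for the ordered pair (u,v): no edge, undirected edge,
-- arc (u,v), arc (v,u)
data Entry : Set where
  none undir arc rev : Entry

flipE : Entry → Entry
flipE none  = none
flipE undir = undir
flipE arc   = rev
flipE rev   = arc

isEdge : Entry → Bool
isEdge none = false
isEdge _    = true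

record MixedGraph (n : ℕ) : Set where
  field
    ent   : Fin n → Fin n → Entry
    loopless : ∀ u → ent u u ≡ none
    consistent : ∀ u v → ent v u ≡ flipE (ent u v)

record Graph (n : ℕ) : Set where
  field
    adj   : Fin n → Fin n → Bool
    irrefl : ∀ u → adj u u ≡ false
    adj-sym : ∀ u v → adj u v ≡ adj v u

open MixedGraph public
open Graph public

underlying : ∀ {n} → MixedGraph n → Graph n
underlying {n} M = record
  { adj = λ u v → isEdge (ent M u v)
  ; irrefl = λ u → irr u
  ; adj-sym = λ u v → sy u v
  }
  where
  open import Relation.Binary.PropositionalEquality using (cong; sym; trans)
  irr : ∀ u → isEdge (ent M u u) ≡ false
  irr u = cong isEdge (loopless M u)
  isEdge-flip : ∀ e → isEdge (flipE e) ≡ isEdge e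
  isEdge-flip none  = Relation.Binary.PropositionalEquality.refl
  isEdge-flip undir = Relation.Binary.PropositionalEquality.refl
  isEdge-flip arc   = Relation.Binary.PropositionalEquality.refl
  isEdge-flip rev   = Relation.Binary.PropositionalEquality.refl
  sy : ∀ u v → isEdge (ent M u v) ≡ isEdge (ent M v u)
  sy u v = sym (trans (cong isEdge (consistent M u v)) (isEdge-flip (ent M u v)))

hermEntry : Entry → ℚi
hermEntry none  = 0ℚ +i 0ℚ
hermEntry undir = 1ℚ +i 0ℚ
hermEntry arc   = 0ℚ +i 1ℚ
hermEntry rev   = 0ℚ +i (Q.- 1ℚ)

H : ∀ {n} → MixedGraph n → Fin n → Fin n → ℚi
H M u v = hermEntry (ent M u v)

A : ∀ {n} → Graph n → Fin n → Fin n → ℚ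
A G u v = if adj G u v then 1ℚ else 0ℚ

Adj : ∀ {n} → Graph n → Fin n → Fin n → Set
Adj G u v = adj G u v ≡ true

numEdges : ∀ {n} → Graph n → ℕ
numEdges G = sumF (λ u → count (λ v → does (toℕ u <? toℕ v) ∧ adj G u v))

Reach : ∀ {n} → Graph n → Fin n → Fin n → Set
Reach G = Star (Adj G)

NumComponents : ∀ {n} → Graph n → ℕ → Set
NumComponents {n} G k =
  Σ (Fin n → Fin k) λ c → Surjective _≡_ _≡_ c ×
    (∀ u v → (c u ≡ c v) ⇔ Reach G u v)

-- d(G) = |E| - |V| + ω(G)  (always ≥ 0, so truncated subtraction is exact)
dim : ∀ {n} → Graph n → (ω : ℕ) → ℕ
dim {n} G ω = numEdges G + ω ∸ n

next : ∀ {m} → Fin (suc m) → Fin (suc m)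
next {zero}  zero    = zero
next {suc m} zero    = suc zero
next {suc m} (suc i) with next {m} i
... | zero  = zero
... | suc j = suc (suc j)

record Cycle {n} (G : Graph n) : Set where
  field
    k    : ℕ
    vert : Fin (3 + k) → Fin n
    inj  : Injective _≡_ _≡_ vert
    step : ∀ i → Adj G (vert i) (vert (next i))

  len : ℕ
  len = 3 + k

open Cycle public

OnCycle : ∀ {n} {G : Graph n} → Cycle G → Fin n → Set
OnCycle C v = ∃[ i ] vert C i ≡ v

CycleEdge : ∀ {n} {G : Graph n} → Cycle G → Fin n → Fin n → Set
CycleEdge C u v = ∃[ i ] ((vert C i ≡ u × vert C (next i) ≡ v) ⊎
                          (vert C i ≡ v × vert C (next i) ≡ u))

SameCycle : ∀ {n} {G : Graph n} → Cycle G → Cycle G → Set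
SameCycle C C' = ∀ u v → CycleEdge C u v ⇔ CycleEdge C' u v

CyclesVertexDisjoint : ∀ {n} → Graph n → Set
CyclesVertexDisjoint G =
  ∀ (C C' : Cycle G) → (∃[ v ] OnCycle C v × OnCycle C' v) → SameCycle C C'

isArc isRev : Entry → Bool
isArc arc = true
isArc _   = false
isRev rev = true
isRev _   = false

signature : ∀ {n} (M : MixedGraph n) → Cycle (underlying M) → ℕ
signature M C =
  ∣ count (λ i → isArc (ent M (vert C i) (vert C (next i))))
  - count (λ i → isRev (ent M (vert C i) (vert C (next i)))) ∣

CycleCondition : ∀ {n} → MixedGraph n → Set
CycleCondition M = ∀ (C : Cycle (underlying M)) →
  (len C % 4 ≡ 2) × (signature M C % 4 ≡ 2)

-- δ-transformations on induced subgraphs G[S], S : Fin n → Bool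

In : ∀ {n} → (Fin n → Bool) → Fin n → Set
In S v = S v ≡ true

degIn : ∀ {n} → Graph n → (Fin n → Bool) → Fin n → ℕ
degIn G S u = count (λ w → S w ∧ adj G u w)

Pendant : ∀ {n} → Graph n → (Fin n → Bool) → Fin n → Set
Pendant G S u = In S u × degIn G S u ≡ 1

Delta : ∀ {n} → Graph n → (Fin n → Bool) → (Fin n → Bool) → Set
Delta G S S' = ∃[ u ] ∃[ v ] Pendant G S u × In S v × Adj G u v ×
  (∀ w → S' w ≡ (S w ∧ not (does (w Data.Fin.≟ u)) ∧ not (does (w Data.Fin.≟ v))))

NoPendant : ∀ {n} → Graph n → (Fin n → Bool) → Set
NoPendant G S = ∀ u → ¬ Pendant G S u

UnionOfCyclesAndIsolated : ∀ {n} → Graph n → (Fin n → Bool) → ℕ → Set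
UnionOfCyclesAndIsolated G S c =
  Σ (Fin c → Cycle G) λ cyc →
    (∀ j i → In S (vert (cyc j) i)) ×
    (∀ j j' v → j ≢ j' → OnCycle (cyc j) v → ¬ OnCycle (cyc j') v) ×
    (∀ u v → In S u → In S v → Adj G u v → ∃[ j ] CycleEdge (cyc j) u v)

full : ∀ {n} → Fin n → Bool
full _ = true

CrucialCondition : ∀ {n} → Graph n → ℕ → Set
CrucialCondition G c =
  ∃[ S ] Star (Delta G) full S × NoPendant G S × UnionOfCyclesAndIsolated G S c

{-# OPTIONS --safe #-}

-- Deleting the row and column x of a Hermitian matrix M lowers the rank by 0, 1 or 2: by 0 exactly
-- when some kernel vector is nonzero at x, and by 2 exactly when M φ = e_x has a solution with
-- φ x = 0.  Deleting cycle vertices, each of which lowers d by at least one, until a forest is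
-- reached (where both ranks agree, by δ-transformations) gives r(G) ≤ rk(G̃) + 2 d(G).
--
-- If equality holds, every estimate is tight: deleting a cycle vertex x preserves equality, lowers r
-- by 2 and d by 1, and keeps rk.  Two cycles through x therefore use the same edges at x, as d would
-- drop by 2 otherwise, so the cycles are disjoint.  The neighbour of a pendant vertex lies on no
-- cycle, because deleting it lowers rk, so δ-transformations preserve equality and all cycles.  When
-- no pendant vertex is left, solve A φ = e_x with φ x = 0 for x on a cycle C.  As φ vanishes on the
-- cycles avoiding x, a non-backtracking walk from x on which φ is nonzero at every other vertex can
-- only close up at x.  Hence φ is nonzero at both neighbours p of x on C, and continuing the walk from
-- p along any edge shows that this edge belongs to C: the cycles are connected components.  Following
-- φ and a kernel vector of H around C yields the two congruences.
--
-- Conversely, δ-transformations change both ranks equally, and under the congruences the two vectors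
-- can be written down on each cycle; deleting one vertex per cycle then leaves a forest.

module Submission where

open import Defs
open import Level using (0ℓ)
open import Algebra.Bundles using (CommutativeRing)
open import Algebra.Bundles.Raw using (RawRing)
open import Algebra.Structures using (IsCommutativeRing)
import Algebra.Properties.CommutativeMonoid.Sum
import Algebra.Properties.Ring
import Algebra.Properties.Semiring.Mult
import Algebra.Properties.Semiring.Sum
import Algebra.Solver.Ring
open import Algebra.Solver.Ring.AlmostCommutativeRing using (fromCommutativeRing; _-Raw-AlmostCommutative⟶_)
open import Data.Bool using (Bool; true; false; _∧_; _∨_; not; if_then_else_)
import Data.Bool.Properties as Bool
open import Data.Empty using (⊥; ⊥-elim)
open import Data.Fin using (Fin; zero; suc; toℕ; fromℕ<; punchIn; punchOut; inject₁)
import Data.Fin.Properties as Fin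
open import Data.Maybe using (Maybe; just; nothing)
open import Data.Nat using (ℕ; zero; suc; _+_; _*_; _∸_; _≤_; _<_; z≤n; s≤s; _%_; _/_; ∣_-_∣)
import Data.Nat as ℕ
import Data.Nat.Properties as ℕ
import Data.Nat.DivMod as ℕ
open import Data.Product using (Σ; ∃; ∃-syntax; _×_; _,_; proj₁; proj₂)
open import Data.Rational using (ℚ; 0ℚ; 1ℚ)
import Data.Rational as Q
import Data.Rational.Properties as Q
open import Data.Sum using (_⊎_; inj₁; inj₂)
open import Data.Unit using (⊤; tt)
open import Function.Base using (_∘_; case_of_)
open import Function.Bundles using (_⇔_; mk⇔; Equivalence)
open import Function.Definitions using (Injective; Surjective)
open import Relation.Binary.Construct.Closure.ReflexiveTransitive using (Star; ε; _◅_; _◅◅_)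
open import Relation.Binary.PropositionalEquality using (_≡_; _≢_; refl; sym; trans; cong; cong₂; subst; subst₂; module ≡-Reasoning)
open import Relation.Binary.Definitions using (tri<; tri≈; tri>)
open import Relation.Nullary using (¬_; Dec; yes; no; does)
open import Relation.Nullary.Decidable using (dec-true; dec-false; ¬?; _×-dec_; _⊎-dec_)

-- `FieldWithConj` lets ℚ and ℚ(i) share every rank argument: with the identity as conjugation,
-- symmetric matrices over ℚ are Hermitian. Minors are awkward to compare before and after a
-- deletion, so rank is rephrased once, in `isRank⇒rank`, by two certificates that can be
-- transformed explicitly: functionals bounding it from above and vectors bounding it from below.
--
-- The deletion criteria rest on one pairing: if M φ = e_x, then φ* M v = v_x for every v, so kernel
-- vectors vanish at x, and the x-coordinate of v can be read off from M v.
--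
-- The residue 2 modulo 4 has a single source. In A φ = e_x and in H ψ = 0, values two steps apart
-- on the cycle are opposite, for H after multiplication by the product of the weights passed. Going
-- once around a length that is twice an odd number reverses the sign. For H the product of all the
-- weights must then be -1, and this product is i to the power f - b.

-- Fields with an involution and their ring solver

record FieldWithConj : Set₁ where
  field
    rawRing : RawRing 0ℓ 0ℓ
  open RawRing rawRing using (Carrier; 0#; 1#) renaming (_+_ to _⊕_; _*_ to _⊗_; -_ to ⊖_) public
  field
    isCommutativeRing : IsCommutativeRing _≡_ _⊕_ _⊗_ ⊖_ 0# 1#
    _≟_ : (x y : Carrier) → Dec (x ≡ y)
    inverse : ∀ x → x ≢ 0# → ∃[ y ] x ⊗ y ≡ 1#
    1≢0 : 1# ≢ 0#
    conj : Carrier → Carrier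
    conj-⊕ : ∀ x y → conj (x ⊕ y) ≡ conj x ⊕ conj y
    conj-⊗ : ∀ x y → conj (x ⊗ y) ≡ conj x ⊗ conj y
    conj-conj : ∀ x → conj (conj x) ≡ x

module RingSolver (F : FieldWithConj) where
  open FieldWithConj F

  commutativeRing : CommutativeRing 0ℓ 0ℓ
  commutativeRing = record { isCommutativeRing = isCommutativeRing }

  module R = CommutativeRing commutativeRing
  private
    module Mult = Algebra.Properties.Semiring.Mult R.semiring
    module RP = Algebra.Properties.Ring R.ring

  -- Coefficients of the ring solver: the pair (m , n) denotes m − n.
  module Solver where
    coefficients : RawRing 0ℓ 0ℓ
    coefficients = record
      { Carrier = ℕ × ℕ
      ; _≈_ = _≡_
      ; _+_ = λ (a , b) (c , d) → a + c , b + d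
      ; _*_ = λ (a , b) (c , d) → a * c + b * d , a * d + b * c
      ; -_ = λ (a , b) → b , a
      ; 0# = 0 , 0
      ; 1# = 1 , 0
      }

    nat : ℕ → Carrier
    nat n = n Mult.× 1#

    value : ℕ × ℕ → Carrier
    value (a , b) = nat a ⊕ (⊖ nat b)

    nat-+ : ∀ a b → nat (a + b) ≡ nat a ⊕ nat b
    nat-+ a b = Mult.×-homo-+ 1# a b

    nat-* : ∀ a b → nat (a * b) ≡ nat a ⊗ nat b
    nat-* a b = Mult.×1-homo-* a b

    interchange : ∀ a b c d → (a ⊕ b) ⊕ (c ⊕ d) ≡ (a ⊕ c) ⊕ (b ⊕ d)
    interchange a b c d = begin
      (a ⊕ b) ⊕ (c ⊕ d) ≡⟨ R.+-assoc a b (c ⊕ d) ⟩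
      a ⊕ (b ⊕ (c ⊕ d)) ≡⟨ cong (a ⊕_) (sym (R.+-assoc b c d)) ⟩
      a ⊕ ((b ⊕ c) ⊕ d) ≡⟨ cong (λ z → a ⊕ (z ⊕ d)) (R.+-comm b c) ⟩
      a ⊕ ((c ⊕ b) ⊕ d) ≡⟨ cong (a ⊕_) (R.+-assoc c b d) ⟩
      a ⊕ (c ⊕ (b ⊕ d)) ≡⟨ sym (R.+-assoc a c (b ⊕ d)) ⟩
      (a ⊕ c) ⊕ (b ⊕ d) ∎
      where open ≡-Reasoning

    neg-⊕ : ∀ a b → ⊖ (a ⊕ b) ≡ (⊖ a) ⊕ (⊖ b)
    neg-⊕ a b = sym (RP.-‿+-comm a b)

    value-+ : ∀ x y → value (RawRing._+_ coefficients x y) ≡ value x ⊕ value y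
    value-+ (a , b) (c , d) = begin
      nat (a + c) ⊕ (⊖ nat (b + d)) ≡⟨ cong₂ (λ p q → p ⊕ (⊖ q)) (nat-+ a c) (nat-+ b d) ⟩
      (nat a ⊕ nat c) ⊕ (⊖ (nat b ⊕ nat d)) ≡⟨ cong ((nat a ⊕ nat c) ⊕_) (neg-⊕ (nat b) (nat d)) ⟩
      (nat a ⊕ nat c) ⊕ ((⊖ nat b) ⊕ (⊖ nat d)) ≡⟨ interchange _ _ _ _ ⟩
      value (a , b) ⊕ value (c , d) ∎
      where open ≡-Reasoning

    value-* : ∀ x y → value (RawRing._*_ coefficients x y) ≡ value x ⊗ value y
    value-* (a , b) (c , d) = begin
      nat (a * c + b * d) ⊕ (⊖ nat (a * d + b * c))
        ≡⟨ cong₂ (λ p q → p ⊕ (⊖ q)) (homo a c b d) (homo a d b c) ⟩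
      (α ⊗ γ ⊕ β ⊗ δ) ⊕ (⊖ (α ⊗ δ ⊕ β ⊗ γ))
        ≡⟨ cong ((α ⊗ γ ⊕ β ⊗ δ) ⊕_) (neg-⊕ _ _) ⟩
      (α ⊗ γ ⊕ β ⊗ δ) ⊕ ((⊖ (α ⊗ δ)) ⊕ (⊖ (β ⊗ γ)))
        ≡⟨ cong₂ (λ p q → (α ⊗ γ ⊕ p) ⊕ q) neg-neg (cong₂ _⊕_ (RP.-‿distribʳ-* α δ) (RP.-‿distribˡ-* β γ)) ⟩
      (α ⊗ γ ⊕ (⊖ β) ⊗ (⊖ δ)) ⊕ (α ⊗ (⊖ δ) ⊕ (⊖ β) ⊗ γ)
        ≡⟨ cong ((α ⊗ γ ⊕ (⊖ β) ⊗ (⊖ δ)) ⊕_) (R.+-comm _ _) ⟩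
      (α ⊗ γ ⊕ (⊖ β) ⊗ (⊖ δ)) ⊕ ((⊖ β) ⊗ γ ⊕ α ⊗ (⊖ δ))
        ≡⟨ interchange _ _ _ _ ⟩
      (α ⊗ γ ⊕ (⊖ β) ⊗ γ) ⊕ ((⊖ β) ⊗ (⊖ δ) ⊕ α ⊗ (⊖ δ))
        ≡⟨ cong₂ _⊕_ (sym (R.distribʳ γ α (⊖ β))) (trans (R.+-comm _ _) (sym (R.distribʳ (⊖ δ) α (⊖ β)))) ⟩
      (α ⊕ (⊖ β)) ⊗ γ ⊕ (α ⊕ (⊖ β)) ⊗ (⊖ δ)
        ≡⟨ sym (R.distribˡ (α ⊕ (⊖ β)) γ (⊖ δ)) ⟩
      (α ⊕ (⊖ β)) ⊗ (γ ⊕ (⊖ δ)) ∎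
      where
      open ≡-Reasoning
      α β γ δ : Carrier
      α = nat a
      β = nat b
      γ = nat c
      δ = nat d
      homo : ∀ p q r s → nat (p * q + r * s) ≡ nat p ⊗ nat q ⊕ nat r ⊗ nat s
      homo p q r s = trans (nat-+ (p * q) (r * s)) (cong₂ _⊕_ (nat-* p q) (nat-* r s))
      neg-neg : β ⊗ δ ≡ (⊖ β) ⊗ (⊖ δ)
      neg-neg = trans (sym (RP.-‿involutive _))
        (trans (cong ⊖_ (RP.-‿distribʳ-* β δ)) (RP.-‿distribˡ-* β (⊖ δ)))

    value-neg : ∀ x → value (RawRing.-_ coefficients x) ≡ ⊖ value x
    value-neg (a , b) = sym (trans (neg-⊕ _ _)
      (trans (cong ((⊖ nat a) ⊕_) (RP.-‿involutive _)) (R.+-comm _ _)))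

    morphism : coefficients -Raw-AlmostCommutative⟶ fromCommutativeRing commutativeRing
    morphism = record
      { ⟦_⟧ = value
      ; +-homo = value-+
      ; *-homo = value-*
      ; -‿homo = value-neg
      ; 0-homo = R.-‿inverseʳ 0#
      ; 1-homo = trans (cong₂ (λ p q → p ⊕ q) (R.+-identityʳ 1#) RP.-0#≈0#) (R.+-identityʳ 1#)
      }

    cancel : ∀ a b c d → a + d ≡ c + b → value (a , b) ≡ value (c , d)
    cancel a b c d eq = begin
      nat a ⊕ (⊖ nat b) ≡⟨ pad a b d ⟩
      nat (a + d) ⊕ ((⊖ nat b) ⊕ (⊖ nat d)) ≡⟨ cong₂ _⊕_ (cong nat eq) (R.+-comm _ _) ⟩
      nat (c + b) ⊕ ((⊖ nat d) ⊕ (⊖ nat b)) ≡⟨ sym (pad c d b) ⟩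
      nat c ⊕ (⊖ nat d) ∎
      where
      open ≡-Reasoning
      pad : ∀ p q r → value (p , q) ≡ nat (p + r) ⊕ ((⊖ nat q) ⊕ (⊖ nat r))
      pad p q r = begin
        nat p ⊕ (⊖ nat q) ≡⟨ sym (R.+-identityʳ _) ⟩
        (nat p ⊕ (⊖ nat q)) ⊕ 0# ≡⟨ cong ((nat p ⊕ (⊖ nat q)) ⊕_) (sym (R.-‿inverseʳ (nat r))) ⟩
        (nat p ⊕ (⊖ nat q)) ⊕ (nat r ⊕ (⊖ nat r)) ≡⟨ interchange _ _ _ _ ⟩
        (nat p ⊕ nat r) ⊕ ((⊖ nat q) ⊕ (⊖ nat r)) ≡⟨ cong (_⊕ ((⊖ nat q) ⊕ (⊖ nat r))) (sym (nat-+ p r)) ⟩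
        nat (p + r) ⊕ ((⊖ nat q) ⊕ (⊖ nat r)) ∎

    decide : ∀ x y → Maybe (value x ≡ value y)
    decide (a , b) (c , d) with a + d ℕ.≟ c + b
    ... | yes eq = just (cancel a b c d eq)
    ... | no _ = nothing

    open Algebra.Solver.Ring coefficients (fromCommutativeRing commutativeRing) morphism decide public
      using (solve; _:=_; _:+_; _:*_; :-_)

-- Linear algebra and certificates for the rank

module Vectors (F : FieldWithConj) where
  open FieldWithConj F public
  open RingSolver F using (commutativeRing; module R; module Solver) public
  open Solver using (solve; _:=_; _:+_; _:*_; :-_) public
  open Algebra.Properties.CommutativeMonoid.Sum R.+-commutativeMonoid public
    using (sum; sum-cong-≗; ∑-distrib-+; ∑-comm; sum-replicate-zero)
  open Algebra.Properties.Semiring.Sum R.semiring public using (*-distribˡ-sum)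
  module RP = Algebra.Properties.Ring R.ring

  Vect : ℕ → Set
  Vect n = Fin n → Carrier

  Matrix : ℕ → ℕ → Set
  Matrix m n = Fin m → Vect n

  0⊕0≡0 : 0# ⊕ 0# ≡ 0#
  0⊕0≡0 = R.+-identityˡ 0#

  ⊗-zero-product : ∀ {x y} → x ≢ 0# → x ⊗ y ≡ 0# → y ≡ 0#
  ⊗-zero-product {x} {y} x≢0 xy≡0 with inverse x x≢0
  ... | x⁻¹ , xx⁻¹≡1 = begin
    y ≡⟨ sym (R.*-identityˡ y) ⟩
    1# ⊗ y ≡⟨ cong (_⊗ y) (sym xx⁻¹≡1) ⟩
    x ⊗ x⁻¹ ⊗ y ≡⟨ solve 3 (λ a b c → a :* b :* c := b :* (a :* c)) refl x x⁻¹ y ⟩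
    x⁻¹ ⊗ (x ⊗ y) ≡⟨ cong (x⁻¹ ⊗_) xy≡0 ⟩
    x⁻¹ ⊗ 0# ≡⟨ R.zeroʳ x⁻¹ ⟩
    0# ∎
    where open ≡-Reasoning

  sum-zero : ∀ {n} {f : Vect n} → (∀ i → f i ≡ 0#) → sum f ≡ 0#
  sum-zero {n} f≡0 = trans (sum-cong-≗ f≡0) (sum-replicate-zero n)

  sum-at : ∀ {n} (i : Fin n) {f : Vect n} → (∀ j → j ≢ i → f j ≡ 0#) → sum f ≡ f i
  sum-at zero {f} h =
    trans (cong (f zero ⊕_) (sum-zero (λ j → h (suc j) λ ()))) (R.+-identityʳ _)
  sum-at (suc i) {f} h =
    trans (cong₂ _⊕_ (h zero λ ()) (sum-at i (λ j j≢i → h (suc j) (j≢i ∘ Fin.suc-injective))))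
      (R.+-identityˡ _)

  sum-at-two : ∀ {n} {a b : Fin n} → a ≢ b → {f : Vect n} →
    (∀ j → j ≢ a → j ≢ b → f j ≡ 0#) → sum f ≡ f a ⊕ f b
  sum-at-two {a = zero} {zero} a≢b h = ⊥-elim (a≢b refl)
  sum-at-two {a = zero} {suc b} a≢b {f} h =
    cong (f zero ⊕_) (sum-at b (λ j j≢b → h (suc j) (λ ()) (j≢b ∘ Fin.suc-injective)))
  sum-at-two {a = suc a} {zero} a≢b {f} h =
    trans (cong (f zero ⊕_) (sum-at a (λ j j≢a → h (suc j) (j≢a ∘ Fin.suc-injective) λ ())))
      (R.+-comm _ _)
  sum-at-two {a = suc a} {suc b} a≢b {f} h =
    trans (cong₂ _⊕_ (h zero (λ ()) (λ ()))
      (sum-at-two (a≢b ∘ cong suc)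
        (λ j j≢a j≢b → h (suc j) (j≢a ∘ Fin.suc-injective) (j≢b ∘ Fin.suc-injective))))
      (R.+-identityˡ _)

  dot : ∀ {n} → Vect n → Vect n → Carrier
  dot q v = sum (λ i → q i ⊗ v i)

  dot-cong : ∀ {n} {q q′ v v′ : Vect n} → (∀ i → q i ≡ q′ i) → (∀ i → v i ≡ v′ i) →
    dot q v ≡ dot q′ v′
  dot-cong q≗q′ v≗v′ = sum-cong-≗ (λ i → cong₂ _⊗_ (q≗q′ i) (v≗v′ i))

  dot-congˡ : ∀ {n} {q q′ v : Vect n} → (∀ i → q i ≡ q′ i) → dot q v ≡ dot q′ v
  dot-congˡ h = dot-cong h (λ _ → refl)

  dot-congʳ : ∀ {n} {q v v′ : Vect n} → (∀ i → v i ≡ v′ i) → dot q v ≡ dot q v′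
  dot-congʳ h = dot-cong (λ _ → refl) h

  dot-comm : ∀ {n} (q v : Vect n) → dot q v ≡ dot v q
  dot-comm q v = sum-cong-≗ (λ i → R.*-comm (q i) (v i))

  dot-⊕ʳ : ∀ {n} (q v w : Vect n) → dot q (λ i → v i ⊕ w i) ≡ dot q v ⊕ dot q w
  dot-⊕ʳ q v w = trans (sum-cong-≗ (λ i → R.distribˡ (q i) (v i) (w i)))
    (∑-distrib-+ (λ i → q i ⊗ v i) (λ i → q i ⊗ w i))

  dot-⊗ʳ : ∀ {n} a (q v : Vect n) → dot q (λ i → a ⊗ v i) ≡ a ⊗ dot q v
  dot-⊗ʳ a q v = trans
    (sum-cong-≗ (λ i → solve 3 (λ q a v → q :* (a :* v) := a :* (q :* v)) refl (q i) a (v i)))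
    (sym (*-distribˡ-sum a (λ i → q i ⊗ v i)))

  dot-axpyʳ : ∀ {n} (q v : Vect n) a (w : Vect n) →
    dot q (λ i → v i ⊕ a ⊗ w i) ≡ dot q v ⊕ a ⊗ dot q w
  dot-axpyʳ q v a w = trans (dot-⊕ʳ q v (λ i → a ⊗ w i)) (cong (dot q v ⊕_) (dot-⊗ʳ a q w))

  dot-axpyˡ : ∀ {n} (q : Vect n) a (r v : Vect n) →
    dot (λ i → q i ⊕ a ⊗ r i) v ≡ dot q v ⊕ a ⊗ dot r v
  dot-axpyˡ q a r v = trans (dot-comm _ v) (trans (dot-axpyʳ v q a r)
    (cong₂ (λ x y → x ⊕ a ⊗ y) (dot-comm v q) (dot-comm v r)))

  dot-zeroʳ : ∀ {n} (q : Vect n) {v : Vect n} → (∀ i → v i ≡ 0#) → dot q v ≡ 0#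
  dot-zeroʳ q h = sum-zero (λ i → trans (cong (q i ⊗_) (h i)) (R.zeroʳ _))

  dot-zeroˡ : ∀ {n} {q : Vect n} (v : Vect n) → (∀ i → q i ≡ 0#) → dot q v ≡ 0#
  dot-zeroˡ v h = sum-zero (λ i → trans (cong (_⊗ v i) (h i)) (R.zeroˡ _))

  dot-supportedʳ : ∀ {n} (q : Vect n) {v : Vect n} i → (∀ j → j ≢ i → v j ≡ 0#) →
    dot q v ≡ q i ⊗ v i
  dot-supportedʳ q i h = sum-at i (λ j j≢i → trans (cong (q j ⊗_) (h j j≢i)) (R.zeroʳ _))

  basis : ∀ {n} → Fin n → Vect n
  basis i j = if does (i Fin.≟ j) then 1# else 0#

  basis-self : ∀ {n} (i : Fin n) → basis i i ≡ 1#
  basis-self i = cong (if_then 1# else 0#) (dec-true (i Fin.≟ i) refl)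

  basis-other : ∀ {n} {i j : Fin n} → j ≢ i → basis i j ≡ 0#
  basis-other {i = i} {j} j≢i = cong (if_then 1# else 0#) (dec-false (i Fin.≟ j) (j≢i ∘ sym))

  dot-basisʳ : ∀ {n} (q : Vect n) i → dot q (basis i) ≡ q i
  dot-basisʳ q i = trans (dot-supportedʳ q i (λ j → basis-other))
    (trans (cong (q i ⊗_) (basis-self i)) (R.*-identityʳ _))

  dot-basisˡ : ∀ {n} i (v : Vect n) → dot (basis i) v ≡ v i
  dot-basisˡ i v = trans (dot-comm _ v) (dot-basisʳ v i)

  lin : ∀ {k n} → Vect k → (Fin k → Vect n) → Vect n
  lin c y i = sum (λ t → c t ⊗ y t i)

  dot-lin : ∀ {k n} (q : Vect n) (c : Vect k) (y : Fin k → Vect n) →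
    dot q (lin c y) ≡ sum (λ t → c t ⊗ dot q (y t))
  dot-lin {k} {n} q c y = begin
    sum (λ i → q i ⊗ sum (λ t → c t ⊗ y t i))
      ≡⟨ sum-cong-≗ (λ i → *-distribˡ-sum (q i) (λ t → c t ⊗ y t i)) ⟩
    sum (λ i → sum (λ t → q i ⊗ (c t ⊗ y t i)))
      ≡⟨ ∑-comm {n} {k} (λ i t → q i ⊗ (c t ⊗ y t i)) ⟩
    sum (λ t → sum (λ i → q i ⊗ (c t ⊗ y t i)))
      ≡⟨ sum-cong-≗ (λ t → dot-⊗ʳ (c t) q (y t)) ⟩
    sum (λ t → c t ⊗ dot q (y t)) ∎
    where open ≡-Reasoning

  findNonzero : ∀ {n} (v : Vect n) → (∃[ i ] v i ≢ 0#) ⊎ (∀ i → v i ≡ 0#)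
  findNonzero v with Fin.any? (λ i → ¬? (v i ≟ 0#))
  ... | yes nonzero = inj₁ nonzero
  ... | no allZero = inj₂ λ i → case v i ≟ 0# of λ where
    (yes z) → z
    (no nz) → ⊥-elim (allZero (i , nz))

  -- Gaussian elimination: a pivot in the first column removes one equation and one unknown, whose
  -- value is then forced. If the first column is zero, the first basis vector is a solution.
  nontrivial-solution : ∀ {m k} → m < k → (a : Matrix m k) →
    ∃[ c ] (∃[ j ] c j ≢ 0#) × (∀ t → dot (a t) c ≡ 0#)
  nontrivial-solution {zero} {suc k} _ a = (λ _ → 1#) , (zero , 1≢0) , λ ()
  nontrivial-solution {suc m} {suc k} (s≤s m<k) a with findNonzero (λ t → a t zero)
  ... | inj₂ column≡0 = basis zero , (zero , (1≢0 ∘ trans (sym (basis-self {suc k} zero)))) ,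
        λ t → trans (dot-basisʳ (a t) zero) (column≡0 t)
  ... | inj₁ (p , ap≢0) with inverse (a p zero) ap≢0
  ...   | w , apw≡1 = c , (suc j , cj≢0) , solves
    where
    open ≡-Reasoning
    row : Vect k
    row i = a p (suc i)
    reduced : Matrix m k
    reduced t i = a (punchIn p t) (suc i) ⊕ (⊖ (a (punchIn p t) zero ⊗ w)) ⊗ row i
    IH : ∃[ c ] (∃[ j ] c j ≢ 0#) × (∀ t → dot (reduced t) c ≡ 0#)
    IH = nontrivial-solution m<k reduced
    c′ : Vect k
    c′ = proj₁ IH
    j : Fin k
    j = proj₁ (proj₁ (proj₂ IH))
    cj≢0 : c′ j ≢ 0#
    cj≢0 = proj₂ (proj₁ (proj₂ IH))
    c : Vect (suc k)
    c zero = ⊖ (w ⊗ dot row c′)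
    c (suc i) = c′ i
    solves-p : dot (a p) c ≡ 0#
    solves-p = begin
      a p zero ⊗ (⊖ (w ⊗ dot row c′)) ⊕ dot row c′
        ≡⟨ solve 3 (λ x w d → x :* (:- (w :* d)) :+ d := (:- ((x :* w) :* d)) :+ d) refl (a p zero) w (dot row c′) ⟩
      (⊖ (a p zero ⊗ w ⊗ dot row c′)) ⊕ dot row c′
        ≡⟨ cong (λ z → (⊖ (z ⊗ dot row c′)) ⊕ dot row c′) apw≡1 ⟩
      (⊖ (1# ⊗ dot row c′)) ⊕ dot row c′ ≡⟨ cong (λ z → (⊖ z) ⊕ dot row c′) (R.*-identityˡ _) ⟩
      (⊖ dot row c′) ⊕ dot row c′ ≡⟨ R.-‿inverseˡ _ ⟩
      0# ∎
    solves-other : ∀ t → dot (a (punchIn p t)) c ≡ 0#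
    solves-other t = begin
      x ⊗ (⊖ (w ⊗ dot row c′)) ⊕ d
        ≡⟨ solve 4 (λ x w r d → x :* (:- (w :* r)) :+ d := d :+ (:- (x :* w)) :* r) refl x w (dot row c′) d ⟩
      d ⊕ (⊖ (x ⊗ w)) ⊗ dot row c′
        ≡⟨ sym (dot-axpyˡ (λ i → a (punchIn p t) (suc i)) (⊖ (x ⊗ w)) row c′) ⟩
      dot (reduced t) c′ ≡⟨ proj₂ (proj₂ IH) t ⟩
      0# ∎
      where
      x d : Carrier
      x = a (punchIn p t) zero
      d = dot (λ i → a (punchIn p t) (suc i)) c′
    solves : ∀ t → dot (a t) c ≡ 0#
    solves t with p Fin.≟ t
    ... | yes refl = solves-p
    ... | no p≢t = subst (λ s → dot (a s) c ≡ 0#) (Fin.punchIn-punchOut p≢t) (solves-other (punchOut p≢t))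

  -- The Fredholm alternative by induction on the rows: either `b` lies in the row space, or a
  -- vector orthogonal to all rows witnesses that it does not. It replaces any choice of bases.
  fredholm : ∀ {m n} (q : Matrix m n) (b : Vect n) →
    (∃[ φ ] ∀ i → b i ≡ lin φ q i) ⊎ (∃[ ψ ] (∀ t → dot (q t) ψ ≡ 0#) × dot b ψ ≢ 0#)
  fredholm {zero} q b with findNonzero b
  ... | inj₁ (i , bi≢0) = inj₂ (basis i , (λ ()) , (bi≢0 ∘ trans (sym (dot-basisʳ b i))))
  ... | inj₂ b≡0 = inj₁ ((λ ()) , b≡0)
  fredholm {suc m} {n} q b with fredholm (q ∘ suc) b
  ... | inj₁ (φ , b≡) = inj₁ (φ′ , λ i → trans (b≡ i)
          (sym (trans (cong (_⊕ lin φ (q ∘ suc) i) (R.zeroˡ _)) (R.+-identityˡ _))))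
    where
    φ′ : Vect (suc m)
    φ′ zero = 0#
    φ′ (suc t) = φ t
  ... | inj₂ (ψ , qψ≡0 , bψ≢0) with dot (q zero) ψ ≟ 0#
  ...   | yes q₀ψ≡0 = inj₂ (ψ , (λ { zero → q₀ψ≡0 ; (suc t) → qψ≡0 t }) , bψ≢0)
  ...   | no q₀ψ≢0 with inverse (dot (q zero) ψ) q₀ψ≢0
  -- `ψ` separates `b` from the later rows but is not orthogonal to `q zero`. The multiple of
  -- `q zero` that makes the difference orthogonal to `ψ` is subtracted from `b`, and the later rows
  -- are tried again. A new witness `χ` is corrected by a multiple of `ψ` to kill `q zero`.
  ...     | w , xw≡1 with fredholm (q ∘ suc) (λ i → b i ⊕ (⊖ (dot b ψ ⊗ w)) ⊗ q zero i)
  ...       | inj₁ (φ , b′≡) = inj₁ (φ′ , λ i → trans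
                (solve 3 (λ b s q → b := s :* q :+ (b :+ (:- s) :* q)) refl (b i) (dot b ψ ⊗ w) (q zero i))
                (cong (dot b ψ ⊗ w ⊗ q zero i ⊕_) (b′≡ i)))
    where
    φ′ : Vect (suc m)
    φ′ zero = dot b ψ ⊗ w
    φ′ (suc t) = φ t
  ...       | inj₂ (χ , qχ≡0 , b′χ≢0) = inj₂ (ξ , kills , λ bξ≡0 → b′χ≢0 (trans same bξ≡0))
    where
    open ≡-Reasoning
    x y : Carrier
    x = dot (q zero) ψ
    y = dot (q zero) χ
    ξ : Vect n
    ξ i = χ i ⊕ (⊖ (y ⊗ w)) ⊗ ψ i
    kills : ∀ t → dot (q t) ξ ≡ 0#
    kills zero = begin
      dot (q zero) ξ ≡⟨ dot-axpyʳ (q zero) χ (⊖ (y ⊗ w)) ψ ⟩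
      y ⊕ (⊖ (y ⊗ w)) ⊗ x ≡⟨ solve 3 (λ y w x → y :+ (:- (y :* w)) :* x := y :+ (:- (y :* (x :* w)))) refl y w x ⟩
      y ⊕ (⊖ (y ⊗ (x ⊗ w))) ≡⟨ cong (λ z → y ⊕ (⊖ z)) (trans (cong (y ⊗_) xw≡1) (R.*-identityʳ y)) ⟩
      y ⊕ (⊖ y) ≡⟨ R.-‿inverseʳ y ⟩
      0# ∎
    kills (suc t) = begin
      dot (q (suc t)) ξ ≡⟨ dot-axpyʳ (q (suc t)) χ (⊖ (y ⊗ w)) ψ ⟩
      dot (q (suc t)) χ ⊕ (⊖ (y ⊗ w)) ⊗ dot (q (suc t)) ψ ≡⟨ cong₂ (λ p r → p ⊕ (⊖ (y ⊗ w)) ⊗ r) (qχ≡0 t) (qψ≡0 t) ⟩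
      0# ⊕ (⊖ (y ⊗ w)) ⊗ 0# ≡⟨ trans (R.+-identityˡ _) (R.zeroʳ _) ⟩
      0# ∎
    same : dot (λ i → b i ⊕ (⊖ (dot b ψ ⊗ w)) ⊗ q zero i) χ ≡ dot b ξ
    same = begin
      dot (λ i → b i ⊕ (⊖ (dot b ψ ⊗ w)) ⊗ q zero i) χ ≡⟨ dot-axpyˡ b (⊖ (dot b ψ ⊗ w)) (q zero) χ ⟩
      dot b χ ⊕ (⊖ (dot b ψ ⊗ w)) ⊗ y
        ≡⟨ solve 4 (λ c d w y → c :+ (:- (d :* w)) :* y := c :+ (:- (y :* w)) :* d) refl (dot b χ) (dot b ψ) w y ⟩
      dot b χ ⊕ (⊖ (y ⊗ w)) ⊗ dot b ψ ≡⟨ sym (dot-axpyʳ b χ (⊖ (y ⊗ w)) ψ) ⟩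
      dot b ξ ∎

  -- The kernel of M contains the common kernel of r functionals, respectively
  -- M is injective on the span of r vectors.
  RankAtMost : ∀ {m n} → Matrix m n → ℕ → Set
  RankAtMost {m} {n} M r =
    Σ (Matrix r n) λ Q → ∀ v → (∀ t → dot (Q t) v ≡ 0#) → ∀ u → dot (M u) v ≡ 0#

  RankAtLeast : ∀ {m n} → Matrix m n → ℕ → Set
  RankAtLeast {m} {n} M r =
    Σ (Fin r → Vect n) λ y → ∀ c → (∀ u → dot (M u) (lin c y) ≡ 0#) → ∀ t → c t ≡ 0#

  Rank : ∀ {m n} → Matrix m n → ℕ → Set
  Rank M r = RankAtMost M r × RankAtLeast M r

  -- With fewer functionals than vectors, a nontrivial combination of the vectors is killed by all
  -- functionals, hence by `M`.
  atLeast≤atMost : ∀ {m n} {M : Matrix m n} {k r} → RankAtLeast M k → RankAtMost M r → k ≤ r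
  atLeast≤atMost {k = k} {r} (y , independent) (Q , bound) with r ℕ.<? k
  ... | no r≮k = ℕ.≮⇒≥ r≮k
  ... | yes r<k with nontrivial-solution r<k (λ t j → dot (Q t) (y j))
  ...   | c , (j , cj≢0) , solves = ⊥-elim (cj≢0 (independent c (bound (lin c y) Qc≡0) j))
    where
    Qc≡0 : ∀ t → dot (Q t) (lin c y) ≡ 0#
    Qc≡0 t = trans (dot-lin (Q t) c y)
      (trans (sum-cong-≗ (λ s → R.*-comm (c s) (dot (Q t) (y s)))) (solves t))

  rank-unique : ∀ {m n} {M : Matrix m n} {r s} → Rank M r → Rank M s → r ≡ s
  rank-unique (U , L) (U′ , L′) = ℕ.≤-antisym (atLeast≤atMost L U′) (atLeast≤atMost L′ U)

  -- Induction on the rows. A first row in the span of the others changes neither certificate.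
  -- Otherwise the separating vector `ψ` extends the lower one and the row itself the upper one.
  rank-exists : ∀ {m n} (M : Matrix m n) → ∃ (Rank M)
  rank-exists {zero} M = 0 , ((λ ()) , λ v _ ()) , ((λ ()) , λ c _ ())
  rank-exists {suc m} {n} M with rank-exists (M ∘ suc) | fredholm (M ∘ suc) (M zero)
  ... | r , (Q , bound) , (y , independent) | inj₁ (φ , M₀≡) =
        r , (Q , bound′) , (y , λ c Mc≡0 → independent c (Mc≡0 ∘ suc))
    where
    bound′ : ∀ v → (∀ t → dot (Q t) v ≡ 0#) → ∀ u → dot (M u) v ≡ 0#
    bound′ v Qv≡0 (suc u) = bound v Qv≡0 u
    bound′ v Qv≡0 zero = trans (dot-congˡ M₀≡) (trans (dot-comm _ v) (trans (dot-lin v φ (M ∘ suc))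
      (sum-zero (λ t → trans (cong (φ t ⊗_) (trans (dot-comm v _) (bound v Qv≡0 t))) (R.zeroʳ _)))))
  ... | r , (Q , bound) , (y , independent) | inj₂ (ψ , Mψ≡0 , M₀ψ≢0) =
        suc r , (Q′ , bound′) , (y′ , independent′)
    where
    open ≡-Reasoning
    Q′ : Matrix (suc r) n
    Q′ zero = M zero
    Q′ (suc t) = Q t
    bound′ : ∀ v → (∀ t → dot (Q′ t) v ≡ 0#) → ∀ u → dot (M u) v ≡ 0#
    bound′ v Q′v≡0 zero = Q′v≡0 zero
    bound′ v Q′v≡0 (suc u) = bound v (Q′v≡0 ∘ suc) u
    y′ : Fin (suc r) → Vect n
    y′ zero = ψ
    y′ (suc t) = y t
    independent′ : ∀ c → (∀ u → dot (M u) (lin c y′) ≡ 0#) → ∀ t → c t ≡ 0#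
    independent′ c Mc≡0 = coefficients
      where
      expand : ∀ u → dot (M u) (lin c y′) ≡ c zero ⊗ dot (M u) ψ ⊕ dot (M u) (lin (c ∘ suc) y)
      expand u = trans (dot-⊕ʳ (M u) (λ i → c zero ⊗ ψ i) (lin (c ∘ suc) y))
        (cong (_⊕ dot (M u) (lin (c ∘ suc) y)) (dot-⊗ʳ (c zero) (M u) ψ))
      rest : ∀ t → c (suc t) ≡ 0#
      rest = independent (c ∘ suc) λ u → begin
        dot (M (suc u)) (lin (c ∘ suc) y) ≡⟨ sym (R.+-identityˡ _) ⟩
        0# ⊕ dot (M (suc u)) (lin (c ∘ suc) y)
          ≡⟨ cong (_⊕ dot (M (suc u)) (lin (c ∘ suc) y)) (sym (trans (cong (c zero ⊗_) (Mψ≡0 u)) (R.zeroʳ _))) ⟩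
        c zero ⊗ dot (M (suc u)) ψ ⊕ dot (M (suc u)) (lin (c ∘ suc) y) ≡⟨ sym (expand (suc u)) ⟩
        dot (M (suc u)) (lin c y′) ≡⟨ Mc≡0 (suc u) ⟩
        0# ∎
      coefficients : ∀ t → c t ≡ 0#
      coefficients (suc t) = rest t
      coefficients zero = ⊗-zero-product M₀ψ≢0 (begin
        dot (M zero) ψ ⊗ c zero ≡⟨ R.*-comm _ _ ⟩
        c zero ⊗ dot (M zero) ψ ≡⟨ sym (R.+-identityʳ _) ⟩
        c zero ⊗ dot (M zero) ψ ⊕ 0# ≡⟨ cong (c zero ⊗ dot (M zero) ψ ⊕_) (sym (dot-zeroʳ (M zero)
          (λ i → sum-zero (λ t → trans (cong (_⊗ y t i) (rest t)) (R.zeroˡ _))))) ⟩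
        c zero ⊗ dot (M zero) ψ ⊕ dot (M zero) (lin (c ∘ suc) y) ≡⟨ sym (expand zero) ⟩
        dot (M zero) (lin c y′) ≡⟨ Mc≡0 zero ⟩
        0# ∎)

  rank-cong : ∀ {m n} {M N : Matrix m n} {r} → (∀ u v → M u v ≡ N u v) → Rank M r → Rank N r
  rank-cong M≗N ((Q , bound) , (y , independent)) =
    (Q , λ v Qv≡0 u → trans (dot-congˡ (λ i → sym (M≗N u i))) (bound v Qv≡0 u)) ,
    (y , λ c Nc≡0 → independent c (λ u → trans (dot-congˡ (M≗N u)) (Nc≡0 u)))

  rank-zero : ∀ {m n} {M : Matrix m n} → (∀ u v → M u v ≡ 0#) → Rank M 0
  rank-zero M≡0 = ((λ ()) , λ v _ u → dot-zeroˡ v (M≡0 u)) , ((λ ()) , λ c _ ())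

-- Determinants and the rank by minors

module Determinants (F : FieldWithConj) where
  open Vectors F
  open RingDet rawRing using (altSum; det; IsRank)

  altSum-cong : ∀ {m} {f g : Vect m} → (∀ j → f j ≡ g j) → altSum f ≡ altSum g
  altSum-cong {zero} h = refl
  altSum-cong {suc m} h = cong₂ (λ p q → p ⊕ (⊖ q)) (h zero) (altSum-cong (h ∘ suc))

  altSum-zero : ∀ {m} {f : Vect m} → (∀ j → f j ≡ 0#) → altSum f ≡ 0#
  altSum-zero {zero} h = refl
  altSum-zero {suc m} h =
    trans (cong₂ (λ p q → p ⊕ (⊖ q)) (h zero) (altSum-zero (h ∘ suc))) (R.-‿inverseʳ 0#)

  altSum-axpy : ∀ {m} (f : Vect m) α (g : Vect m) →
    altSum (λ j → f j ⊕ α ⊗ g j) ≡ altSum f ⊕ α ⊗ altSum g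
  altSum-axpy {zero} f α g = sym (trans (R.+-identityˡ _) (R.zeroʳ α))
  altSum-axpy {suc m} f α g = trans
    (cong (λ s → f zero ⊕ α ⊗ g zero ⊕ (⊖ s)) (altSum-axpy (f ∘ suc) α (g ∘ suc)))
    (solve 5 (λ f α g s t → f :+ α :* g :+ (:- (s :+ α :* t)) := f :+ (:- s) :+ α :* (g :+ (:- t))) refl
      (f zero) α (g zero) (altSum (f ∘ suc)) (altSum (g ∘ suc)))

  altSum-adjacent : ∀ {m} (c : Fin m) {f : Vect (suc m)} → f (inject₁ c) ≡ f (suc c) →
    (∀ j → j ≢ inject₁ c → j ≢ suc c → f j ≡ 0#) → altSum f ≡ 0#
  altSum-adjacent zero {f} eq h = begin
    f zero ⊕ (⊖ (f (suc zero) ⊕ (⊖ altSum (λ j → f (suc (suc j))))))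
      ≡⟨ cong₂ (λ p q → p ⊕ (⊖ (f (suc zero) ⊕ (⊖ q)))) eq (altSum-zero (λ j → h (suc (suc j)) (λ ()) (λ ()))) ⟩
    f (suc zero) ⊕ (⊖ (f (suc zero) ⊕ (⊖ 0#)))
      ≡⟨ solve 2 (λ x y → x :+ (:- (x :+ (:- y))) := y) refl (f (suc zero)) 0# ⟩
    0# ∎
    where open ≡-Reasoning
  altSum-adjacent (suc c) {f} eq h = trans
    (cong₂ (λ p q → p ⊕ (⊖ q)) (h zero (λ ()) (λ ()))
      (altSum-adjacent c eq (λ j j≢ j≢′ → h (suc j) (j≢ ∘ Fin.suc-injective) (j≢′ ∘ Fin.suc-injective))))
    (R.-‿inverseʳ 0#)

  dot-altSum : ∀ {m n} (f : Fin m → Vect n) v →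
    dot (λ j → altSum (λ t → f t j)) v ≡ altSum (λ t → dot (f t) v)
  dot-altSum {zero} f v = dot-zeroˡ v (λ _ → refl)
  dot-altSum {suc m} f v = begin
    dot (λ j → f zero j ⊕ (⊖ altSum (λ t → f (suc t) j))) v
      ≡⟨ dot-congˡ (λ j → cong (f zero j ⊕_) (sym (RP.-1*x≈-x _))) ⟩
    dot (λ j → f zero j ⊕ (⊖ 1#) ⊗ altSum (λ t → f (suc t) j)) v
      ≡⟨ dot-axpyˡ (f zero) (⊖ 1#) (λ j → altSum (λ t → f (suc t) j)) v ⟩
    dot (f zero) v ⊕ (⊖ 1#) ⊗ dot (λ j → altSum (λ t → f (suc t) j)) v
      ≡⟨ cong (dot (f zero) v ⊕_) (trans (RP.-1*x≈-x _) (cong ⊖_ (dot-altSum (f ∘ suc) v))) ⟩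
    dot (f zero) v ⊕ (⊖ altSum (λ t → dot (f (suc t)) v)) ∎
    where open ≡-Reasoning

  minor : ∀ {m} → Matrix (suc m) (suc m) → Fin (suc m) → Matrix m m
  minor M j i l = M (suc i) (punchIn j l)

  det-cong : ∀ {m} {M N : Matrix m m} → (∀ i j → M i j ≡ N i j) → det M ≡ det N
  det-cong {zero} h = refl
  det-cong {suc m} h = altSum-cong (λ j → cong₂ _⊗_ (h zero j) (det-cong (λ i l → h (suc i) (punchIn j l))))

  -- Linearity in column `c`. In the expansion along the first row this column enters each term
  -- exactly once: through the entry if `j` is `c`, through the minor otherwise.
  det-axpy : ∀ {m} (c : Fin m) α (M N P : Matrix m m) →
    (∀ i j → j ≢ c → N i j ≡ M i j) → (∀ i j → j ≢ c → P i j ≡ M i j) →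
    (∀ i → P i c ≡ M i c ⊕ α ⊗ N i c) → det P ≡ det M ⊕ α ⊗ det N
  det-axpy {suc m} c α M N P N≡M P≡M Pc = trans (altSum-cong term)
    (altSum-axpy (λ j → M zero j ⊗ det (minor M j)) α (λ j → N zero j ⊗ det (minor N j)))
    where
    open ≡-Reasoning
    term : ∀ j → P zero j ⊗ det (minor P j) ≡
      M zero j ⊗ det (minor M j) ⊕ α ⊗ (N zero j ⊗ det (minor N j))
    term j with j Fin.≟ c
    ... | yes refl = begin
      P zero c ⊗ det (minor P c) ≡⟨ cong₂ _⊗_ (Pc zero) (det-cong λ i l → P≡M (suc i) (punchIn c l) (Fin.punchInᵢ≢i c l)) ⟩
      (M zero c ⊕ α ⊗ N zero c) ⊗ det (minor M c)
        ≡⟨ solve 4 (λ m a n d → (m :+ a :* n) :* d := m :* d :+ a :* (n :* d)) refl (M zero c) α (N zero c) (det (minor M c)) ⟩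
      M zero c ⊗ det (minor M c) ⊕ α ⊗ (N zero c ⊗ det (minor M c))
        ≡⟨ cong (λ d → M zero c ⊗ det (minor M c) ⊕ α ⊗ (N zero c ⊗ d))
             (sym (det-cong λ i l → N≡M (suc i) (punchIn c l) (Fin.punchInᵢ≢i c l))) ⟩
      M zero c ⊗ det (minor M c) ⊕ α ⊗ (N zero c ⊗ det (minor N c)) ∎
    ... | no j≢c = begin
      P zero j ⊗ det (minor P j)
        ≡⟨ cong₂ _⊗_ (P≡M zero j j≢c) (det-axpy c′ α (minor M j) (minor N j) (minor P j)
             (λ i l l≢c′ → N≡M (suc i) (punchIn j l) (avoids l l≢c′))
             (λ i l l≢c′ → P≡M (suc i) (punchIn j l) (avoids l l≢c′))
             (λ i → subst (λ x → P (suc i) x ≡ M (suc i) x ⊕ α ⊗ N (suc i) x)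
                      (sym (Fin.punchIn-punchOut j≢c)) (Pc (suc i)))) ⟩
      M zero j ⊗ (det (minor M j) ⊕ α ⊗ det (minor N j))
        ≡⟨ solve 4 (λ m d a e → m :* (d :+ a :* e) := m :* d :+ a :* (m :* e)) refl
             (M zero j) (det (minor M j)) α (det (minor N j)) ⟩
      M zero j ⊗ det (minor M j) ⊕ α ⊗ (M zero j ⊗ det (minor N j))
        ≡⟨ cong (λ x → M zero j ⊗ det (minor M j) ⊕ α ⊗ (x ⊗ det (minor N j))) (sym (N≡M zero j j≢c)) ⟩
      M zero j ⊗ det (minor M j) ⊕ α ⊗ (N zero j ⊗ det (minor N j)) ∎
      where
      c′ : Fin m
      c′ = punchOut j≢c
      avoids : ∀ l → l ≢ c′ → punchIn j l ≢ c
      avoids l l≢c′ eq = l≢c′ (Fin.punchIn-injective j l c′ (trans eq (sym (Fin.punchIn-punchOut j≢c))))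

  punchIn-adjacent : ∀ {m} (j : Fin (suc (suc m))) (c : Fin (suc m)) → j ≢ inject₁ c → j ≢ suc c →
    ∃[ c′ ] punchIn j (inject₁ c′) ≡ inject₁ c × punchIn j (suc c′) ≡ suc c
  punchIn-adjacent zero zero j≢ _ = ⊥-elim (j≢ refl)
  punchIn-adjacent zero (suc c) _ _ = c , refl , refl
  punchIn-adjacent (suc zero) zero _ j≢′ = ⊥-elim (j≢′ refl)
  punchIn-adjacent {suc m} (suc (suc j)) zero _ _ = zero , refl , refl
  punchIn-adjacent {zero} (suc zero) (suc ())
  punchIn-adjacent {suc m} (suc j) (suc c) j≢ j≢′
    with punchIn-adjacent j c (j≢ ∘ cong suc) (j≢′ ∘ cong suc)
  ... | c′ , eq , eq′ = suc c′ , cong suc eq , cong suc eq′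

  punchIn-skew : ∀ {m} (c : Fin m) (l : Fin m) → punchIn (inject₁ c) l ≡ punchIn (suc c) l ⊎
    (punchIn (inject₁ c) l ≡ suc c × punchIn (suc c) l ≡ inject₁ c)
  punchIn-skew zero zero = inj₂ (refl , refl)
  punchIn-skew zero (suc l) = inj₁ refl
  punchIn-skew (suc c) zero = inj₁ refl
  punchIn-skew (suc c) (suc l) with punchIn-skew c l
  ... | inj₁ eq = inj₁ (cong suc eq)
  ... | inj₂ (eq , eq′) = inj₂ (cong suc eq , cong suc eq′)

  -- The two terms that delete one of the equal columns have the same minor and opposite signs.
  -- Every other minor still contains the equal pair, and still adjacently. Restricting to adjacent
  -- columns avoids signs of permutations.
  det-adjacent : ∀ {m} (c : Fin m) (M : Matrix (suc m) (suc m)) →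
    (∀ i → M i (inject₁ c) ≡ M i (suc c)) → det M ≡ 0#
  det-adjacent {suc m} c M eq = altSum-adjacent c
    (cong₂ _⊗_ (eq zero) (det-cong skew))
    (λ j j≢ j≢′ → vanish j j≢ j≢′)
    where
    skew : ∀ i l → minor M (inject₁ c) i l ≡ minor M (suc c) i l
    skew i l with punchIn-skew c l
    ... | inj₁ same = cong (M (suc i)) same
    ... | inj₂ (left , right) = trans (cong (M (suc i)) left) (trans (sym (eq (suc i))) (cong (M (suc i)) (sym right)))
    vanish : ∀ j → j ≢ inject₁ c → j ≢ suc c → M zero j ⊗ det (minor M j) ≡ 0#
    vanish j j≢ j≢′ with punchIn-adjacent j c j≢ j≢′
    ... | c′ , left , right = trans (cong (M zero j ⊗_) (det-adjacent c′ (minor M j) λ i →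
          trans (cong (M (suc i)) left) (trans (eq (suc i)) (cong (M (suc i)) (sym right))))) (R.zeroʳ _)

  addColumn : ∀ {m n} → Carrier → Fin n → Fin n → Matrix m n → Matrix m n
  addColumn μ a b M i j = M i j ⊕ μ ⊗ (basis a j ⊗ M i b)

  replaceColumn : ∀ {m n} → Fin n → Fin n → Matrix m n → Matrix m n
  replaceColumn a b M i j = if does (a Fin.≟ j) then M i b else M i j

  replaceColumn-self : ∀ {m n} a b (M : Matrix m n) i → replaceColumn a b M i a ≡ M i b
  replaceColumn-self a b M i = cong (if_then M i b else M i a) (dec-true (a Fin.≟ a) refl)

  replaceColumn-other : ∀ {m n} a b (M : Matrix m n) i j → j ≢ a → replaceColumn a b M i j ≡ M i j
  replaceColumn-other a b M i j j≢a = cong (if_then M i b else M i j) (dec-false (a Fin.≟ j) (j≢a ∘ sym))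

  det-addColumn : ∀ {m} μ (a b : Fin m) (M : Matrix m m) → det (replaceColumn a b M) ≡ 0# →
    det (addColumn μ a b M) ≡ det M
  det-addColumn μ a b M repeated = trans
    (det-axpy a μ M (replaceColumn a b M) (addColumn μ a b M)
      (replaceColumn-other a b M) other self)
    (trans (cong (λ d → det M ⊕ μ ⊗ d) repeated) (trans (cong (det M ⊕_) (R.zeroʳ μ)) (R.+-identityʳ _)))
    where
    other : ∀ i j → j ≢ a → addColumn μ a b M i j ≡ M i j
    other i j j≢a = trans (cong (λ e → M i j ⊕ μ ⊗ (e ⊗ M i b)) (basis-other j≢a))
      (trans (cong (λ e → M i j ⊕ μ ⊗ e) (R.zeroˡ _)) (trans (cong (M i j ⊕_) (R.zeroʳ _)) (R.+-identityʳ _)))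
    self : ∀ i → addColumn μ a b M i a ≡ M i a ⊕ μ ⊗ replaceColumn a b M i a
    self i = cong (λ e → M i a ⊕ μ ⊗ e) (trans (cong (_⊗ M i b) (basis-self a))
      (trans (R.*-identityˡ _) (sym (replaceColumn-self a b M i))))

  inject₁≢suc : ∀ {m} (c : Fin m) → inject₁ c ≢ suc c
  inject₁≢suc (suc c) eq = inject₁≢suc c (Fin.suc-injective eq)

  det-addNext : ∀ {m} μ (c : Fin m) (M : Matrix (suc m) (suc m)) →
    det (addColumn μ (inject₁ c) (suc c) M) ≡ det M
  det-addNext μ c M = det-addColumn μ (inject₁ c) (suc c) M
    (det-adjacent c (replaceColumn (inject₁ c) (suc c) M) λ i →
      trans (replaceColumn-self (inject₁ c) (suc c) M i)
        (sym (replaceColumn-other (inject₁ c) (suc c) M i (suc c) (inject₁≢suc c ∘ sym))))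

  det-addPrevious : ∀ {m} μ (c : Fin m) (M : Matrix (suc m) (suc m)) →
    det (addColumn μ (suc c) (inject₁ c) M) ≡ det M
  det-addPrevious μ c M = det-addColumn μ (suc c) (inject₁ c) M
    (det-adjacent c (replaceColumn (suc c) (inject₁ c) M) λ i →
      trans (replaceColumn-other (suc c) (inject₁ c) M i (inject₁ c) (inject₁≢suc c))
        (sym (replaceColumn-self (suc c) (inject₁ c) M i)))

  -- The coordinates after the column operation that leave the product M w unchanged.
  compensate : ∀ {n} → Carrier → Fin n → Fin n → Vect n → Vect n
  compensate μ a b w j = w j ⊕ (⊖ (μ ⊗ w a)) ⊗ basis b j

  compensate-other : ∀ {n} μ (a b : Fin n) w {j} → j ≢ b → compensate μ a b w j ≡ w j
  compensate-other μ a b w {j} j≢b = trans (cong (λ e → w j ⊕ (⊖ (μ ⊗ w a)) ⊗ e) (basis-other j≢b))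
    (trans (cong (w j ⊕_) (R.zeroʳ _)) (R.+-identityʳ _))

  compensate-self : ∀ {n} μ (a b : Fin n) w → compensate μ a b w b ≡ w b ⊕ (⊖ (μ ⊗ w a))
  compensate-self μ a b w = cong (w b ⊕_) (trans (cong ((⊖ (μ ⊗ w a)) ⊗_) (basis-self b)) (R.*-identityʳ _))

  addColumn-compensate : ∀ {m n} μ {a b : Fin n} → a ≢ b → (M : Matrix m n) (w : Vect n) (i : Fin m) →
    dot (addColumn μ a b M i) (compensate μ a b w) ≡ dot (M i) w
  addColumn-compensate μ {a} {b} a≢b M w i = begin
    dot (addColumn μ a b M i) w′ ≡⟨ dot-axpyˡ (M i) μ (λ j → basis a j ⊗ M i b) w′ ⟩
    dot (M i) w′ ⊕ μ ⊗ dot (λ j → basis a j ⊗ M i b) w′ ≡⟨ cong₂ (λ p q → p ⊕ μ ⊗ q) first second ⟩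
    (dot (M i) w ⊕ (⊖ (μ ⊗ w a)) ⊗ M i b) ⊕ μ ⊗ (M i b ⊗ w a)
      ≡⟨ solve 4 (λ d μ x m → (d :+ (:- (μ :* x)) :* m) :+ μ :* (m :* x) := d) refl (dot (M i) w) μ (w a) (M i b) ⟩
    dot (M i) w ∎
    where
    open ≡-Reasoning
    w′ : Vect _
    w′ = compensate μ a b w
    first : dot (M i) w′ ≡ dot (M i) w ⊕ (⊖ (μ ⊗ w a)) ⊗ M i b
    first = trans (dot-axpyʳ (M i) w (⊖ (μ ⊗ w a)) (basis b))
      (cong (λ z → dot (M i) w ⊕ (⊖ (μ ⊗ w a)) ⊗ z) (dot-basisʳ (M i) b))
    second : dot (λ j → basis a j ⊗ M i b) w′ ≡ M i b ⊗ w a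
    second = begin
      dot (λ j → basis a j ⊗ M i b) w′
        ≡⟨ sum-at a (λ j j≢a → trans (cong (λ e → e ⊗ M i b ⊗ w′ j) (basis-other j≢a))
             (trans (cong (_⊗ w′ j) (R.zeroˡ _)) (R.zeroˡ _))) ⟩
      basis a a ⊗ M i b ⊗ w′ a ≡⟨ cong₂ _⊗_ (trans (cong (_⊗ M i b) (basis-self a)) (R.*-identityˡ _))
                                     (compensate-other μ a b w a≢b) ⟩
      M i b ⊗ w a ∎

  -- Column operations on adjacent columns push the last nonzero entry of the
  -- kernel vector down to index zero, where it exhibits a zero column.
  det-kernel′ : ∀ {m} d (M : Matrix (suc m) (suc m)) (w : Vect (suc m)) → (∀ i → dot (M i) w ≡ 0#) →
    (∀ j → d ≤ toℕ j → w j ≡ 0#) → ∃[ c ] w c ≢ 0# → det M ≡ 0#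
  det-kernel′ zero M w Mw≡0 beyond (c , wc≢0) = ⊥-elim (wc≢0 (beyond c z≤n))
  det-kernel′ {m} (suc d) M w Mw≡0 beyond nonzero with d ℕ.<? suc m
  ... | no d≮ = det-kernel′ d M w Mw≡0 (λ j d≤j → ⊥-elim (d≮ (ℕ.≤-<-trans d≤j (Fin.toℕ<n j)))) nonzero
  ... | yes d< = byIndex (fromℕ< d<) (Fin.toℕ-fromℕ< d<)
    where
    open ≡-Reasoning
    eliminate : ∀ (c : Fin m) → suc (toℕ c) ≡ d → ∀ M w → (∀ i → dot (M i) w ≡ 0#) → (∀ j → suc d ≤ toℕ j → w j ≡ 0#) →
      w (inject₁ c) ≢ 0# → det M ≡ 0#
    eliminate c c≡d M w Mw≡0 beyond wp≢0 with inverse (w (inject₁ c)) wp≢0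
    ... | x , wpx≡1 = trans (sym (det-addNext μ c M))
          (det-kernel′ d M′ w′
            (λ i → trans (addColumn-compensate μ (inject₁≢suc c) M w i) (Mw≡0 i)) below
            (inject₁ c , λ w′p≡0 → wp≢0 (trans (sym (compensate-other μ (inject₁ c) (suc c) w (inject₁≢suc c))) w′p≡0)))
      where
      -- The quotient of two consecutive entries of `w`: compensation subtracts `μ ⊗ w (inject₁ c)`
      -- from the entry at `suc c`, which makes it zero.
      μ : Carrier
      μ = w (suc c) ⊗ x
      M′ : Matrix (suc m) (suc m)
      M′ = addColumn μ (inject₁ c) (suc c) M
      w′ : Vect (suc m)
      w′ = compensate μ (inject₁ c) (suc c) w
      below : ∀ j → d ≤ toℕ j → w′ j ≡ 0#
      below j d≤j with j Fin.≟ suc c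
      ... | yes refl = begin
        w′ (suc c) ≡⟨ compensate-self μ (inject₁ c) (suc c) w ⟩
        w (suc c) ⊕ (⊖ (w (suc c) ⊗ x ⊗ w (inject₁ c)))
          ≡⟨ solve 3 (λ y x z → y :+ (:- (y :* x :* z)) := y :+ (:- (y :* (z :* x)))) refl (w (suc c)) x (w (inject₁ c)) ⟩
        w (suc c) ⊕ (⊖ (w (suc c) ⊗ (w (inject₁ c) ⊗ x)))
          ≡⟨ cong (λ z → w (suc c) ⊕ (⊖ z)) (trans (cong (w (suc c) ⊗_) wpx≡1) (R.*-identityʳ _)) ⟩
        w (suc c) ⊕ (⊖ w (suc c)) ≡⟨ R.-‿inverseʳ _ ⟩
        0# ∎
      ... | no j≢c = trans (compensate-other μ (inject₁ c) (suc c) w j≢c)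
            (beyond j (ℕ.≤∧≢⇒< d≤j (λ d≡j → j≢c (Fin.toℕ-injective (trans (sym d≡j) (sym c≡d))))))
    byIndex : (c : Fin (suc m)) → toℕ c ≡ d → det M ≡ 0#
    byIndex c c≡d with w c ≟ 0#
    ... | yes wc≡0 = det-kernel′ d M w Mw≡0 below nonzero
      where
      below : ∀ j → d ≤ toℕ j → w j ≡ 0#
      below j d≤j with j Fin.≟ c
      ... | yes refl = wc≡0
      ... | no j≢c = beyond j (ℕ.≤∧≢⇒< d≤j (λ d≡j → j≢c (Fin.toℕ-injective (trans (sym d≡j) (sym c≡d)))))
    byIndex zero c≡d | no w₀≢0 = RP.x+x≈x⇒x≈0 (det M) (trans
      (sym (trans (det-axpy zero 1# M M M (λ _ _ _ → refl) (λ _ _ _ → refl) (λ i →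
        sym (trans (cong₂ (λ p q → p ⊕ 1# ⊗ q) (column i) (column i))
          (trans (trans (R.+-identityˡ _) (R.zeroʳ _)) (sym (column i))))))
        (cong (det M ⊕_) (R.*-identityˡ _)))) refl)
      where
      column : ∀ i → M i zero ≡ 0#
      column i = ⊗-zero-product w₀≢0 (trans (R.*-comm _ _)
        (trans (sym (dot-supportedʳ (M i) {w} zero (λ { zero 0≢0 → ⊥-elim (0≢0 refl) ; (suc j) _ → beyond (suc j) (subst (λ e → suc e ≤ suc (toℕ j)) c≡d (s≤s z≤n)) })))
          (Mw≡0 i)))
    byIndex (suc c) c≡d | no wc≢0 with w (inject₁ c) ≟ 0#
    ...   | no wp≢0 = eliminate c c≡d M w Mw≡0 beyond wp≢0
    -- The entry below is zero and cannot serve as a pivot. Subtracting the previous column from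
    -- column `suc c` adds `w (suc c)` to it and leaves the other entries of `w` unchanged.
    ...   | yes wp≡0 = trans (sym (det-addPrevious (⊖ 1#) c M))
            (eliminate c c≡d M′ w′ (λ i → trans (addColumn-compensate (⊖ 1#) (inject₁≢suc c ∘ sym) M w i) (Mw≡0 i)) beyond′ w′p≢0)
      where
      M′ : Matrix (suc m) (suc m)
      M′ = addColumn (⊖ 1#) (suc c) (inject₁ c) M
      w′ : Vect (suc m)
      w′ = compensate (⊖ 1#) (suc c) (inject₁ c) w
      w′p≢0 : w′ (inject₁ c) ≢ 0#
      w′p≢0 w′p≡0 = wc≢0 (begin
        w (suc c) ≡⟨ sym (R.+-identityˡ _) ⟩
        0# ⊕ w (suc c) ≡⟨ cong₂ _⊕_ (sym wp≡0) (sym (trans (cong ⊖_ (RP.-1*x≈-x _)) (RP.-‿involutive _))) ⟩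
        w (inject₁ c) ⊕ (⊖ ((⊖ 1#) ⊗ w (suc c))) ≡⟨ sym (compensate-self (⊖ 1#) (suc c) (inject₁ c) w) ⟩
        w′ (inject₁ c) ≡⟨ w′p≡0 ⟩
        0# ∎)
      beyond′ : ∀ j → suc d ≤ toℕ j → w′ j ≡ 0#
      beyond′ j d<j = trans (compensate-other (⊖ 1#) (suc c) (inject₁ c) w
        (λ { refl → ℕ.1+n≰n (ℕ.≤-trans d<j (ℕ.≤-trans (ℕ.≤-reflexive (Fin.toℕ-inject₁ c)) (ℕ.≤-trans (ℕ.n≤1+n _) (ℕ.≤-reflexive c≡d)))) }))
        (beyond j d<j)

  det-kernel : ∀ {m} (M : Matrix m m) (w : Vect m) → (∀ i → dot (M i) w ≡ 0#) → ∃[ c ] w c ≢ 0# → det M ≡ 0#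
  det-kernel {suc m} M w Mw≡0 nonzero =
    det-kernel′ (suc m) M w Mw≡0 (λ j m<j → ⊥-elim (ℕ.<⇒≱ (Fin.toℕ<n j) m<j)) nonzero

  cons : ∀ {a} {X : Set a} {m} → X → (Fin m → X) → Fin (suc m) → X
  cons x f zero = x
  cons x f (suc i) = f i

  cons-injective : ∀ {m n} {x : Fin n} {f : Fin m → Fin n} → (∀ i → f i ≢ x) →
    Injective _≡_ _≡_ f → Injective _≡_ _≡_ (cons x f)
  cons-injective x∉f inj-f {zero} {zero} _ = refl
  cons-injective x∉f inj-f {zero} {suc j} eq = ⊥-elim (x∉f j (sym eq))
  cons-injective x∉f inj-f {suc i} {zero} eq = ⊥-elim (x∉f i eq)
  cons-injective x∉f inj-f {suc i} {suc j} eq = cong suc (inj-f eq)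

  -- By maximality every bordering of the nonsingular minor is singular, so Laplace expansion writes
  -- `D` times any row through `r` fixed functionals. From below, the basis vectors of the chosen
  -- columns work, since a kernel vector of the minor would make its determinant vanish.
  isRank⇒rank : ∀ {n} {M : Matrix n n} {r} → IsRank M r → Rank M r
  isRank⇒rank {n} {M} {r} ((f , g , inj-f , inj-g , det≢0) , maximal) = (Q , bound) , (y , independent)
    where
    open ≡-Reasoning
    D : Carrier
    D = det (λ i j → M (f i) (g j))

    y : Fin r → Vect n
    y t = basis (g t)
    independent : ∀ c → (∀ u → dot (M u) (lin c y) ≡ 0#) → ∀ t → c t ≡ 0#
    independent c Mc≡0 t with c t ≟ 0#
    ... | yes ct≡0 = ct≡0
    ... | no ct≢0 = ⊥-elim (det≢0 (det-kernel _ c restricted (t , ct≢0)))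
      where
      restricted : ∀ i → dot (λ j → M (f i) (g j)) c ≡ 0#
      restricted i = begin
        dot (λ j → M (f i) (g j)) c ≡⟨ dot-comm _ c ⟩
        sum (λ s → c s ⊗ M (f i) (g s)) ≡⟨ sum-cong-≗ (λ s → cong (c s ⊗_) (sym (dot-basisʳ (M (f i)) (g s)))) ⟩
        sum (λ s → c s ⊗ dot (M (f i)) (y s)) ≡⟨ sym (dot-lin (M (f i)) c y) ⟩
        dot (M (f i)) (lin c y) ≡⟨ Mc≡0 (f i) ⟩
        0# ∎

    bordered : Fin n → Fin n → Matrix (suc r) (suc r)
    bordered i j a b = M (cons i f a) (cons j g b)

    bordered-singular : ∀ i j → det (bordered i j) ≡ 0#
    bordered-singular i j with Fin.any? (λ s → f s Fin.≟ i) | Fin.any? (λ s → g s Fin.≟ j)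
    -- A repeated row leaves `r` conditions on `suc r` unknowns. A repeated column is handled below
    -- by the difference of two basis vectors.
    ... | yes (s , fs≡i) | _ with nontrivial-solution (ℕ.n<1+n r) (λ t → bordered i j (suc t))
    ...   | c , nonzero , solves = det-kernel (bordered i j) c kills nonzero
      where
      kills : ∀ a → dot (bordered i j a) c ≡ 0#
      kills (suc t) = solves t
      kills zero = trans (dot-congˡ {v = c} (λ b → cong (λ x → M x (cons j g b)) (sym fs≡i))) (solves s)
    bordered-singular i j | no _ | yes (s , gs≡j) = det-kernel (bordered i j) w kills (zero , w₀≢0)
      where
      w : Vect (suc r)
      w b = basis zero b ⊕ (⊖ 1#) ⊗ basis (suc s) b
      w₀≢0 : w zero ≢ 0#
      w₀≢0 w₀≡0 = 1≢0 (trans (sym (trans (cong (1# ⊕_) (R.zeroʳ _)) (R.+-identityʳ _))) w₀≡0)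
      kills : ∀ a → dot (bordered i j a) w ≡ 0#
      kills a = begin
        dot (bordered i j a) w ≡⟨ dot-axpyʳ (bordered i j a) (basis zero) (⊖ 1#) (basis (suc s)) ⟩
        dot (bordered i j a) (basis zero) ⊕ (⊖ 1#) ⊗ dot (bordered i j a) (basis (suc s))
          ≡⟨ cong₂ (λ p q → p ⊕ (⊖ 1#) ⊗ q) (dot-basisʳ (bordered i j a) zero) (dot-basisʳ (bordered i j a) (suc s)) ⟩
        M (cons i f a) j ⊕ (⊖ 1#) ⊗ M (cons i f a) (g s)
          ≡⟨ cong₂ (λ p q → p ⊕ q) (cong (M (cons i f a)) (sym gs≡j)) (RP.-1*x≈-x _) ⟩
        M (cons i f a) (g s) ⊕ (⊖ M (cons i f a) (g s)) ≡⟨ R.-‿inverseʳ _ ⟩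
        0# ∎
    bordered-singular i j | no i∉f | no j∉g with det (bordered i j) ≟ 0#
    ... | yes singular = singular
    ... | no nonsingular = ⊥-elim (ℕ.1+n≰n (maximal (suc r) (cons i f , cons j g ,
          cons-injective (λ s eq → i∉f (s , eq)) inj-f , cons-injective (λ s eq → j∉g (s , eq)) inj-g , nonsingular)))

    -- The cofactors of the first row of a bordered minor. They do not involve the bordering row, so
    -- one family of functionals serves all rows of `M`.
    Q : Matrix r n
    Q t j = det (λ i l → M (f i) (cons j g (punchIn (suc t) l)))

    -- Laplace expansion of the singular bordered minor.
    entry : ∀ i j → M i j ⊗ D ≡ altSum (λ t → M i (g t) ⊗ Q t j)
    entry i j = RP.x∙y⁻¹≈ε⇒x≈y _ _ (bordered-singular i j)

    bound : ∀ v → (∀ t → dot (Q t) v ≡ 0#) → ∀ u → dot (M u) v ≡ 0#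
    bound v Qv≡0 u = ⊗-zero-product det≢0 (begin
      D ⊗ dot (M u) v ≡⟨ sym (trans (dot-comm _ v) (trans (dot-⊗ʳ D v (M u)) (cong (D ⊗_) (dot-comm v (M u))))) ⟩
      dot (λ j → D ⊗ M u j) v ≡⟨ dot-congˡ (λ j → trans (R.*-comm D _) (entry u j)) ⟩
      dot (λ j → altSum (λ t → M u (g t) ⊗ Q t j)) v ≡⟨ dot-altSum (λ t j → M u (g t) ⊗ Q t j) v ⟩
      altSum (λ t → dot (λ j → M u (g t) ⊗ Q t j) v) ≡⟨ altSum-zero (λ t → trans (dot-comm _ v)
        (trans (dot-⊗ʳ (M u (g t)) v (Q t)) (trans (cong (M u (g t) ⊗_) (trans (dot-comm v (Q t)) (Qv≡0 t))) (R.zeroʳ _)))) ⟩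
      0# ∎)

-- Deleting a row and the same column of a Hermitian matrix

module VertexDeletion (F : FieldWithConj) where
  open Vectors F

  conj-0 : conj 0# ≡ 0#
  conj-0 = RP.x+x≈x⇒x≈0 (conj 0#) (trans (sym (conj-⊕ 0# 0#)) (cong conj 0⊕0≡0))

  conj-1 : conj 1# ≡ 1#
  conj-1 = begin
    conj 1# ≡⟨ sym (R.*-identityʳ _) ⟩
    conj 1# ⊗ 1# ≡⟨ cong (conj 1# ⊗_) (sym (conj-conj 1#)) ⟩
    conj 1# ⊗ conj (conj 1#) ≡⟨ sym (conj-⊗ 1# (conj 1#)) ⟩
    conj (1# ⊗ conj 1#) ≡⟨ cong conj (R.*-identityˡ _) ⟩
    conj (conj 1#) ≡⟨ conj-conj 1# ⟩
    1# ∎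
    where open ≡-Reasoning

  conj-sum : ∀ {n} (f : Vect n) → conj (sum f) ≡ sum (λ i → conj (f i))
  conj-sum {zero} f = conj-0
  conj-sum {suc n} f = trans (conj-⊕ (f zero) _) (cong (conj (f zero) ⊕_) (conj-sum (f ∘ suc)))

  conj-dot : ∀ {n} (q v : Vect n) → conj (dot q v) ≡ dot (conj ∘ q) (conj ∘ v)
  conj-dot q v = trans (conj-sum (λ i → q i ⊗ v i)) (sum-cong-≗ (λ i → conj-⊗ (q i) (v i)))

  conj-nonzero : ∀ {x} → x ≢ 0# → conj x ≢ 0#
  conj-nonzero x≢0 cx≡0 = x≢0 (trans (sym (conj-conj _)) (trans (cong conj cx≡0) conj-0))

  conj-basis : ∀ {n} (x i : Fin n) → conj (basis x i) ≡ basis x i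
  conj-basis x i with does (x Fin.≟ i)
  ... | true = conj-1
  ... | false = conj-0

  Hermitian : ∀ {n} → Matrix n n → Set
  Hermitian M = ∀ u v → conj (M u v) ≡ M v u

  InKernel : ∀ {n} → Matrix n n → Vect n → Set
  InKernel M ψ = ∀ u → dot (M u) ψ ≡ 0#

  KernelAt : ∀ {n} → Fin n → Matrix n n → Set
  KernelAt x M = ∃[ ψ ] InKernel M ψ × ψ x ≢ 0#

  Solves : ∀ {n} → Fin n → Matrix n n → Vect n → Set
  Solves x M φ = ∀ u → dot (M u) φ ≡ basis x u

  adjoint : ∀ {n} {M : Matrix n n} → Hermitian M → ∀ {φ b} → (∀ u → dot (M u) φ ≡ b u) →
    ∀ v → dot (conj ∘ φ) (λ u → dot (M u) v) ≡ dot (conj ∘ b) v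
  adjoint {n} {M} herm {φ} {b} Mφ≡b v = begin
    sum (λ u → conj (φ u) ⊗ dot (M u) v)
      ≡⟨ sum-cong-≗ (λ u → *-distribˡ-sum (conj (φ u)) (λ w → M u w ⊗ v w)) ⟩
    sum (λ u → sum (λ w → conj (φ u) ⊗ (M u w ⊗ v w)))
      ≡⟨ ∑-comm {n} {n} (λ u w → conj (φ u) ⊗ (M u w ⊗ v w)) ⟩
    sum (λ w → sum (λ u → conj (φ u) ⊗ (M u w ⊗ v w)))
      ≡⟨ sum-cong-≗ (λ w → trans (sum-cong-≗ λ u →
           solve 3 (λ p m v → p :* (m :* v) := v :* (m :* p)) refl (conj (φ u)) (M u w) (v w))
           (sym (*-distribˡ-sum (v w) (λ u → M u w ⊗ conj (φ u))))) ⟩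
    sum (λ w → v w ⊗ sum (λ u → M u w ⊗ conj (φ u)))
      ≡⟨ sum-cong-≗ (λ w → trans (cong (v w ⊗_) (column w)) (R.*-comm _ _)) ⟩
    sum (λ w → conj (b w) ⊗ v w) ∎
    where
    open ≡-Reasoning
    column : ∀ w → sum (λ u → M u w ⊗ conj (φ u)) ≡ conj (b w)
    column w = begin
      sum (λ u → M u w ⊗ conj (φ u)) ≡⟨ sum-cong-≗ (λ u → cong (_⊗ conj (φ u)) (sym (herm w u))) ⟩
      dot (conj ∘ M w) (conj ∘ φ) ≡⟨ sym (conj-dot (M w) φ) ⟩
      conj (dot (M w) φ) ≡⟨ cong conj (Mφ≡b w) ⟩
      conj (b w) ∎

  adjoint-solves : ∀ {n} {M : Matrix n n} → Hermitian M → ∀ {x φ} → Solves x M φ →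
    ∀ v → dot (conj ∘ φ) (λ u → dot (M u) v) ≡ v x
  adjoint-solves herm {x} solves v = trans (adjoint herm solves v)
    (trans (dot-congˡ (conj-basis x)) (dot-basisˡ x v))

  solves⇒kernel-vanishes : ∀ {n} {M : Matrix n n} → Hermitian M → ∀ {x φ} → Solves x M φ →
    ∀ {ψ} → InKernel M ψ → ψ x ≡ 0#
  solves⇒kernel-vanishes herm {φ = φ} solves {ψ} Mψ≡0 =
    trans (sym (adjoint-solves herm solves ψ)) (dot-zeroʳ (conj ∘ φ) Mψ≡0)

  -- The Fredholm alternative for e_x. A combination of rows becomes a combination of columns under
  -- conjugation, because the matrix is Hermitian.
  kernelAt⊎solves : ∀ {n} {M : Matrix n n} → Hermitian M → ∀ x → KernelAt x M ⊎ ∃ (Solves x M)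
  kernelAt⊎solves {M = M} herm x with fredholm M (basis x)
  ... | inj₂ (ψ , Mψ≡0 , bψ≢0) = inj₁ (ψ , Mψ≡0 , bψ≢0 ∘ trans (dot-basisˡ x ψ))
  ... | inj₁ (φ , b≡) = inj₂ (conj ∘ φ , λ w → begin
    sum (λ u → M w u ⊗ conj (φ u)) ≡⟨ sum-cong-≗ (λ u → trans (cong (_⊗ conj (φ u)) (sym (herm u w))) (R.*-comm _ _)) ⟩
    sum (λ u → conj (φ u) ⊗ conj (M u w)) ≡⟨ sym (conj-dot φ (λ u → M u w)) ⟩
    conj (lin φ M w) ≡⟨ cong conj (sym (b≡ w)) ⟩
    conj (basis x w) ≡⟨ conj-basis x w ⟩
    basis x w ∎)
    where open ≡-Reasoning

  record IsDeletion {n} (x : Fin n) (M M′ : Matrix n n) : Set where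
    field
      off : ∀ u v → u ≢ x → v ≢ x → M′ u v ≡ M u v
      row : ∀ v → M′ x v ≡ 0#
      column : ∀ u → M′ u x ≡ 0#

  module _ {n} {x : Fin n} {M M′ : Matrix n n} (deletion : IsDeletion x M M′) where
    open IsDeletion deletion

    deleted-dot : ∀ u → u ≢ x → ∀ v → v x ≡ 0# → dot (M′ u) v ≡ dot (M u) v
    deleted-dot u u≢x v vx≡0 = sum-cong-≗ term
      where
      term : ∀ w → M′ u w ⊗ v w ≡ M u w ⊗ v w
      term w with w Fin.≟ x
      ... | yes refl = trans (trans (cong (M′ u x ⊗_) vx≡0) (R.zeroʳ _)) (sym (trans (cong (M u x ⊗_) vx≡0) (R.zeroʳ _)))
      ... | no w≢x = cong (_⊗ v w) (off u w u≢x w≢x)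

    clear : Vect n → Vect n
    clear v i = if does (x Fin.≟ i) then 0# else v i

    clear-self : ∀ v → clear v x ≡ 0#
    clear-self v = cong (if_then 0# else v x) (dec-true (x Fin.≟ x) refl)

    clear-other : ∀ v {i} → i ≢ x → clear v i ≡ v i
    clear-other v {i} i≢x = cong (if_then 0# else v i) (dec-false (x Fin.≟ i) (i≢x ∘ sym))

    dot-clear : ∀ u v → dot (M′ u) (clear v) ≡ dot (M′ u) v
    dot-clear u v = sum-cong-≗ term
      where
      term : ∀ w → M′ u w ⊗ clear v w ≡ M′ u w ⊗ v w
      term w with w Fin.≟ x
      ... | yes refl = trans (trans (cong (_⊗ clear v x) (column u)) (R.zeroˡ _))
                         (sym (trans (cong (_⊗ v x) (column u)) (R.zeroˡ _)))
      ... | no w≢x = cong (M′ u w ⊗_) (clear-other v w≢x)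

    lin-clear-self : ∀ {k} (c : Vect k) y → lin c (clear ∘ y) x ≡ 0#
    lin-clear-self c y = sum-zero (λ t → trans (cong (c t ⊗_) (clear-self (y t))) (R.zeroʳ _))

    kernel-descends : ∀ {k} (c : Vect k) y → (∀ u → u ≢ x → dot (M u) (lin c (clear ∘ y)) ≡ 0#) →
      ∀ u → dot (M′ u) (lin c y) ≡ 0#
    kernel-descends c y h u with u Fin.≟ x
    ... | yes refl = dot-zeroˡ (lin c y) row
    ... | no u≢x = begin
      dot (M′ u) (lin c y) ≡⟨ sym (dot-clear u (lin c y)) ⟩
      dot (M′ u) (clear (lin c y)) ≡⟨ dot-congʳ {q = M′ u} same ⟩
      dot (M′ u) (lin c (clear ∘ y)) ≡⟨ deleted-dot u u≢x _ (lin-clear-self c y) ⟩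
      dot (M u) (lin c (clear ∘ y)) ≡⟨ h u u≢x ⟩
      0# ∎
      where
      open ≡-Reasoning
      same : ∀ i → clear (lin c y) i ≡ lin c (clear ∘ y) i
      same i with i Fin.≟ x
      ... | yes refl = trans (clear-self (lin c y)) (sym (lin-clear-self c y))
      ... | no i≢x = trans (clear-other (lin c y) i≢x) (sum-cong-≗ (λ t → cong (c t ⊗_) (sym (clear-other (y t) i≢x))))

    atLeast-restore : ∀ {r} → RankAtLeast M′ r → RankAtLeast M r
    atLeast-restore (y , independent) = clear ∘ y , λ c Mc≡0 →
      independent c (kernel-descends c y (λ u _ → Mc≡0 u))

    -- A vector killed by the coordinate functional at `x` has the same products with the rows of
    -- both matrices, apart from row `x`, which is added as a functional of its own.
    atMost-restore : ∀ {r} → RankAtMost M′ r → RankAtMost M (2 + r)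
    atMost-restore {r} (Q , bound) = Q′ , bound′
      where
      Q′ : Matrix (2 + r) n
      Q′ zero = basis x
      Q′ (suc zero) = M x
      Q′ (suc (suc t)) = Q t
      bound′ : ∀ v → (∀ t → dot (Q′ t) v ≡ 0#) → ∀ u → dot (M u) v ≡ 0#
      bound′ v Q′v≡0 u with u Fin.≟ x
      ... | yes refl = Q′v≡0 (suc zero)
      ... | no u≢x = trans (sym (deleted-dot u u≢x v (trans (sym (dot-basisˡ x v)) (Q′v≡0 zero))))
            (bound v (λ t → Q′v≡0 (suc (suc t))) u)

    module _ (herm : Hermitian M) where

      -- The vector e_x is added. The coefficient of e_x in a combination is its x-coordinate,
      -- because the other vectors are cleared there, and the pairing with `φ` shows that this
      -- coordinate is zero on the kernel.
      atLeast-solves : ∀ {r φ} → Solves x M φ → RankAtLeast M′ r → RankAtLeast M (suc r)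
      atLeast-solves {r} {φ} solves (y , independent) = y′ , λ c Mc≡0 → zeros c Mc≡0
        where
        y′ : Fin (suc r) → Vect n
        y′ zero = basis x
        y′ (suc t) = clear (y t)
        module _ (c : Vect (suc r)) (Mc≡0 : ∀ u → dot (M u) (lin c y′) ≡ 0#) where
          head : c zero ≡ 0#
          head = begin
            c zero ≡⟨ sym (trans (cong₂ _⊕_ (trans (cong (c zero ⊗_) (basis-self x)) (R.*-identityʳ _))
                        (lin-clear-self (c ∘ suc) y)) (R.+-identityʳ _)) ⟩
            lin c y′ x ≡⟨ sym (adjoint-solves herm solves (lin c y′)) ⟩
            dot (conj ∘ φ) (λ u → dot (M u) (lin c y′)) ≡⟨ dot-zeroʳ (conj ∘ φ) Mc≡0 ⟩
            0# ∎
            where open ≡-Reasoning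
          zeros : ∀ t → c t ≡ 0#
          zeros zero = head
          zeros (suc t) = independent (c ∘ suc) (kernel-descends (c ∘ suc) y λ u _ → trans
            (dot-congʳ {q = M u} (λ i → sym (trans (cong (_⊕ lin (c ∘ suc) (clear ∘ y) i)
              (trans (cong (_⊗ basis x i) head) (R.zeroˡ _))) (R.+-identityˡ _))))
            (Mc≡0 u)) t

      -- Besides e_x, also `φ` is added. As `φ x` is zero, the x-coordinate still isolates the
      -- coefficient of e_x. The rows off `x` do not see `φ`, so the old coefficients vanish, and
      -- row `x` finally isolates the coefficient of `φ`.
      atLeast-solves-zero : ∀ {r φ} → Solves x M φ → φ x ≡ 0# → RankAtLeast M′ r → RankAtLeast M (2 + r)
      atLeast-solves-zero {r} {φ} solves φx≡0 (y , independent) = y′ , λ c Mc≡0 → zeros c Mc≡0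
        where
        y′ : Fin (2 + r) → Vect n
        y′ zero = basis x
        y′ (suc zero) = φ
        y′ (suc (suc t)) = clear (y t)
        module _ (c : Vect (2 + r)) (Mc≡0 : ∀ u → dot (M u) (lin c y′) ≡ 0#) where
          open ≡-Reasoning
          c″ : Vect r
          c″ t = c (suc (suc t))
          β : Carrier
          β = c (suc zero)
          head : c zero ≡ 0#
          head = begin
            c zero ≡⟨ sym (R.+-identityʳ _) ⟩
            c zero ⊕ 0# ≡⟨ cong₂ _⊕_ (sym (trans (cong (c zero ⊗_) (basis-self x)) (R.*-identityʳ _)))
              (sym (trans (cong₂ _⊕_ (trans (cong (β ⊗_) φx≡0) (R.zeroʳ _)) (lin-clear-self c″ y)) 0⊕0≡0)) ⟩
            lin c y′ x ≡⟨ sym (adjoint-solves herm solves (lin c y′)) ⟩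
            dot (conj ∘ φ) (λ u → dot (M u) (lin c y′)) ≡⟨ dot-zeroʳ (conj ∘ φ) Mc≡0 ⟩
            0# ∎
          expand : ∀ u → dot (M u) (lin c y′) ≡ dot (M u) (lin c″ (clear ∘ y)) ⊕ β ⊗ basis x u
          expand u = begin
            dot (M u) (lin c y′) ≡⟨ dot-congʳ {q = M u} (λ i → trans (cong (_⊕ (β ⊗ φ i ⊕ lin c″ (clear ∘ y) i))
              (trans (cong (_⊗ basis x i) head) (R.zeroˡ _))) (trans (R.+-identityˡ _) (R.+-comm _ _))) ⟩
            dot (M u) (λ i → lin c″ (clear ∘ y) i ⊕ β ⊗ φ i) ≡⟨ dot-axpyʳ (M u) (lin c″ (clear ∘ y)) β φ ⟩
            dot (M u) (lin c″ (clear ∘ y)) ⊕ β ⊗ dot (M u) φ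
              ≡⟨ cong (λ e → dot (M u) (lin c″ (clear ∘ y)) ⊕ β ⊗ e) (solves u) ⟩
            dot (M u) (lin c″ (clear ∘ y)) ⊕ β ⊗ basis x u ∎
          tail : ∀ t → c″ t ≡ 0#
          tail = independent c″ (kernel-descends c″ y λ u u≢x → begin
            dot (M u) (lin c″ (clear ∘ y)) ≡⟨ sym (R.+-identityʳ _) ⟩
            dot (M u) (lin c″ (clear ∘ y)) ⊕ 0#
              ≡⟨ cong (dot (M u) (lin c″ (clear ∘ y)) ⊕_) (sym (trans (cong (β ⊗_) (basis-other u≢x)) (R.zeroʳ _))) ⟩
            dot (M u) (lin c″ (clear ∘ y)) ⊕ β ⊗ basis x u ≡⟨ sym (expand u) ⟩
            dot (M u) (lin c y′) ≡⟨ Mc≡0 u ⟩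
            0# ∎)
          zeros : ∀ t → c t ≡ 0#
          zeros zero = head
          zeros (suc (suc t)) = tail t
          zeros (suc zero) = begin
            β ≡⟨ sym (trans (cong (β ⊗_) (basis-self x)) (R.*-identityʳ _)) ⟩
            β ⊗ basis x x ≡⟨ sym (R.+-identityˡ _) ⟩
            0# ⊕ β ⊗ basis x x ≡⟨ cong (_⊕ β ⊗ basis x x) (sym (dot-zeroʳ (M x)
              (λ i → sum-zero (λ t → trans (cong (_⊗ clear (y t) i) (tail t)) (R.zeroˡ _))))) ⟩
            dot (M x) (lin c″ (clear ∘ y)) ⊕ β ⊗ basis x x ≡⟨ sym (expand x) ⟩
            dot (M x) (lin c y′) ≡⟨ Mc≡0 x ⟩
            0# ∎

      -- Projection along `φ` removes the x-coordinate of a vector without changing its products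
      -- with the rows off `x`. The functionals of the smaller matrix therefore control these rows,
      -- and only row `x` is left to treat.
      module _ {r} (Q : Matrix r n) (bound : ∀ v → (∀ t → dot (Q t) v ≡ 0#) → InKernel M′ v)
        {φ : Vect n} (φx≢0 : φ x ≢ 0#) (Mφ≡0 : ∀ u → u ≢ x → dot (M u) φ ≡ 0#) where
        private
          p : Carrier
          p = proj₁ (inverse (φ x) φx≢0)

          φxp≡1 : φ x ⊗ p ≡ 1#
          φxp≡1 = proj₂ (inverse (φ x) φx≢0)

          -- Q evaluated on the projection v − (v x / φ x) φ along φ.
          Q′ : Matrix r n
          Q′ t i = Q t i ⊕ (⊖ (p ⊗ dot (Q t) φ)) ⊗ basis x i

          project : Vect n → Vect n
          project v i = v i ⊕ (⊖ (v x ⊗ p)) ⊗ φ i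

          project-x : ∀ v → project v x ≡ 0#
          project-x v = begin
            v x ⊕ (⊖ (v x ⊗ p)) ⊗ φ x ≡⟨ solve 3 (λ v p f → v :+ (:- (v :* p)) :* f := v :+ (:- (v :* (f :* p)))) refl (v x) p (φ x) ⟩
            v x ⊕ (⊖ (v x ⊗ (φ x ⊗ p))) ≡⟨ cong (λ e → v x ⊕ (⊖ e)) (trans (cong (v x ⊗_) φxp≡1) (R.*-identityʳ _)) ⟩
            v x ⊕ (⊖ v x) ≡⟨ R.-‿inverseʳ _ ⟩
            0# ∎
            where open ≡-Reasoning

          Q-project : ∀ v t → dot (Q t) (project v) ≡ dot (Q′ t) v
          Q-project v t = begin
            dot (Q t) (project v) ≡⟨ dot-axpyʳ (Q t) v (⊖ (v x ⊗ p)) φ ⟩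
            dot (Q t) v ⊕ (⊖ (v x ⊗ p)) ⊗ dot (Q t) φ
              ≡⟨ solve 4 (λ a b p d → a :+ (:- (b :* p)) :* d := a :+ (:- (p :* d)) :* b) refl (dot (Q t) v) (v x) p (dot (Q t) φ) ⟩
            dot (Q t) v ⊕ (⊖ (p ⊗ dot (Q t) φ)) ⊗ v x
              ≡⟨ cong (λ e → dot (Q t) v ⊕ (⊖ (p ⊗ dot (Q t) φ)) ⊗ e) (sym (dot-basisˡ x v)) ⟩
            dot (Q t) v ⊕ (⊖ (p ⊗ dot (Q t) φ)) ⊗ dot (basis x) v
              ≡⟨ sym (dot-axpyˡ (Q t) (⊖ (p ⊗ dot (Q t) φ)) (basis x) v) ⟩
            dot (Q′ t) v ∎
            where open ≡-Reasoning

          off-rows-vanish : ∀ v → (∀ t → dot (Q′ t) v ≡ 0#) → ∀ u → u ≢ x → dot (M u) v ≡ 0#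
          off-rows-vanish v Q′v≡0 u u≢x = begin
            dot (M u) v ≡⟨ sym (trans (cong (λ e → dot (M u) v ⊕ (⊖ (v x ⊗ p)) ⊗ e) (Mφ≡0 u u≢x))
              (trans (cong (dot (M u) v ⊕_) (R.zeroʳ _)) (R.+-identityʳ _))) ⟩
            dot (M u) v ⊕ (⊖ (v x ⊗ p)) ⊗ dot (M u) φ ≡⟨ sym (dot-axpyʳ (M u) v (⊖ (v x ⊗ p)) φ) ⟩
            dot (M u) (project v) ≡⟨ sym (deleted-dot u u≢x (project v) (project-x v)) ⟩
            dot (M′ u) (project v) ≡⟨ bound (project v) (λ t → trans (Q-project v t) (Q′v≡0 t)) u ⟩
            0# ∎
            where open ≡-Reasoning

        -- Row `x` needs no further functional: the relation given by the kernel vector `φ`, whose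
        -- coefficient at `x` is invertible, expresses it through the other rows.
        atMost-kernel : InKernel M φ → RankAtMost M r
        atMost-kernel Mφ≡0′ = Q′ , bound′
          where
          open ≡-Reasoning
          bound′ : ∀ v → (∀ t → dot (Q′ t) v ≡ 0#) → InKernel M v
          bound′ v Q′v≡0 u with u Fin.≟ x
          ... | no u≢x = off-rows-vanish v Q′v≡0 u u≢x
          ... | yes refl = ⊗-zero-product (conj-nonzero φx≢0) (begin
            conj (φ x) ⊗ dot (M x) v
              ≡⟨ sym (dot-supportedʳ (conj ∘ φ) {λ u → dot (M u) v} x (off-rows-vanish v Q′v≡0)) ⟩
            dot (conj ∘ φ) (λ u → dot (M u) v) ≡⟨ adjoint herm Mφ≡0′ v ⟩
            dot (λ _ → conj 0#) v ≡⟨ dot-zeroˡ v (λ _ → conj-0) ⟩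
            0# ∎)

        atMost-suc : RankAtMost M (suc r)
        atMost-suc = Q″ , bound′
          where
          Q″ : Matrix (suc r) n
          Q″ zero = M x
          Q″ (suc t) = Q′ t
          bound′ : ∀ v → (∀ t → dot (Q″ t) v ≡ 0#) → InKernel M v
          bound′ v Q″v≡0 u with u Fin.≟ x
          ... | no u≢x = off-rows-vanish v (Q″v≡0 ∘ suc) u u≢x
          ... | yes refl = Q″v≡0 zero

      module _ {s r} (rank : Rank M s) (rank′ : Rank M′ r) where

        rank-deletion-≤ : r ≤ s
        rank-deletion-≤ = atLeast≤atMost (atLeast-restore (proj₂ rank′)) (proj₁ rank)

        rank-deletion-≥ : s ≤ 2 + r
        rank-deletion-≥ = atLeast≤atMost (proj₂ rank) (atMost-restore (proj₁ rank′))

        kernelAt⇒rank≡ : KernelAt x M → s ≡ r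
        kernelAt⇒rank≡ (ψ , Mψ≡0 , ψx≢0) = ℕ.≤-antisym
          (atLeast≤atMost (proj₂ rank) (atMost-kernel (proj₁ (proj₁ rank′)) (proj₂ (proj₁ rank′)) ψx≢0 (λ u _ → Mψ≡0 u) Mψ≡0))
          rank-deletion-≤

        solves⇒rank≡2+ : ∀ {φ} → Solves x M φ → φ x ≡ 0# → s ≡ 2 + r
        solves⇒rank≡2+ solves φx≡0 = ℕ.≤-antisym rank-deletion-≥
          (atLeast≤atMost (atLeast-solves-zero solves φx≡0 (proj₂ rank′)) (proj₁ rank))

        rank≡⇒kernelAt : s ≡ r → KernelAt x M
        rank≡⇒kernelAt refl with kernelAt⊎solves herm x
        ... | inj₁ kernel = kernel
        ... | inj₂ (φ , solves) = ⊥-elim (ℕ.1+n≰n (atLeast≤atMost (atLeast-solves solves (proj₂ rank′)) (proj₁ rank)))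

        -- A kernel vector that is nonzero at `x` would give no drop, and a solution that is nonzero
        -- at `x` a drop of at most one.
        rank≡2+⇒solves : s ≡ 2 + r → ∃[ φ ] Solves x M φ × φ x ≡ 0#
        rank≡2+⇒solves s≡2+r with kernelAt⊎solves herm x
        ... | inj₁ kernel = ⊥-elim (ℕ.m≢1+n+m r (trans (sym (kernelAt⇒rank≡ kernel)) s≡2+r))
        ... | inj₂ (φ , solves) with φ x ≟ 0#
        ...   | yes φx≡0 = φ , solves , φx≡0
        ...   | no φx≢0 = ⊥-elim (ℕ.1+n≰n (ℕ.≤-trans (ℕ.≤-reflexive (sym s≡2+r))
                (atLeast≤atMost (proj₂ rank) (atMost-suc (proj₁ (proj₁ rank′)) (proj₂ (proj₁ rank′)) φx≢0
                  (λ u u≢x → trans (solves u) (basis-other u≢x))))))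

-- The fields ℚ and ℚ(i)

ℚ-field : FieldWithConj
ℚ-field = record
  { rawRing = Q.+-*-rawRing
  ; isCommutativeRing = Q.+-*-isCommutativeRing
  ; _≟_ = Q._≟_
  ; inverse = λ p p≢0 → let instance _ = Q.≢-nonZero p≢0 in Q.1/ p , Q.*-inverseʳ p
  ; 1≢0 = λ ()
  ; conj = λ p → p
  ; conj-⊕ = λ _ _ → refl
  ; conj-⊗ = λ _ _ → refl
  ; conj-conj = λ _ → refl
  }

module Gaussian where
  open RingSolver ℚ-field using (module Solver)
  open Solver using (solve; _:=_; _:+_; _:*_; :-_)
  open RawRing ℚi-rawRing using () renaming (_+_ to _⊕_; _*_ to _⊗_; -_ to ⊖_)
  open ℚi

  square-nonNegative : ∀ p → 0ℚ Q.≤ p Q.* p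
  square-nonNegative p with Q.≤-total 0ℚ p
  ... | inj₁ 0≤p = subst (Q._≤ p Q.* p) (Q.*-zeroʳ p)
        (Q.*-monoˡ-≤-nonNeg p ⦃ Q.nonNegative 0≤p ⦄ 0≤p)
  ... | inj₂ p≤0 = subst (Q._≤ p Q.* p) (Q.*-zeroʳ p)
        (Q.*-monoˡ-≤-nonPos p ⦃ Q.nonPositive p≤0 ⦄ p≤0)

  square≡0 : ∀ p → p Q.* p ≡ 0ℚ → p ≡ 0ℚ
  square≡0 p pp≡0 with p Q.≟ 0ℚ
  ... | yes p≡0 = p≡0
  ... | no p≢0 = Vectors.⊗-zero-product ℚ-field p≢0 pp≡0

  sum-of-squares≡0 : ∀ p q → p Q.* p Q.+ q Q.* q ≡ 0ℚ → p Q.* p ≡ 0ℚ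
  sum-of-squares≡0 p q eq = Q.≤-antisym
    (subst (p Q.* p Q.≤_) eq (subst (Q._≤ p Q.* p Q.+ q Q.* q) (Q.+-identityʳ (p Q.* p))
      (Q.+-monoʳ-≤ (p Q.* p) (square-nonNegative q))))
    (square-nonNegative p)

  norm : ℚi → ℚ
  norm (a +i b) = a Q.* a Q.+ b Q.* b

  norm≢0 : ∀ z → z ≢ 0ℚ +i 0ℚ → norm z ≢ 0ℚ
  norm≢0 (a +i b) z≢0 eq = z≢0 (cong₂ _+i_ (square≡0 a (sum-of-squares≡0 a b eq))
    (square≡0 b (sum-of-squares≡0 b a (trans (Q.+-comm (b Q.* b) (a Q.* a)) eq))))

  inverse : ∀ z → z ≢ 0ℚ +i 0ℚ → ∃[ w ] z ⊗ w ≡ 1ℚ +i 0ℚ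
  inverse (a +i b) z≢0 with FieldWithConj.inverse ℚ-field (norm (a +i b)) (norm≢0 _ z≢0)
  ... | d , nd≡1 = (a Q.* d) +i (Q.- (b Q.* d)) , cong₂ _+i_
    (trans (solve 3 (λ a b d → a :* (a :* d) :+ (:- (b :* (:- (b :* d)))) := (a :* a :+ b :* b) :* d) refl a b d) nd≡1)
    (trans (solve 3 (λ a b d → a :* (:- (b :* d)) :+ b :* (a :* d) := d :+ (:- d)) refl a b d) (Q.+-inverseʳ d))

  isCommutativeRing : IsCommutativeRing _≡_ _⊕_ _⊗_ ⊖_ (0ℚ +i 0ℚ) (1ℚ +i 0ℚ)
  isCommutativeRing = record
    { isRing = record
      { +-isAbelianGroup = record
        { isGroup = record
          { isMonoid = record
            { isSemigroup = record
              { isMagma = record { isEquivalence = Eq.isEquivalence ; ∙-cong = cong₂ _⊕_ }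
              ; assoc = λ x y z → cong₂ _+i_ (Q.+-assoc (re x) (re y) (re z)) (Q.+-assoc (im x) (im y) (im z))
              }
            ; identity = (λ x → cong₂ _+i_ (Q.+-identityˡ (re x)) (Q.+-identityˡ (im x)))
                       , (λ x → cong₂ _+i_ (Q.+-identityʳ (re x)) (Q.+-identityʳ (im x)))
            }
          ; inverse = (λ x → cong₂ _+i_ (Q.+-inverseˡ (re x)) (Q.+-inverseˡ (im x)))
                    , (λ x → cong₂ _+i_ (Q.+-inverseʳ (re x)) (Q.+-inverseʳ (im x)))
          ; ⁻¹-cong = cong ⊖_
          }
        ; comm = λ x y → cong₂ _+i_ (Q.+-comm (re x) (re y)) (Q.+-comm (im x) (im y))
        }
      ; *-cong = cong₂ _⊗_
      ; *-assoc = λ x y z → cong₂ _+i_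
          (solve 6 (λ a b c d e f → (a :* c :+ :- (b :* d)) :* e :+ :- ((a :* d :+ b :* c) :* f)
            := a :* (c :* e :+ :- (d :* f)) :+ :- (b :* (c :* f :+ d :* e))) refl (re x) (im x) (re y) (im y) (re z) (im z))
          (solve 6 (λ a b c d e f → (a :* c :+ :- (b :* d)) :* f :+ (a :* d :+ b :* c) :* e
            := a :* (c :* f :+ d :* e) :+ b :* (c :* e :+ :- (d :* f))) refl (re x) (im x) (re y) (im y) (re z) (im z))
      ; *-identity = identityˡ , λ x → trans (*-comm x _) (identityˡ x)
      ; distrib = distribˡ , λ x y z → trans (*-comm (y ⊕ z) x) (trans (distribˡ x y z) (cong₂ _⊕_ (*-comm x y) (*-comm x z)))
      }
    ; *-comm = *-comm
    }
    where
    import Relation.Binary.PropositionalEquality as Eq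
    *-comm : ∀ x y → x ⊗ y ≡ y ⊗ x
    *-comm x y = cong₂ _+i_
      (solve 4 (λ a b c d → a :* c :+ :- (b :* d) := c :* a :+ :- (d :* b)) refl (re x) (im x) (re y) (im y))
      (solve 4 (λ a b c d → a :* d :+ b :* c := c :* b :+ d :* a) refl (re x) (im x) (re y) (im y))
    identityˡ : ∀ x → (1ℚ +i 0ℚ) ⊗ x ≡ x
    identityˡ (a +i b) = cong₂ _+i_
      (trans (cong₂ Q._-_ (Q.*-identityˡ a) (Q.*-zeroˡ b)) (Q.+-identityʳ a))
      (trans (cong₂ Q._+_ (Q.*-identityˡ b) (Q.*-zeroˡ a)) (Q.+-identityʳ b))
    distribˡ : ∀ x y z → x ⊗ (y ⊕ z) ≡ x ⊗ y ⊕ x ⊗ z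
    distribˡ x y z = cong₂ _+i_
      (solve 6 (λ a b c d e f → a :* (c :+ e) :+ :- (b :* (d :+ f)) := (a :* c :+ :- (b :* d)) :+ (a :* e :+ :- (b :* f)))
        refl (re x) (im x) (re y) (im y) (re z) (im z))
      (solve 6 (λ a b c d e f → a :* (d :+ f) :+ b :* (c :+ e) := (a :* d :+ b :* c) :+ (a :* f :+ b :* e))
        refl (re x) (im x) (re y) (im y) (re z) (im z))

  conjugate : ℚi → ℚi
  conjugate (a +i b) = a +i (Q.- b)

  decide : (x y : ℚi) → Dec (x ≡ y)
  decide (a +i b) (c +i d) with a Q.≟ c | b Q.≟ d
  ... | yes refl | yes refl = yes refl
  ... | no a≢c | _ = no λ { refl → a≢c refl }
  ... | _ | no b≢d = no λ { refl → b≢d refl }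

ℚi-field : FieldWithConj
ℚi-field = record
  { rawRing = ℚi-rawRing
  ; isCommutativeRing = Gaussian.isCommutativeRing
  ; _≟_ = Gaussian.decide
  ; inverse = Gaussian.inverse
  ; 1≢0 = λ ()
  ; conj = Gaussian.conjugate
  ; conj-⊕ = λ { (a +i b) (c +i d) → cong ((a Q.+ c) +i_) (Q.neg-distrib-+ b d) }
  ; conj-⊗ = λ { (a +i b) (c +i d) → cong₂ _+i_
      (solve 4 (λ a b c d → a :* c :+ :- (b :* d) := a :* c :+ :- ((:- b) :* (:- d))) refl a b c d)
      (solve 4 (λ a b c d → :- (a :* d :+ b :* c) := a :* (:- d) :+ (:- b) :* c) refl a b c d) }
  ; conj-conj = λ { (a +i b) → cong (a +i_) (Algebra.Properties.Ring.-‿involutive Q.+-*-ring b) }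
  }
  where open RingSolver.Solver ℚ-field using (solve; _:=_; _:+_; _:*_; :-_)

-- Boolean subsets and counting

∧-trueˡ : ∀ {a b} → a ∧ b ≡ true → a ≡ true
∧-trueˡ {true} _ = refl

∧-trueʳ : ∀ {a b} → a ∧ b ≡ true → b ≡ true
∧-trueʳ {true} b≡true = b≡true

∧-true : ∀ {a b} → a ≡ true → b ≡ true → a ∧ b ≡ true
∧-true refl refl = refl

¬true⇒false : ∀ {a} → a ≢ true → a ≡ false
¬true⇒false {true} a≢true = ⊥-elim (a≢true refl)
¬true⇒false {false} _ = refl

false≢true : ∀ {a} → a ≡ false → a ≢ true
false≢true refl ()

bool-ext : ∀ {a b} → (a ≡ true → b ≡ true) → (b ≡ true → a ≡ true) → a ≡ b
bool-ext {true} to _ = sym (to refl)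
bool-ext {false} {true} _ from = from refl
bool-ext {false} {false} _ _ = refl

remove : ∀ {n} → (Fin n → Bool) → Fin n → Fin n → Bool
remove p a w = p w ∧ not (does (w Fin.≟ a))

remove-self : ∀ {n} (p : Fin n → Bool) a → remove p a a ≡ false
remove-self p a = trans (cong (λ d → p a ∧ not d) (dec-true (a Fin.≟ a) refl)) (Bool.∧-zeroʳ (p a))

remove-other : ∀ {n} (p : Fin n → Bool) {a w} → w ≢ a → remove p a w ≡ p w
remove-other p {a} {w} w≢a = trans (cong (λ d → p w ∧ not d) (dec-false (w Fin.≟ a) w≢a)) (Bool.∧-identityʳ (p w))

remove⁺ : ∀ {n} (p : Fin n → Bool) {a w} → p w ≡ true → w ≢ a → remove p a w ≡ true
remove⁺ p pw w≢a = trans (remove-other p w≢a) pw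

remove⁻ : ∀ {n} (p : Fin n → Bool) {a w} → remove p a w ≡ true → p w ≡ true × w ≢ a
remove⁻ p {a} pw = ∧-trueˡ pw , λ { refl → false≢true (remove-self p a) pw }

count-cong : ∀ {n} {p q : Fin n → Bool} → (∀ w → p w ≡ q w) → count p ≡ count q
count-cong {zero} h = refl
count-cong {suc n} h = cong₂ (λ b c → (if b then 1 else 0) + c) (h zero) (count-cong (h ∘ suc))

count-none : ∀ {n} {p : Fin n → Bool} → (∀ w → p w ≡ false) → count p ≡ 0
count-none {zero} h = refl
count-none {suc n} h = cong₂ (λ b c → (if b then 1 else 0) + c) (h zero) (count-none (h ∘ suc))

count-remove : ∀ {n} (p : Fin n → Bool) a → p a ≡ true → count p ≡ suc (count (remove p a))
count-remove {suc n} p zero pa rewrite pa =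
  cong suc (count-cong (λ w → sym (Bool.∧-identityʳ (p (suc w)))))
count-remove {suc n} p (suc a) pa rewrite Bool.∧-identityʳ (p zero) =
  trans (cong ((if p zero then 1 else 0) +_) (count-remove (p ∘ suc) a pa)) (ℕ.+-suc _ _)

count-witness : ∀ {n} (p : Fin n → Bool) → count p ≢ 0 → ∃[ w ] p w ≡ true
count-witness p c≢0 with Fin.any? (λ w → p w Bool.≟ true)
... | yes found = found
... | no absent = ⊥-elim (c≢0 (count-none (λ w → ¬true⇒false (λ pw → absent (w , pw)))))

count≢1⇒another : ∀ {n} (p : Fin n → Bool) {a} → p a ≡ true → count p ≢ 1 → ∃[ b ] b ≢ a × p b ≡ true
count≢1⇒another p {a} pa c≢1 with count-witness (remove p a) (λ c≡0 → c≢1 (trans (count-remove p a pa) (cong suc c≡0)))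
... | b , rb = b , proj₂ (remove⁻ p rb) , proj₁ (remove⁻ p rb)

two⇒count≢1 : ∀ {n} (p : Fin n → Bool) {a b} → a ≢ b → p a ≡ true → p b ≡ true → count p ≢ 1
two⇒count≢1 p {a} {b} a≢b pa pb c≡1
  with trans (sym c≡1) (trans (count-remove p a pa) (cong suc (count-remove (remove p a) b (remove⁺ p pb (a≢b ∘ sym)))))
... | ()

sumF-cong : ∀ {n} {f g : Fin n → ℕ} → (∀ u → f u ≡ g u) → sumF f ≡ sumF g
sumF-cong {zero} h = refl
sumF-cong {suc n} h = cong₂ _+_ (h zero) (sumF-cong (h ∘ suc))

sumF-none : ∀ {n} {f : Fin n → ℕ} → (∀ u → f u ≡ 0) → sumF f ≡ 0
sumF-none {zero} h = refl
sumF-none {suc n} h = cong₂ _+_ (h zero) (sumF-none (h ∘ suc))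

sumF-increment : ∀ {n} {f g : Fin n → ℕ} a → f a ≡ suc (g a) → (∀ u → u ≢ a → f u ≡ g u) →
  sumF f ≡ suc (sumF g)
sumF-increment zero fa h = cong₂ _+_ fa (sumF-cong (λ u → h (suc u) λ ()))
sumF-increment {f = f} {g} (suc a) fa h = trans
  (cong₂ _+_ (h zero λ ()) (sumF-increment a fa (λ u u≢a → h (suc u) (u≢a ∘ Fin.suc-injective))))
  (ℕ.+-suc (g zero) _)

-- The cyclomatic number and the deletion of edges

SamePair : ∀ {n} → Fin n → Fin n → Fin n → Fin n → Set
SamePair a b u v = (u ≡ a × v ≡ b) ⊎ (u ≡ b × v ≡ a)

samePair? : ∀ {n} (a b u v : Fin n) → Dec (SamePair a b u v)
samePair? a b u v = (u Fin.≟ a ×-dec v Fin.≟ b) ⊎-dec (u Fin.≟ b ×-dec v Fin.≟ a)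

_⊆_ : ∀ {n} → Graph n → Graph n → Set
G′ ⊆ G = ∀ {u v} → Adj G′ u v → Adj G u v

adj-symm : ∀ {n} (G : Graph n) {u v} → Adj G u v → Adj G v u
adj-symm G {u} {v} uv = trans (adj-sym G v u) uv

adj⇒≢ : ∀ {n} (G : Graph n) {u v} → Adj G u v → u ≢ v
adj⇒≢ G {u} uv refl = false≢true (irrefl G u) uv

reach-⊆ : ∀ {n} {G′ G : Graph n} → G′ ⊆ G → ∀ {u v} → Reach G′ u v → Reach G u v
reach-⊆ sub ε = ε
reach-⊆ {G′ = G′} {G} sub (e ◅ r) = sub e ◅ reach-⊆ {G′ = G′} {G} sub r

reach-sym : ∀ {n} (G : Graph n) {u v} → Reach G u v → Reach G v u
reach-sym G ε = ε
reach-sym G (e ◅ r) = reach-sym G r ◅◅ (adj-symm G e ◅ ε)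

_-edge_,_ : ∀ {n} → Graph n → Fin n → Fin n → Graph n
G -edge a , b = record
  { adj = λ u v → adj G u v ∧ not (does (samePair? a b u v))
  ; irrefl = λ u → cong (_∧ not (does (samePair? a b u u))) (irrefl G u)
  ; adj-sym = λ u v → cong₂ (λ x y → x ∧ not y) (adj-sym G u v) (same u v)
  }
  where
  same : ∀ u v → does (samePair? a b u v) ≡ does (samePair? a b v u)
  same u v = trans (Bool.∨-comm (does (u Fin.≟ a ×-dec v Fin.≟ b)) (does (u Fin.≟ b ×-dec v Fin.≟ a)))
    (cong₂ _∨_ (Bool.∧-comm (does (u Fin.≟ b)) (does (v Fin.≟ a))) (Bool.∧-comm (does (u Fin.≟ a)) (does (v Fin.≟ b))))

module _ {n} (G : Graph n) (a b : Fin n) where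

  edge-kept : ∀ {u v} → ¬ SamePair a b u v → adj (G -edge a , b) u v ≡ adj G u v
  edge-kept {u} {v} ¬p = trans (cong (λ d → adj G u v ∧ not d) (dec-false (samePair? a b u v) ¬p)) (Bool.∧-identityʳ _)

  edge-removed : ∀ {u v} → SamePair a b u v → adj (G -edge a , b) u v ≡ false
  edge-removed {u} {v} p = trans (cong (λ d → adj G u v ∧ not d) (dec-true (samePair? a b u v) p)) (Bool.∧-zeroʳ _)

  -edge-⊆ : (G -edge a , b) ⊆ G
  -edge-⊆ = ∧-trueˡ

  -edge⁺ : ∀ {u v} → Adj G u v → ¬ SamePair a b u v → Adj (G -edge a , b) u v
  -edge⁺ uv ¬p = trans (edge-kept ¬p) uv

numEdges-cong : ∀ {n} (G G′ : Graph n) → (∀ u v → adj G u v ≡ adj G′ u v) → numEdges G ≡ numEdges G′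
numEdges-cong G G′ h = sumF-cong (λ u → count-cong (λ v → cong (does (toℕ u ℕ.<? toℕ v) ∧_) (h u v)))

numEdges-none : ∀ {n} (G : Graph n) → (∀ u v → adj G u v ≡ false) → numEdges G ≡ 0
numEdges-none G h = sumF-none (λ u → count-none (λ v →
  trans (cong (does (toℕ u ℕ.<? toℕ v) ∧_) (h u v)) (Bool.∧-zeroʳ _)))

numEdges--edge-< : ∀ {n} (G : Graph n) a b → toℕ a < toℕ b → Adj G a b →
  numEdges G ≡ suc (numEdges (G -edge a , b))
numEdges--edge-< G a b a<b ab = sumF-increment a
  (trans (count-remove _ b (∧-true (dec-true (toℕ a ℕ.<? toℕ b) a<b) ab)) (cong suc (count-cong row))) other
  where
  up : ∀ u v → Bool
  up u v = does (toℕ u ℕ.<? toℕ v)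
  row : ∀ v → remove (λ v → up a v ∧ adj G a v) b v ≡ up a v ∧ adj (G -edge a , b) a v
  row v = case v Fin.≟ b of λ where
    (yes refl) → trans (remove-self (λ v → up a v ∧ adj G a v) b)
      (sym (trans (cong (up a v ∧_) (edge-removed G a b (inj₁ (refl , refl)))) (Bool.∧-zeroʳ _)))
    (no v≢b) → trans (remove-other (λ v → up a v ∧ adj G a v) v≢b) (cong (up a v ∧_) (sym (edge-kept G a b
      λ { (inj₁ (_ , v≡b)) → v≢b v≡b ; (inj₂ (a≡b , _)) → adj⇒≢ G ab a≡b })))
  other : ∀ u → u ≢ a → count (λ v → up u v ∧ adj G u v) ≡ count (λ v → up u v ∧ adj (G -edge a , b) u v)
  other u u≢a = count-cong entry
    where
    below : ∀ x → up b a ∧ x ≡ false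
    below x = cong (_∧ x) (dec-false (toℕ b ℕ.<? toℕ a) (ℕ.<-asym a<b))
    entry : ∀ v → up u v ∧ adj G u v ≡ up u v ∧ adj (G -edge a , b) u v
    entry v = case samePair? a b u v of λ where
      (no ¬p) → cong (up u v ∧_) (sym (edge-kept G a b ¬p))
      (yes (inj₁ (u≡a , _))) → ⊥-elim (u≢a u≡a)
      (yes (inj₂ (refl , refl))) → trans (below (adj G u v)) (sym (below (adj (G -edge a , b) u v)))

numEdges--edge : ∀ {n} (G : Graph n) a b → Adj G a b → numEdges G ≡ suc (numEdges (G -edge a , b))
numEdges--edge G a b ab with ℕ.<-cmp (toℕ a) (toℕ b)
... | tri< a<b _ _ = numEdges--edge-< G a b a<b ab
... | tri≈ _ a≡b _ = ⊥-elim (adj⇒≢ G ab (Fin.toℕ-injective a≡b))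
... | tri> _ _ b<a = trans (numEdges--edge-< G b a b<a (adj-symm G ab))
      (cong suc (numEdges-cong (G -edge b , a) (G -edge a , b) swapped))
  where
  swapped : ∀ u v → adj (G -edge b , a) u v ≡ adj (G -edge a , b) u v
  swapped u v = cong (λ d → adj G u v ∧ not d)
    (Bool.∨-comm (does (u Fin.≟ b ×-dec v Fin.≟ a)) (does (u Fin.≟ a ×-dec v Fin.≟ b)))

components-unique : ∀ {n} {G G′ : Graph n} {k k′} → (∀ u v → Reach G u v ⇔ Reach G′ u v) →
  NumComponents G k → NumComponents G′ k′ → k ≤ k′
components-unique {k = k} {k′} same (c , surj , iff) (c′ , surj′ , iff′) = Fin.injective⇒≤ {f = λ j → c′ (pick j)} injective
  where
  pick : Fin k → _
  pick j = proj₁ (surj j)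
  c-pick : ∀ j → c (pick j) ≡ j
  c-pick j = proj₂ (surj j) refl
  injective : Injective _≡_ _≡_ (λ j → c′ (pick j))
  injective {i} {j} eq = trans (sym (c-pick i)) (trans (Equivalence.from (iff (pick i) (pick j))
    (Equivalence.from (same (pick i) (pick j)) (Equivalence.to (iff′ (pick i) (pick j)) eq))) (c-pick j))

-- m = |E| − |V| + k, free of truncated subtraction.
Cyclomatic : ∀ {n} → Graph n → ℕ → Set
Cyclomatic {n} G m = ∃[ k ] NumComponents G k × numEdges G + k ≡ n + m

cyclomatic-cong : ∀ {n} {G G′ : Graph n} {m m′} → (∀ u v → adj G u v ≡ adj G′ u v) →
  Cyclomatic G m → Cyclomatic G′ m′ → m ≡ m′
cyclomatic-cong {n} {G} {G′} same (k , comps , eq) (k′ , comps′ , eq′) = ℕ.+-cancelˡ-≡ n _ _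
  (trans (sym eq) (trans (cong₂ _+_ (numEdges-cong G G′ same)
    (ℕ.≤-antisym (components-unique {G = G} {G′} (λ u v → mk⇔ to from) comps comps′)
                 (components-unique {G = G′} {G} (λ u v → mk⇔ from to) comps′ comps))) eq′))
  where
  to : ∀ {u v} → Reach G u v → Reach G′ u v
  to = reach-⊆ {G′ = G} {G′} (λ {u} {v} uv → trans (sym (same u v)) uv)
  from : ∀ {u v} → Reach G′ u v → Reach G u v
  from = reach-⊆ {G′ = G′} {G} (λ {u} {v} uv → trans (same u v) uv)

cyclomatic-unique : ∀ {n} {G : Graph n} {m m′} → Cyclomatic G m → Cyclomatic G m′ → m ≡ m′
cyclomatic-unique {G = G} = cyclomatic-cong {G = G} {G} (λ _ _ → refl)

module _ {n} (G : Graph n) (a b : Fin n) (ab : Adj G a b) where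
  private
    G′ : Graph n
    G′ = G -edge a , b

  components-joined : ∀ {k} (comps : NumComponents G′ k) → proj₁ comps a ≡ proj₁ comps b → NumComponents G k
  components-joined (c , surj , iff) ca≡cb = c , surj , λ u v →
    mk⇔ (λ cu≡cv → reach-⊆ {G′ = G′} {G} (-edge-⊆ G a b) (Equivalence.to (iff u v) cu≡cv)) same
    where
    step-same : ∀ {u v} → Adj G u v → c u ≡ c v
    step-same {u} {v} uv with samePair? a b u v
    ... | yes (inj₁ (refl , refl)) = ca≡cb
    ... | yes (inj₂ (refl , refl)) = sym ca≡cb
    ... | no ¬p = Equivalence.from (iff u v) (-edge⁺ G a b uv ¬p ◅ ε)
    same : ∀ {u v} → Reach G u v → c u ≡ c v
    same ε = refl
    same (e ◅ r) = trans (step-same e) (same r)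

  -- The label of b is replaced by that of a and then punched out of Fin (suc k).
  components-separated : ∀ {k} (comps : NumComponents G′ (suc k)) → proj₁ comps a ≢ proj₁ comps b →
    NumComponents G k
  components-separated {k} (c , surj , iff) ca≢cb = c′ , surj′ , λ u v → mk⇔
    (λ eq → connected u v (Fin.punchOut-injective (merged≢ u) (merged≢ v) eq))
    (λ r → Fin.punchOut-cong (c b) (same r))
    where
    rep : Fin n → Fin n
    rep w with c w Fin.≟ c b
    ... | yes _ = a
    ... | no _ = w
    merged≢ : ∀ w → c b ≢ c (rep w)
    merged≢ w with c w Fin.≟ c b
    ... | yes _ = ca≢cb ∘ sym
    ... | no cw≢cb = cw≢cb ∘ sym
    c′ : Fin n → Fin k
    c′ w = punchOut (merged≢ w)
    c-rep : ∀ w → c w ≢ c b → c (rep w) ≡ c w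
    c-rep w cw≢cb with c w Fin.≟ c b
    ... | yes eq = ⊥-elim (cw≢cb eq)
    ... | no _ = refl
    surj′ : Surjective _≡_ _≡_ c′
    surj′ y with surj (punchIn (c b) y)
    ... | w , cw = w , λ { refl → trans (Fin.punchOut-cong (c b) {i≢j = merged≢ w} {i≢k = Fin.punchInᵢ≢i (c b) y ∘ sym}
            (trans (c-rep w (λ eq → Fin.punchInᵢ≢i (c b) y (trans (sym (cw refl)) eq))) (cw refl)))
            (Fin.punchOut-punchIn (c b)) }
    lift : ∀ {u v} → c u ≡ c v → Reach G u v
    lift {u} {v} eq = reach-⊆ {G′ = G′} {G} (-edge-⊆ G a b) (Equivalence.to (iff u v) eq)
    to-rep : ∀ w → Reach G w (rep w)
    to-rep w with c w Fin.≟ c b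
    ... | yes eq = lift eq ◅◅ (adj-symm G ab ◅ ε)
    ... | no _ = ε
    connected : ∀ u v → c (rep u) ≡ c (rep v) → Reach G u v
    connected u v eq = to-rep u ◅◅ (lift eq ◅◅ reach-sym G (to-rep v))
    rep-cong : ∀ u v → c u ≡ c v → c (rep u) ≡ c (rep v)
    rep-cong u v eq with c u Fin.≟ c b | c v Fin.≟ c b
    ... | yes _ | yes _ = refl
    ... | yes p | no ¬q = ⊥-elim (¬q (trans (sym eq) p))
    ... | no ¬p | yes q = ⊥-elim (¬p (trans eq q))
    ... | no _ | no _ = eq
    rep-a : c (rep a) ≡ c a
    rep-a = c-rep a ca≢cb
    rep-b : c (rep b) ≡ c a
    rep-b with c b Fin.≟ c b
    ... | yes _ = refl
    ... | no b≢b = ⊥-elim (b≢b refl)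
    step-same : ∀ {u v} → Adj G u v → c (rep u) ≡ c (rep v)
    step-same {u} {v} uv with samePair? a b u v
    ... | yes (inj₁ (refl , refl)) = trans rep-a (sym rep-b)
    ... | yes (inj₂ (refl , refl)) = trans rep-b (sym rep-a)
    ... | no ¬p = rep-cong u v (Equivalence.from (iff u v) (-edge⁺ G a b uv ¬p ◅ ε))
    same : ∀ {u v} → Reach G u v → c (rep u) ≡ c (rep v)
    same ε = refl
    same (e ◅ r) = trans (step-same e) (same r)

  -- The new edge adds one to the number of edges. If its ends were already connected, the
  -- components stay the same; otherwise two of them merge and the two changes cancel.
  cyclomatic-restore : ∀ {m′} → Cyclomatic G′ m′ →
    ∃[ m ] Cyclomatic G m × m′ ≤ m × (Reach G′ a b → m ≡ suc m′)
  cyclomatic-restore {m′} (k , comps , eq) with proj₁ comps a Fin.≟ proj₁ comps b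
  ... | yes ca≡cb = suc m′ , (k , components-joined comps ca≡cb ,
        trans (cong (_+ k) (numEdges--edge G a b ab)) (trans (cong suc eq) (sym (ℕ.+-suc n m′)))) , ℕ.n≤1+n m′ , λ _ → refl
  cyclomatic-restore {m′} (zero , comps , eq) | no _ = case proj₁ comps a of λ ()
  cyclomatic-restore {m′} (suc k , comps , eq) | no ca≢cb = m′ , (k , components-separated comps ca≢cb ,
        trans (cong (_+ k) (numEdges--edge G a b ab)) (trans (sym (ℕ.+-suc _ k)) eq)) , ℕ.≤-refl ,
        λ r → ⊥-elim (ca≢cb (Equivalence.from (proj₂ (proj₂ comps) a b) r))

  cyclomatic--edge : ∀ {m m′} → Cyclomatic G m → Cyclomatic G′ m′ → m′ ≤ m × (Reach G′ a b → m ≡ suc m′)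
  cyclomatic--edge cyc cyc′ with cyclomatic-restore cyc′
  ... | m₁ , cyc₁ , le , eq with cyclomatic-unique {G = G} cyc cyc₁
  ...   | refl = le , eq

-- Edges are put back one at a time, starting from the edgeless graph. The labelling of components
-- built on the way decides reachability without a search for paths.
cyclomatic-exists′ : ∀ {n} e (G : Graph n) → numEdges G ≡ e → ∃ (Cyclomatic G)
cyclomatic-exists′ {n} e G edges with Fin.any? (λ u → Fin.any? (λ v → adj G u v Bool.≟ true))
... | no empty = 0 , n , ((λ u → u) , (λ y → y , λ eq → eq) , λ u v → mk⇔ (λ { refl → ε }) trivial) ,
      trans (cong (_+ n) (numEdges-none G (λ u v → ¬true⇒false (λ uv → empty (u , v , uv))))) (sym (ℕ.+-identityʳ n))
  where
  trivial : ∀ {u v} → Reach G u v → u ≡ v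
  trivial ε = refl
  trivial (e ◅ _) = ⊥-elim (empty (_ , _ , e))
cyclomatic-exists′ zero G edges | yes (a , b , ab) with trans (sym edges) (numEdges--edge G a b ab)
... | ()
cyclomatic-exists′ (suc e) G edges | yes (a , b , ab)
  with cyclomatic-restore G a b ab (proj₂ (cyclomatic-exists′ e (G -edge a , b)
         (ℕ.suc-injective (trans (sym (numEdges--edge G a b ab)) edges))))
... | m , cyc , _ = m , cyc

cyclomatic-exists : ∀ {n} (G : Graph n) → ∃ (Cyclomatic G)
cyclomatic-exists G = cyclomatic-exists′ (numEdges G) G refl

cyclomatic-⊆′ : ∀ {n} e (G G′ : Graph n) → numEdges G ≡ e → G′ ⊆ G → ∀ {m m′} →
  Cyclomatic G m → Cyclomatic G′ m′ → m′ ≤ m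
cyclomatic-⊆′ e G G′ edges sub cyc cyc′
  with Fin.any? (λ u → Fin.any? (λ v → (adj G u v Bool.≟ true) ×-dec (adj G′ u v Bool.≟ false)))
... | no same = ℕ.≤-reflexive (sym (cyclomatic-cong {G = G} {G′}
      (λ u v → bool-ext (λ uv → Bool.¬-not (λ f → same (u , v , uv , f))) sub) cyc cyc′))
cyclomatic-⊆′ zero G G′ edges sub cyc cyc′ | yes (a , b , ab , _)
  with trans (sym edges) (numEdges--edge G a b ab)
... | ()
cyclomatic-⊆′ (suc e) G G′ edges sub cyc cyc′ | yes (a , b , ab , ab′) = ℕ.≤-trans
  (cyclomatic-⊆′ e (G -edge a , b) G′ (ℕ.suc-injective (trans (sym (numEdges--edge G a b ab)) edges))
    (λ {u} {v} uv → -edge⁺ G a b (sub uv) λ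
      { (inj₁ (refl , refl)) → false≢true ab′ uv
      ; (inj₂ (refl , refl)) → false≢true ab′ (adj-symm G′ uv) })
    (proj₂ (cyclomatic-exists (G -edge a , b))) cyc′)
  (proj₁ (cyclomatic--edge G a b ab cyc (proj₂ (cyclomatic-exists (G -edge a , b)))))

cyclomatic-⊆ : ∀ {n} {G G′ : Graph n} → G′ ⊆ G → ∀ {m m′} → Cyclomatic G m → Cyclomatic G′ m′ → m′ ≤ m
cyclomatic-⊆ {G = G} {G′} = cyclomatic-⊆′ (numEdges G) G G′ refl

cyclomatic-⊂ : ∀ {n} {G G′ : Graph n} {a b} → Adj G a b → G′ ⊆ (G -edge a , b) → Reach (G -edge a , b) a b →
  ∀ {m m′} → Cyclomatic G m → Cyclomatic G′ m′ → suc m′ ≤ m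
cyclomatic-⊂ {G = G} {G′} {a} {b} ab sub r cyc cyc′ with cyclomatic-exists (G -edge a , b)
... | m₁ , cyc₁ = ℕ.≤-trans (s≤s (cyclomatic-⊆ {G = G -edge a , b} {G′} sub cyc₁ cyc′))
      (ℕ.≤-reflexive (sym (proj₂ (cyclomatic--edge G a b ab cyc cyc₁) r)))

-- Cycles

next-step : ∀ {m} (i : Fin (suc m)) → (toℕ i ≡ m × next i ≡ zero) ⊎ (toℕ (next i) ≡ suc (toℕ i))
next-step {zero} zero = inj₁ (refl , refl)
next-step {suc m} zero = inj₂ refl
next-step {suc m} (suc i) with next {m} i | next-step {m} i
... | zero | inj₁ (eq , _) = inj₁ (cong suc eq , refl)
... | suc j | inj₂ eq = inj₂ (cong suc eq)

toℕ-next : ∀ {m} (i : Fin (suc m)) → toℕ (next i) ≡ suc (toℕ i) % suc m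
toℕ-next {m} i with next-step i
... | inj₁ (eq , eq′) rewrite eq | eq′ = sym (ℕ.n%n≡0 (suc m))
... | inj₂ eq = trans eq (sym (ℕ.m<n⇒m%n≡m (subst (_< suc m) eq (Fin.toℕ<n (next i)))))

+-%ʳ : ∀ a b d ⦃ _ : ℕ.NonZero d ⦄ → (a + b % d) % d ≡ (a + b) % d
+-%ʳ a b d = begin
  (a + b % d) % d ≡⟨ ℕ.%-distribˡ-+ a (b % d) d ⟩
  (a % d + b % d % d) % d ≡⟨ cong (λ e → (a % d + e) % d) (ℕ.m%n%n≡m%n b d) ⟩
  (a % d + b % d) % d ≡⟨ sym (ℕ.%-distribˡ-+ a b d) ⟩
  (a + b) % d ∎
  where open ≡-Reasoning

rot : ∀ {m} → Fin (suc m) → ℕ → Fin (suc m)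
rot i zero = i
rot i (suc t) = next (rot i t)

toℕ-rot : ∀ {m} (i : Fin (suc m)) t → toℕ (rot i t) ≡ (toℕ i + t) % suc m
toℕ-rot {m} i zero = sym (trans (cong (_% suc m) (ℕ.+-identityʳ (toℕ i))) (ℕ.m<n⇒m%n≡m (Fin.toℕ<n i)))
toℕ-rot {m} i (suc t) = begin
  toℕ (next (rot i t)) ≡⟨ toℕ-next (rot i t) ⟩
  (1 + toℕ (rot i t)) % suc m ≡⟨ cong (λ r → (1 + r) % suc m) (toℕ-rot i t) ⟩
  (1 + (toℕ i + t) % suc m) % suc m ≡⟨ +-%ʳ 1 (toℕ i + t) (suc m) ⟩
  (1 + (toℕ i + t)) % suc m ≡⟨ cong (_% suc m) (sym (ℕ.+-suc (toℕ i) t)) ⟩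
  (toℕ i + suc t) % suc m ∎
  where open ≡-Reasoning

rot-full : ∀ {m} (i : Fin (suc m)) → rot i (suc m) ≡ i
rot-full {m} i = Fin.toℕ-injective (trans (toℕ-rot i (suc m))
  (trans (ℕ.[m+n]%n≡m%n (toℕ i) (suc m)) (ℕ.m<n⇒m%n≡m (Fin.toℕ<n i))))

rot-next : ∀ {m} (i : Fin (suc m)) t → rot (next i) t ≡ rot i (suc t)
rot-next i zero = refl
rot-next i (suc t) = cong next (rot-next i t)

-- Equal residues of `a + s` and `a + t`, at a distance strictly between 0 and `L`, would force
-- quotients with `q₁ < q₂ < suc q₁`.
rot-injective-< : ∀ {m} (i : Fin (suc m)) {s t} → s < t → t < suc m → rot i s ≢ rot i t
rot-injective-< {m} i {s} {t} s<t t<L eq = ℕ.<-irrefl refl (begin-strict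
  a + t ≡⟨ ℕ.m≡m%n+[m/n]*n (a + t) L ⟩
  (a + t) % L + q₂ * L ≡⟨ cong (_+ q₂ * L) (sym same) ⟩
  (a + s) % L + q₂ * L <⟨ ℕ.+-monoʳ-< ((a + s) % L) bound ⟩
  (a + s) % L + suc q₁ * L ≤⟨ ℕ.+-monoʳ-≤ ((a + s) % L) (ℕ.*-monoˡ-≤ L q₁<q₂) ⟩
  (a + s) % L + q₂ * L ≡⟨ cong (_+ q₂ * L) same ⟩
  (a + t) % L + q₂ * L ≡⟨ sym (ℕ.m≡m%n+[m/n]*n (a + t) L) ⟩
  a + t ∎)
  where
  open ℕ.≤-Reasoning
  L a q₁ q₂ : ℕ
  L = suc m
  a = toℕ i
  q₁ = (a + s) / L
  q₂ = (a + t) / L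
  same : (a + s) % L ≡ (a + t) % L
  same = trans (sym (toℕ-rot i s)) (trans (cong toℕ eq) (toℕ-rot i t))
  q₁<q₂ : q₁ < q₂
  q₁<q₂ = ℕ.*-cancelʳ-< L q₁ q₂ (ℕ.+-cancelˡ-< ((a + s) % L) (q₁ * L) (q₂ * L) (begin-strict
    (a + s) % L + q₁ * L ≡⟨ sym (ℕ.m≡m%n+[m/n]*n (a + s) L) ⟩
    a + s <⟨ ℕ.+-monoʳ-< a s<t ⟩
    a + t ≡⟨ ℕ.m≡m%n+[m/n]*n (a + t) L ⟩
    (a + t) % L + q₂ * L ≡⟨ cong (_+ q₂ * L) (sym same) ⟩
    (a + s) % L + q₂ * L ∎))
  bound : q₂ * L < suc q₁ * L
  bound = ℕ.+-cancelˡ-< ((a + s) % L) (q₂ * L) (suc q₁ * L) (begin-strict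
    (a + s) % L + q₂ * L ≡⟨ cong (_+ q₂ * L) same ⟩
    (a + t) % L + q₂ * L ≡⟨ sym (ℕ.m≡m%n+[m/n]*n (a + t) L) ⟩
    a + t <⟨ ℕ.+-monoʳ-< a t<L ⟩
    a + L ≤⟨ ℕ.+-monoˡ-≤ L (ℕ.m≤m+n a s) ⟩
    a + s + L ≡⟨ cong (_+ L) (ℕ.m≡m%n+[m/n]*n (a + s) L) ⟩
    (a + s) % L + q₁ * L + L ≡⟨ trans (ℕ.+-assoc ((a + s) % L) (q₁ * L) L) (cong ((a + s) % L +_) (ℕ.+-comm (q₁ * L) L)) ⟩
    (a + s) % L + suc q₁ * L ∎)

rot-injective : ∀ {m} (i : Fin (suc m)) {s t} → s < suc m → t < suc m → rot i s ≡ rot i t → s ≡ t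
rot-injective i {s} {t} s<L t<L eq with ℕ.<-cmp s t
... | tri< s<t _ _ = ⊥-elim (rot-injective-< i s<t t<L eq)
... | tri≈ _ s≡t _ = s≡t
... | tri> _ _ t<s = ⊥-elim (rot-injective-< i t<s s<L (sym eq))

rot-surjective : ∀ {m} (i j : Fin (suc m)) → ∃[ t ] t < suc m × rot i t ≡ j
rot-surjective {m} i j = (b + (L ∸ a)) % L , ℕ.m%n<n (b + (L ∸ a)) L , Fin.toℕ-injective (begin
  toℕ (rot i ((b + (L ∸ a)) % L)) ≡⟨ toℕ-rot i _ ⟩
  (a + (b + (L ∸ a)) % L) % L ≡⟨ +-%ʳ a (b + (L ∸ a)) L ⟩
  (a + (b + (L ∸ a))) % L ≡⟨ cong (_% L) (trans (sym (ℕ.+-assoc a b (L ∸ a)))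
      (trans (cong (_+ (L ∸ a)) (ℕ.+-comm a b)) (trans (ℕ.+-assoc b a (L ∸ a))
        (cong (b +_) (ℕ.m+[n∸m]≡n (ℕ.<⇒≤ (Fin.toℕ<n i))))))) ⟩
  (b + L) % L ≡⟨ ℕ.[m+n]%n≡m%n b L ⟩
  b % L ≡⟨ ℕ.m<n⇒m%n≡m (Fin.toℕ<n j) ⟩
  b ∎)
  where
  open ≡-Reasoning
  L a b : ℕ
  L = suc m
  a = toℕ i
  b = toℕ j

module _ {n} {G : Graph n} (C : Cycle G) where

  around : Fin (len C) → ℕ → Fin n
  around i t = vert C (rot i t)

  around-full : ∀ i → around i (len C) ≡ vert C i
  around-full i = cong (vert C) (rot-full i)

  around-adj : ∀ i t → Adj G (around i t) (around i (suc t))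
  around-adj i t = step C (rot i t)

  around-injective : ∀ i {s t} → s < len C → t < len C → around i s ≡ around i t → s ≡ t
  around-injective i s<L t<L eq = rot-injective i s<L t<L (inj C eq)

  around-edge : ∀ i t → CycleEdge C (around i t) (around i (suc t))
  around-edge i t = rot i t , inj₁ (refl , refl)

  cycleEdge-sym : ∀ {u v} → CycleEdge C u v → CycleEdge C v u
  cycleEdge-sym (i , inj₁ (p , q)) = i , inj₂ (p , q)
  cycleEdge-sym (i , inj₂ (p , q)) = i , inj₁ (p , q)

  cycleEdge-adj : ∀ {u v} → CycleEdge C u v → Adj G u v
  cycleEdge-adj (i , inj₁ (refl , refl)) = step C i
  cycleEdge-adj (i , inj₂ (refl , refl)) = adj-symm G (step C i)

  cycleEdge-on : ∀ {u v} → CycleEdge C u v → OnCycle C u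
  cycleEdge-on (i , inj₁ (p , _)) = i , p
  cycleEdge-on (i , inj₂ (_ , q)) = next i , q

  -- `2 + k C` is the length minus one, so `around i (2 + k C)` is the predecessor of `vert C i`,
  -- reached by going forward.
  cycleEdge-neighbour : ∀ i {y} → CycleEdge C (vert C i) y → y ≡ around i 1 ⊎ y ≡ around i (2 + k C)
  cycleEdge-neighbour i (j , inj₁ (p , q)) = inj₁ (trans (sym q) (cong (vert C ∘ next) (inj C p)))
  cycleEdge-neighbour i (j , inj₂ (p , q)) = inj₂ (trans (sym p) (cong (vert C)
    (trans (sym (rot-full j)) (trans (sym (rot-next j (2 + k C))) (cong (λ e → rot e (2 + k C)) (inj C q))))))

  last-edge : ∀ i → CycleEdge C (vert C i) (around i (2 + k C))
  last-edge i = cycleEdge-sym (subst (CycleEdge C (around i (2 + k C))) (around-full i) (around-edge i (2 + k C)))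

  last≢first : ∀ i → around i (2 + k C) ≢ around i 1
  last≢first i eq with around-injective i (ℕ.n<1+n _) (s≤s (s≤s z≤n)) eq
  ... | ()

  Within : (Fin n → Bool) → Set
  Within S = ∀ i → In S (vert C i)

onCycle? : ∀ {n} {G : Graph n} (C : Cycle G) v → Dec (OnCycle C v)
onCycle? C v = Fin.any? (λ i → vert C i Fin.≟ v)

-- Follow `C′` from the common vertex: as long as the current vertex is on `C`, the hypothesis
-- places the next edge on `C`, and with it the next vertex.
sameCycle-⊆ : ∀ {n} {G : Graph n} (C C′ : Cycle G) →
  (∀ {x y} → OnCycle C x → CycleEdge C′ x y → CycleEdge C x y) →
  ∃[ v ] OnCycle C v × OnCycle C′ v → ∀ {u v} → CycleEdge C′ u v → CycleEdge C u v
sameCycle-⊆ C C′ local (v , on , (i , refl)) = edges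
  where
  all-on : ∀ t → OnCycle C (around C′ i t)
  all-on zero = on
  all-on (suc t) = cycleEdge-on C (cycleEdge-sym C (local (all-on t) (around-edge C′ i t)))
  on-C : ∀ j → OnCycle C (vert C′ j)
  on-C j with rot-surjective i j
  ... | t , _ , refl = all-on t
  edges : ∀ {u v} → CycleEdge C′ u v → CycleEdge C u v
  edges e with cycleEdge-on C′ e
  ... | j , refl = local (on-C j) e

-- The period has the form `3 + rest` to match the lengths in `Cycle`. `start` counts the vertices
-- before the closed part, which need not be empty.
record FirstRepetition {n} (f : ℕ → Fin n) : Set where
  field
    start rest : ℕ
    closes : f (start + (3 + rest)) ≡ f start
    distinct : ∀ {s t} → s < start + (3 + rest) → t < start + (3 + rest) → f s ≡ f t → s ≡ t

InjectiveBelow : ∀ {n} → (ℕ → Fin n) → ℕ → Set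
InjectiveBelow f m = ∀ {s t} → s < m → t < m → f s ≡ f t → s ≡ t

injectiveBelow-suc : ∀ {n} (f : ℕ → Fin n) {m} → InjectiveBelow f m → (∀ i → i < m → f i ≢ f m) → InjectiveBelow f (suc m)
injectiveBelow-suc f {m} injective fresh {s} {t} s<m t<m eq with ℕ.<-cmp s m | ℕ.<-cmp t m
... | tri< p _ _ | tri< q _ _ = injective p q eq
... | tri< p _ _ | tri≈ _ refl _ = ⊥-elim (fresh s p eq)
... | tri≈ _ refl _ | tri< q _ _ = ⊥-elim (fresh t q (sym eq))
... | tri≈ _ refl _ | tri≈ _ refl _ = refl
... | tri> _ _ p | _ = ⊥-elim (ℕ.<⇒≱ p (ℕ.s≤s⁻¹ s<m))
... | _ | tri> _ _ q = ⊥-elim (ℕ.<⇒≱ q (ℕ.s≤s⁻¹ t<m))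

repetition : ∀ {n} (f : ℕ → Fin n) m → InjectiveBelow f m ⊎ ∃[ j ] ∃[ i ] i < j × f i ≡ f j × InjectiveBelow f j
repetition f zero = inj₁ λ ()
repetition f (suc m) with repetition f m
... | inj₂ found = inj₂ found
... | inj₁ injective with Fin.any? {n = m} (λ i → f (toℕ i) Fin.≟ f m)
...   | yes (i , eq) = inj₂ (m , toℕ i , Fin.toℕ<n i , eq , injective)
...   | no fresh = inj₁ (injectiveBelow-suc f injective
        (λ i i<m eq → fresh (fromℕ< i<m , trans (cong f (Fin.toℕ-fromℕ< i<m)) eq)))

abstract
  -- Some vertex repeats by the pigeonhole principle. A period of one would be a loop and a period
  -- of two a step back, so the first repetition closes a genuine cycle.
  first-repetition : ∀ {n} (G : Graph n) (f : ℕ → Fin n) → (∀ t → Adj G (f t) (f (suc t))) →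
    (∀ t → f (suc (suc t)) ≢ f t) → FirstRepetition f
  first-repetition {n} G f adjacent forward with repetition f (suc n)
  ... | inj₁ injective = ⊥-elim (ℕ.1+n≰n (Fin.injective⇒≤ {f = λ (i : Fin (suc n)) → f (toℕ i)}
          (λ {i} {j} eq → Fin.toℕ-injective (injective (Fin.toℕ<n i) (Fin.toℕ<n j) eq))))
  ... | inj₂ (j , i , i<j , eq , injective) = gap (j ∸ i) (ℕ.m+[n∸m]≡n (ℕ.<⇒≤ i<j))
    where
    gap : ∀ d → i + d ≡ j → FirstRepetition f
    gap 0 refl = ⊥-elim (ℕ.<-irrefl (sym (ℕ.+-identityʳ i)) i<j)
    gap 1 refl = ⊥-elim (adj⇒≢ G (adjacent i) (trans eq (cong f (ℕ.+-comm i 1))))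
    gap 2 refl = ⊥-elim (forward i (sym (trans eq (cong f (ℕ.+-comm i 2)))))
    gap (suc (suc (suc d))) refl = record { start = i ; rest = d ; closes = sym eq ; distinct = injective }

module _ {n} (G : Graph n) (f : ℕ → Fin n) (adjacent : ∀ t → Adj G (f t) (f (suc t))) (rep : FirstRepetition f) where
  open FirstRepetition rep

  cycleOf : Cycle G
  cycleOf = record { k = rest ; vert = v ; inj = injective ; step = edge }
    where
    v : Fin (3 + rest) → Fin n
    v t = f (start + toℕ t)
    injective : Injective _≡_ _≡_ v
    injective {s} {t} eq = Fin.toℕ-injective (ℕ.+-cancelˡ-≡ start _ _
      (distinct (ℕ.+-monoʳ-< start (Fin.toℕ<n s)) (ℕ.+-monoʳ-< start (Fin.toℕ<n t)) eq))
    edge : ∀ t → Adj G (v t) (v (next t))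
    edge t with next-step t
    ... | inj₁ (eq , eq′) = subst (Adj G (v t)) (trans (cong f (trans (sym (ℕ.+-suc start (toℕ t)))
            (cong (λ e → start + suc e) eq))) (trans closes (cong f (trans (sym (ℕ.+-identityʳ start))
            (cong (λ e → start + toℕ e) (sym eq′)))))) (adjacent (start + toℕ t))
    ... | inj₂ eq = subst (Adj G (v t)) (cong f (trans (sym (ℕ.+-suc start (toℕ t))) (cong (start +_) (sym eq))))
            (adjacent (start + toℕ t))

-- Induced subgraphs

_⊆ₛ_ : ∀ {n} → (Fin n → Bool) → (Fin n → Bool) → Set
S′ ⊆ₛ S = ∀ {w} → In S′ w → In S w

remove-⊆ₛ : ∀ {n} (S : Fin n → Bool) x → remove S x ⊆ₛ S
remove-⊆ₛ S x = ∧-trueˡ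

remove-swap : ∀ {n} (S : Fin n → Bool) x y w → remove (remove S x) y w ≡ remove (remove S y) x w
remove-swap S x y w = trans (Bool.∧-assoc (S w) _ _)
  (trans (cong (S w ∧_) (Bool.∧-comm (not (does (w Fin.≟ x))) _)) (sym (Bool.∧-assoc (S w) _ _)))

-- Ranks of induced subgraphs

module Restriction (F : FieldWithConj) {n} (G : Graph n) (N : Vectors.Matrix F n n)
  (hermitian : VertexDeletion.Hermitian F N)
  (support : ∀ u v → adj G u v ≡ false → N u v ≡ FieldWithConj.0# F)
  (unit : ∀ u v → Adj G u v → N u v ≢ FieldWithConj.0# F) where
  open Vectors F
  open VertexDeletion F

  -- Vertices outside S keep zero rows and columns, so that every induced subgraph has an n × n matrix.
  restrict : (Fin n → Bool) → Matrix n n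
  restrict S u v = if S u ∧ S v then N u v else 0#

  restrict-in : ∀ S {u v} → In S u → In S v → restrict S u v ≡ N u v
  restrict-in S {u} {v} Su Sv = cong (if_then N u v else 0#) (∧-true Su Sv)

  restrict-outˡ : ∀ S {u v} → S u ≡ false → restrict S u v ≡ 0#
  restrict-outˡ S {u} {v} Su = cong (λ b → if b ∧ S v then N u v else 0#) Su

  restrict-outʳ : ∀ S {u v} → S v ≡ false → restrict S u v ≡ 0#
  restrict-outʳ S {u} {v} Sv = trans (cong (λ b → if S u ∧ b then N u v else 0#) Sv)
    (cong (if_then N u v else 0#) (Bool.∧-zeroʳ (S u)))

  restrict-nonadjacent : ∀ S u v → adj G u v ≡ false → restrict S u v ≡ 0#
  restrict-nonadjacent S u v uv with S u ∧ S v
  ... | true = support u v uv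
  ... | false = refl

  restrict-nonzero : ∀ S {u v} → restrict S u v ≢ 0# → In S u × In S v × Adj G u v
  restrict-nonzero S {u} {v} nz =
    Bool.¬-not (λ Su → nz (restrict-outˡ S Su)) ,
    Bool.¬-not (λ Sv → nz (restrict-outʳ S {u} Sv)) ,
    Bool.¬-not (λ uv → nz (restrict-nonadjacent S u v uv))

  restrict-hermitian : ∀ S → Hermitian (restrict S)
  restrict-hermitian S u v with S u | S v
  ... | true | true = hermitian u v
  ... | true | false = conj-0
  ... | false | true = conj-0
  ... | false | false = conj-0

  restrict-cong : ∀ {S S′} → (∀ w → S w ≡ S′ w) → ∀ u v → restrict S u v ≡ restrict S′ u v
  restrict-cong h u v = cong₂ (λ a b → if a ∧ b then N u v else 0#) (h u) (h v)

  restrict-deletion : ∀ S x → IsDeletion x (restrict S) (restrict (remove S x))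
  restrict-deletion S x = record
    { off = λ u v u≢x v≢x → cong₂ (λ a b → if a ∧ b then N u v else 0#) (remove-other S u≢x) (remove-other S v≢x)
    ; row = λ v → restrict-outˡ (remove S x) (remove-self S x)
    ; column = λ u → restrict-outʳ (remove S x) {u} (remove-self S x)
    }

  abstract
    -- Kept opaque: `rank-spec` determines the number by `rank-unique`, and the elimination that
    -- computes it should never unfold.
    rank : (Fin n → Bool) → ℕ
    rank S = proj₁ (rank-exists (restrict S))

    rank-spec : ∀ S → Rank (restrict S) (rank S)
    rank-spec S = proj₂ (rank-exists (restrict S))

  rank-≗ : ∀ {S S′} → (∀ w → S w ≡ S′ w) → rank S ≡ rank S′
  rank-≗ {S} {S′} h = rank-unique (rank-cong (restrict-cong h) (rank-spec S)) (rank-spec S′)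

  module _ (S : Fin n → Bool) (x : Fin n) where

    rank-remove-≤ : rank (remove S x) ≤ rank S
    rank-remove-≤ = rank-deletion-≤ (restrict-deletion S x) (restrict-hermitian S) (rank-spec S) (rank-spec (remove S x))

    rank-remove-≥ : rank S ≤ 2 + rank (remove S x)
    rank-remove-≥ = rank-deletion-≥ (restrict-deletion S x) (restrict-hermitian S) (rank-spec S) (rank-spec (remove S x))

    kernel⇒rank-same : KernelAt x (restrict S) → rank S ≡ rank (remove S x)
    kernel⇒rank-same = kernelAt⇒rank≡ (restrict-deletion S x) (restrict-hermitian S) (rank-spec S) (rank-spec (remove S x))

    solves⇒rank-drops : ∀ {φ} → Solves x (restrict S) φ → φ x ≡ 0# → rank S ≡ 2 + rank (remove S x)
    solves⇒rank-drops = solves⇒rank≡2+ (restrict-deletion S x) (restrict-hermitian S) (rank-spec S) (rank-spec (remove S x))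

    rank-same⇒kernel : rank S ≡ rank (remove S x) → KernelAt x (restrict S)
    rank-same⇒kernel = rank≡⇒kernelAt (restrict-deletion S x) (restrict-hermitian S) (rank-spec S) (rank-spec (remove S x))

    rank-drops⇒solves : rank S ≡ 2 + rank (remove S x) → ∃[ φ ] Solves x (restrict S) φ × φ x ≡ 0#
    rank-drops⇒solves = rank≡2+⇒solves (restrict-deletion S x) (restrict-hermitian S) (rank-spec S) (rank-spec (remove S x))

  pendant-unique : ∀ S {u v w} → Pendant G S u → In S v → Adj G u v → w ≢ v → In S w → adj G u w ≡ false
  pendant-unique S {u} {v} {w} (_ , deg) Sv uv w≢v Sw = ¬true⇒false (λ uw →
    two⇒count≢1 (λ z → S z ∧ adj G u z) w≢v (∧-true Sw uw) (∧-true Sv uv) deg)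

  module _ (S : Fin n → Bool) {u v} (pendant : Pendant G S u) (Sv : In S v) (uv : Adj G u v) where
    private
      c : Carrier
      c = proj₁ (inverse (N v u) (unit v u (adj-symm G uv)))

    -- Column `u` of the matrix has its only nonzero entry in row `v`. A multiple of e_u therefore
    -- solves the equation for e_v, and it is zero at `v`.
    rank-pendant-neighbour : rank S ≡ 2 + rank (remove S v)
    rank-pendant-neighbour = solves⇒rank-drops S v {λ i → c ⊗ basis u i} solves
      (trans (cong (c ⊗_) (basis-other (adj⇒≢ G uv ∘ sym))) (R.zeroʳ c))
      where
      column : ∀ w → dot (restrict S w) (λ i → c ⊗ basis u i) ≡ c ⊗ restrict S w u
      column w = trans (dot-⊗ʳ c (restrict S w) (basis u)) (cong (c ⊗_) (dot-basisʳ (restrict S w) u))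
      vanishes : ∀ w → w ≢ v → restrict S w u ≡ 0#
      vanishes w w≢v with restrict S w u ≟ 0#
      ... | yes z = z
      ... | no nz with restrict-nonzero S nz
      ...   | Sw , _ , wu = ⊥-elim (false≢true (pendant-unique S pendant Sv uv w≢v Sw) (adj-symm G wu))
      solves : Solves v (restrict S) (λ i → c ⊗ basis u i)
      solves w = case w Fin.≟ v of λ where
        (yes refl) → trans (column w) (trans (cong (c ⊗_) (restrict-in S Sv (proj₁ pendant)))
          (trans (R.*-comm _ _) (trans (proj₂ (inverse (N v u) (unit v u (adj-symm G uv)))) (sym (basis-self v)))))
        (no w≢v) → trans (column w) (trans (cong (c ⊗_) (vanishes w w≢v)) (trans (R.zeroʳ c) (sym (basis-other w≢v))))

    rank-isolated : rank (remove S v) ≡ rank (remove (remove S v) u)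
    rank-isolated = kernel⇒rank-same (remove S v) u (basis u , kernel , 1≢0 ∘ trans (sym (basis-self u)))
      where
      kernel : InKernel (restrict (remove S v)) (basis u)
      kernel w = trans (dot-basisʳ (restrict (remove S v) w) u) (vanishes (restrict (remove S v) w u ≟ 0#))
        where
        vanishes : Dec (restrict (remove S v) w u ≡ 0#) → restrict (remove S v) w u ≡ 0#
        vanishes (yes z) = z
        vanishes (no nz) with restrict-nonzero (remove S v) nz
        ... | Sw , _ , wu with remove⁻ S Sw
        ...   | Sw′ , w≢v = ⊥-elim (false≢true (pendant-unique S pendant Sv uv w≢v Sw′) (adj-symm G wu))

    rank-pendant : rank S ≡ 2 + rank (remove (remove S u) v)
    rank-pendant = trans rank-pendant-neighbour (cong (2 +_) (trans rank-isolated (rank-≗ (remove-swap S v u))))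

  rank-no-edges : ∀ S → (∀ u v → In S u → In S v → ¬ Adj G u v) → rank S ≡ 0
  rank-no-edges S edgeless = rank-unique (rank-spec S) (rank-zero λ u v → vanishes u v)
    where
    vanishes : ∀ u v → restrict S u v ≡ 0#
    vanishes u v with restrict S u v ≟ 0#
    ... | yes z = z
    ... | no nz with restrict-nonzero S nz
    ...   | Su , Sv , uv = ⊥-elim (edgeless u v Su Sv uv)

  -- Chords are excluded as well, so `C` is an induced cycle that forms a whole component of the
  -- subgraph on `S`.
  Component : (Fin n → Bool) → Cycle G → Set
  Component S C = ∀ i {w} → In S w → Adj G (vert C i) w → CycleEdge C (vert C i) w

  module CycleComponent (S : Fin n → Bool) (C : Cycle G) (within : Within C S) (component : Component S C) where

    p : ℕ → Fin n
    p = around C zero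

    previous : ∀ t → around C (rot zero (suc t)) (2 + k C) ≡ p t
    previous t = cong (vert C) (trans (rot-next (rot zero t) (2 + k C)) (rot-full (rot zero t)))

    row-sum : ∀ ψ t → dot (restrict S (p (suc t))) ψ ≡
      N (p (suc t)) (p (2 + t)) ⊗ ψ (p (2 + t)) ⊕ N (p (suc t)) (p t) ⊗ ψ (p t)
    row-sum ψ t = trans (sum-at-two distinct others)
      (cong₂ _⊕_ (cong (_⊗ ψ (p (2 + t))) (restrict-in S (within _) (within _)))
                 (cong (_⊗ ψ (p t)) (restrict-in S (within _) (within _))))
      where
      distinct : p (2 + t) ≢ p t
      distinct eq with around-injective C (rot zero t) {2} {0} (s≤s (s≤s (s≤s z≤n))) (s≤s z≤n) eq
      ... | ()
      others : ∀ w → w ≢ p (2 + t) → w ≢ p t → restrict S (p (suc t)) w ⊗ ψ w ≡ 0#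
      others w w≢next w≢prev with restrict S (p (suc t)) w ≟ 0#
      ... | yes z = trans (cong (_⊗ ψ w) z) (R.zeroˡ _)
      ... | no nz with restrict-nonzero S nz
      ...   | _ , Sw , e with cycleEdge-neighbour C (rot zero (suc t)) (component (rot zero (suc t)) Sw e)
      ...     | inj₁ eq = ⊥-elim (w≢next eq)
      ...     | inj₂ eq = ⊥-elim (w≢prev (trans eq (previous t)))

    -- Only the values at positions below `len C` are used. That a sequence fits together where it
    -- wraps around has to be checked separately for each sequence.
    spread : (ℕ → Carrier) → Vect n
    spread r v with onCycle? C v
    ... | yes (i , _) = r (toℕ i)
    ... | no _ = 0#

    spread-around : ∀ r {t} → t < len C → spread r (p t) ≡ r t
    spread-around r {t} t<L with onCycle? C (p t)
    ... | yes (i , eq) = cong r (trans (cong toℕ (inj C eq))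
          (trans (toℕ-rot zero t) (ℕ.m<n⇒m%n≡m t<L)))
    ... | no off = ⊥-elim (off (rot zero t , refl))

    spread-full : ∀ r → spread r (p (len C)) ≡ r 0
    spread-full r = trans (cong (spread r) (around-full C zero)) (spread-around r (s≤s z≤n))

    spread-off : ∀ r v → ¬ OnCycle C v → spread r v ≡ 0#
    spread-off r v off with onCycle? C v
    ... | yes on = ⊥-elim (off on)
    ... | no _ = refl

    -- A row off the cycle meets no vertex of the cycle, because `C` is a component. The rows on the
    -- cycle are indexed by `suc t`, so that `row-sum` applies to each.
    rows : ∀ r (b : Vect n) → (∀ t → t < len C → dot (restrict S (p (suc t))) (spread r) ≡ b (p (suc t))) →
      (∀ w → ¬ OnCycle C w → b w ≡ 0#) → ∀ u → dot (restrict S u) (spread r) ≡ b u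
    rows r b on-rows off-zero u with onCycle? C u
    ... | yes (i , refl) with rot-surjective (next zero) i
    ...   | t , t<L , eq = subst (λ j → dot (restrict S (vert C j)) (spread r) ≡ b (vert C j))
            (trans (sym (rot-next zero t)) eq) (on-rows t t<L)
    rows r b on-rows off-zero u | no off = trans (sum-zero vanishes) (sym (off-zero u off))
      where
      vanishes : ∀ w → restrict S u w ⊗ spread r w ≡ 0#
      vanishes w with restrict S u w ≟ 0#
      ... | yes z = trans (cong (_⊗ spread r w) z) (R.zeroˡ _)
      ... | no nz with restrict-nonzero S nz
      ...   | Su , _ , uw = trans (cong (restrict S u w ⊗_) (spread-off r w w-off)) (R.zeroʳ _)
        where
        w-off : ¬ OnCycle C w
        w-off (j , refl) = off (cycleEdge-on C (cycleEdge-sym C (component j Su (adj-symm G uw))))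

-- The cyclomatic number under vertex deletion

module InducedSubgraphs {n} (G : Graph n) where

  induced : (Fin n → Bool) → Graph n
  induced S = record
    { adj = λ u v → (S u ∧ S v) ∧ adj G u v
    ; irrefl = λ u → trans (cong ((S u ∧ S u) ∧_) (irrefl G u)) (Bool.∧-zeroʳ _)
    ; adj-sym = λ u v → cong₂ _∧_ (Bool.∧-comm (S u) (S v)) (adj-sym G u v)
    }

  induced⁺ : ∀ S {u v} → In S u → In S v → Adj G u v → Adj (induced S) u v
  induced⁺ S Su Sv uv = ∧-true (∧-true Su Sv) uv

  induced⁻ : ∀ S {u v} → Adj (induced S) u v → In S u × In S v × Adj G u v
  induced⁻ S {u} {v} e = ∧-trueˡ {S u} (∧-trueˡ e) , ∧-trueʳ {S u} (∧-trueˡ e) , ∧-trueʳ {S u ∧ S v} e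

  abstract
    d : (Fin n → Bool) → ℕ
    d S = proj₁ (cyclomatic-exists (induced S))

    d-spec : ∀ S → Cyclomatic (induced S) (d S)
    d-spec S = proj₂ (cyclomatic-exists (induced S))

  d-mono : ∀ {S S′} → S′ ⊆ₛ S → d S′ ≤ d S
  d-mono {S} {S′} sub = cyclomatic-⊆ {G = induced S} {induced S′}
    (λ e → case induced⁻ S′ e of λ (Su , Sv , uv) → induced⁺ S (sub Su) (sub Sv) uv) (d-spec S) (d-spec S′)

  module _ (S : Fin n → Bool) (C : Cycle G) (within : Within C S) (i : Fin (len C)) {x} (x≡ : vert C i ≡ x) where

    around≢ : ∀ {t} → 1 ≤ t → t < len C → around C i t ≢ x
    around≢ 1≤t t<L eq = ℕ.<-irrefl (around-injective C i (s≤s z≤n) t<L (trans x≡ (sym eq))) 1≤t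

    -- The arc of the cycle that misses `x`. It is stated for every `K` retaining the edges off `x`,
    -- to allow one or two edges at `x` to be deleted.
    path-avoiding : (K : Graph n) → (∀ {u v} → Adj (induced S) u v → u ≢ x → v ≢ x → Adj K u v) →
      Reach K (around C i 1) (around C i (2 + k C))
    path-avoiding K kept = path (1 + k C) ℕ.≤-refl
      where
      path : ∀ t → suc t ≤ 2 + k C → Reach K (around C i 1) (around C i (suc t))
      path zero _ = ε
      path (suc t) t<L = path t (ℕ.≤-trans (ℕ.n≤1+n _) t<L) ◅◅
        (kept (induced⁺ S (within _) (within _) (around-adj C i (suc t)))
          (around≢ (s≤s z≤n) (ℕ.≤-trans (ℕ.≤-trans (ℕ.n≤1+n _) (s≤s t<L)) ℕ.≤-refl))
          (around≢ (s≤s z≤n) (s≤s t<L)) ◅ ε)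

    neighbour-adj : ∀ {y} → CycleEdge C x y → Adj (induced S) x y
    neighbour-adj {y} e with cycleEdge-on C (cycleEdge-sym C e)
    ... | j , refl = induced⁺ S (subst (In S) x≡ (within i)) (within j) (cycleEdge-adj C e)

    first-adj : Adj (induced S) x (around C i 1)
    first-adj = neighbour-adj (subst (λ z → CycleEdge C z (around C i 1)) x≡ (around-edge C i 0))

    last-adj : Adj (induced S) x (around C i (2 + k C))
    last-adj = neighbour-adj (subst (λ z → CycleEdge C z (around C i (2 + k C))) x≡ (last-edge C i))

  remove-avoids : ∀ S x y → induced (remove S x) ⊆ (induced S -edge x , y)
  remove-avoids S x y e with induced⁻ (remove S x) e
  ... | Su , Sv , uv = -edge⁺ (induced S) x y (induced⁺ S (proj₁ (remove⁻ S Su)) (proj₁ (remove⁻ S Sv)) uv)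
        λ { (inj₁ (u≡x , _)) → proj₂ (remove⁻ S Su) u≡x ; (inj₂ (_ , v≡x)) → proj₂ (remove⁻ S Sv) v≡x }

  off-kept : ∀ (K : Graph n) x y {u v} → Adj K u v → u ≢ x → v ≢ x → Adj (K -edge x , y) u v
  off-kept K x y uv u≢x v≢x = -edge⁺ K x y uv λ { (inj₁ (u≡x , _)) → u≢x u≡x ; (inj₂ (_ , v≡x)) → v≢x v≡x }

  -edge-end : ∀ (K : Graph n) x y {z} → Adj K x z → z ≢ y → Adj (K -edge x , y) x z
  -edge-end K x y xz z≢y = -edge⁺ K x y xz
    λ { (inj₁ (_ , z≡y)) → z≢y z≡y ; (inj₂ (_ , z≡x)) → adj⇒≢ K xz (sym z≡x) }

  module _ (S : Fin n → Bool) (C : Cycle G) (within : Within C S) (i : Fin (len C)) where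
    private
      x a b : Fin n
      x = vert C i
      a = around C i 1
      b = around C i (2 + k C)
      G₁ : Graph n
      G₁ = induced S -edge x , a
      xa : Adj (induced S) x a
      xa = first-adj S C within i refl
      xb : Adj (induced S) x b
      xb = last-adj S C within i refl
      joined : Reach G₁ x a
      joined = -edge-end (induced S) x a xb (last≢first C i) ◅
        reach-sym G₁ (path-avoiding S C within i refl G₁ (off-kept (induced S) x a))

    -- The edge from `x` to `a` is deleted first. It is no bridge, as `x` still reaches `a` through
    -- `b` and the rest of the cycle, so this alone costs one; deleting more edges never increases
    -- `d`.
    d-remove-cycle : suc (d (remove S x)) ≤ d S
    d-remove-cycle = cyclomatic-⊂ {G = induced S} {induced (remove S x)} xa (remove-avoids S x a)
      joined (d-spec S) (d-spec (remove S x))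

    -- At a vertex where two cycles part, both xa and xy can be deleted without disconnecting.
    d-remove-branch : (C′ : Cycle G) → Within C′ S → ∀ i′ → vert C′ i′ ≡ x → ∀ {y} → CycleEdge C′ x y →
      y ≢ a → y ≢ b → 2 + d (remove S x) ≤ d S
    d-remove-branch C′ within′ i′ x≡ {y} e y≢a y≢b with cyclomatic-exists G₁
    ... | m , cyc = ℕ.≤-trans
          (s≤s (cyclomatic-⊂ {G = G₁} {induced (remove S x)} (-edge-end (induced S) x a xy y≢a) sub joined′ cyc (d-spec (remove S x))))
          (cyclomatic-⊂ {G = induced S} {G₁} xa (λ z → z) joined (d-spec S) cyc)
      where
      G₂ : Graph n
      G₂ = G₁ -edge x , y
      xy : Adj (induced S) x y
      xy = neighbour-adj S C′ within′ i′ x≡ e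
      kept : ∀ {u v} → Adj (induced S) u v → u ≢ x → v ≢ x → Adj G₂ u v
      kept uv u≢x v≢x = off-kept G₁ x y (off-kept (induced S) x a uv u≢x v≢x) u≢x v≢x
      end-kept : ∀ {z} → Adj (induced S) x z → z ≢ a → z ≢ y → Adj G₂ x z
      end-kept xz z≢a z≢y = -edge-end G₁ x y (-edge-end (induced S) x a xz z≢a) z≢y
      sub : induced (remove S x) ⊆ G₂
      sub f with induced⁻ (remove S x) f
      ... | Su , Sv , uv = kept (induced⁺ S (proj₁ (remove⁻ S Su)) (proj₁ (remove⁻ S Sv)) uv)
            (proj₂ (remove⁻ S Su)) (proj₂ (remove⁻ S Sv))
      back : Reach G₂ b a
      back = reach-sym G₂ (path-avoiding S C within i refl G₂ kept)
      -- `z` is the neighbour of `x` on `C′` other than `y`, so the rest of `C′` leads from `z` to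
      -- `y`. If the edge to `z` is the deleted one to `a`, the detour through `b` along `C`
      -- replaces it; this needs `y` to differ from `b`.
      via : ∀ {z} → z ≢ y → Adj (induced S) x z → Reach G₂ z y → Reach G₂ x y
      via {z} z≢y xz zy with z Fin.≟ a
      ... | no z≢a = end-kept xz z≢a z≢y ◅ zy
      ... | yes refl = end-kept xb (last≢first C i) (y≢b ∘ sym) ◅ (back ◅◅ zy)
      path′ : Reach G₂ (around C′ i′ 1) (around C′ i′ (2 + k C′))
      path′ = path-avoiding S C′ within′ i′ x≡ G₂ kept
      joined′ : Reach G₂ x y
      joined′ with cycleEdge-neighbour C′ i′ (subst (λ z → CycleEdge C′ z y) (sym x≡) e)
      ... | inj₁ refl = via (last≢first C′ i′) (last-adj S C′ within′ i′ x≡) (reach-sym G₂ path′)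
      ... | inj₂ refl = via (last≢first C′ i′ ∘ sym) (first-adj S C′ within′ i′ x≡) path′

-- Non-backtracking walks

-- `Phase` is an invariant of the directed edge last traversed, which `turn` has to renew together
-- with the choice of the next vertex.
module Walk {n} (G : Graph n) (S : Fin n → Bool) (Phase : Fin n → Fin n → Set)
  (turn : ∀ {a b} → In S a → In S b → Adj G a b → Phase a b → ∃[ c ] c ≢ a × In S c × Adj G b c × Phase b c) where

  record State : Set where
    field
      tail head : Fin n
      tail-in : In S tail
      head-in : In S head
      edge : Adj G tail head
      phase : Phase tail head
  open State public

  advance : State → State
  advance s = let c , _ , c-in , bc , ph = turn (tail-in s) (head-in s) (edge s) (phase s) in record
    { tail = head s ; head = c ; tail-in = head-in s ; head-in = c-in ; edge = bc ; phase = ph }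

  run : State → ℕ → State
  run s zero = s
  run s (suc t) = advance (run s t)

  trace : State → ℕ → Fin n
  trace s t = tail (run s t)

  trace-adj : ∀ s t → Adj G (trace s t) (trace s (suc t))
  trace-adj s t = edge (run s t)

  trace-forward : ∀ s t → trace s (suc (suc t)) ≢ trace s t
  trace-forward s t = proj₁ (proj₂ (turn (tail-in r) (head-in r) (edge r) (phase r)))
    where
    r : State
    r = run s t

onward : ∀ {n} (G : Graph n) {S} → NoPendant G S → ∀ {a b} → In S a → In S b → Adj G a b →
  ∃[ c ] c ≢ a × In S c × Adj G b c
onward G {S} noPendant {a} {b} Sa Sb ab
  with count≢1⇒another (λ w → S w ∧ adj G b w) {a} (∧-true Sa (adj-symm G ab)) (λ deg → noPendant b (Sb , deg))
... | c , c≢a , Sc∧bc = c , c≢a , ∧-trueˡ Sc∧bc , ∧-trueʳ {S c} Sc∧bc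

module PlainWalk {n} (G : Graph n) (S : Fin n → Bool) (noPendant : NoPendant G S) where
  NoPhase : Fin n → Fin n → Set
  NoPhase _ _ = ⊤

  turn : ∀ {a b} → In S a → In S b → Adj G a b → NoPhase a b → ∃[ c ] c ≢ a × In S c × Adj G b c × NoPhase b c
  turn Sa Sb ab _ with onward G {S} noPendant Sa Sb ab
  ... | c , c≢a , Sc , bc = c , c≢a , Sc , bc , tt

  open Walk G S NoPhase turn public

  module _ {a b} (Sa : In S a) (Sb : In S b) (ab : Adj G a b) where
    start-state : State
    start-state = record { tail = a ; head = b ; tail-in = Sa ; head-in = Sb ; edge = ab ; phase = tt }

    repetition-from : FirstRepetition (trace start-state)
    repetition-from = first-repetition G (trace start-state) (trace-adj start-state) (trace-forward start-state)

    cycle-from : Cycle G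
    cycle-from = cycleOf G (trace start-state) (trace-adj start-state) repetition-from

    cycle-from-within : Within cycle-from S
    cycle-from-within i = tail-in (run start-state (FirstRepetition.start repetition-from + toℕ i))

pendant? : ∀ {n} (G : Graph n) S → Dec (∃[ u ] Pendant G S u)
pendant? G S = Fin.any? (λ u → (S u Bool.≟ true) ×-dec (degIn G S u ℕ.≟ 1))

pendant-neighbour : ∀ {n} (G : Graph n) S {u} → Pendant G S u → ∃[ v ] In S v × Adj G u v
pendant-neighbour G S {u} (_ , deg)
  with count-witness (λ w → S w ∧ adj G u w) (λ c≡0 → case trans (sym deg) c≡0 of λ ())
... | v , e = v , ∧-trueˡ e , ∧-trueʳ {S v} e

edge? : ∀ {n} (G : Graph n) S → Dec (∃[ u ] ∃[ v ] In S u × In S v × Adj G u v)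
edge? G S = Fin.any? (λ u → Fin.any? (λ v → (S u Bool.≟ true) ×-dec ((S v Bool.≟ true) ×-dec (adj G u v Bool.≟ true))))

count-remove-≤ : ∀ {n} (S : Fin n → Bool) {x m} → In S x → count S ≤ suc m → count (remove S x) ≤ m
count-remove-≤ S {x} Sx le = ℕ.s≤s⁻¹ (ℕ.≤-trans (ℕ.≤-reflexive (sym (count-remove S x Sx))) le)

count-zero : ∀ {n} (S : Fin n → Bool) {x} → In S x → ¬ (count S ≤ 0)
count-zero S {x} Sx le with trans (sym (ℕ.n≤0⇒n≡0 le)) (count-remove S x Sx)
... | ()

-- Extremal induced subgraphs

-- Here `a` stands for the rank of the adjacency matrix, `h` for that of the Hermitian one, and
-- primes mark the graph after deletion. The chain a ≤ 2 + a′ ≤ h′ + 2 (d′ + 1) ≤ h + 2 d = a closes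
-- up, so each of its inequalities is an equality.
squeeze : ∀ {a a′ h h′ d d′} → a ≤ 2 + a′ → a′ ≤ h′ + 2 * d′ → h′ ≤ h → suc d′ ≤ d → h + 2 * d ≡ a →
  a ≡ 2 + a′ × h′ + 2 * d′ ≡ a′ × h ≡ h′ × d ≡ suc d′
squeeze {a} {a′} {h} {h′} {d} {d′} a≤ a′≤ h′≤h d′<d eq =
  ℕ.≤-antisym a≤ (ℕ.≤-trans (ℕ.+-monoʳ-≤ 2 a′≤) (ℕ.≤-trans back (ℕ.≤-reflexive eq))) ,
  ℕ.≤-antisym (ℕ.+-cancelˡ-≤ 2 _ _ (ℕ.≤-trans back (ℕ.≤-trans (ℕ.≤-reflexive eq) a≤))) a′≤ ,
  ℕ.≤-antisym (ℕ.+-cancelʳ-≤ (2 * suc d′) h h′ (ℕ.≤-trans lower (ℕ.≤-trans up (ℕ.≤-reflexive shift)))) h′≤h ,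
  ℕ.≤-antisym (ℕ.*-cancelˡ-≤ 2 (ℕ.+-cancelˡ-≤ h _ _ (ℕ.≤-trans up
    (ℕ.≤-trans (ℕ.≤-reflexive shift) (ℕ.+-monoˡ-≤ (2 * suc d′) h′≤h))))) d′<d
  where
  shift : 2 + (h′ + 2 * d′) ≡ h′ + 2 * suc d′
  shift = trans (sym (ℕ.+-assoc 2 h′ (2 * d′))) (trans (cong (_+ 2 * d′) (ℕ.+-comm 2 h′))
    (trans (ℕ.+-assoc h′ 2 (2 * d′)) (cong (h′ +_) (sym (ℕ.*-suc 2 d′)))))
  lower : h + 2 * suc d′ ≤ h + 2 * d
  lower = ℕ.+-monoʳ-≤ h (ℕ.*-monoʳ-≤ 2 d′<d)
  up : h + 2 * d ≤ 2 + (h′ + 2 * d′)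
  up = ℕ.≤-trans (ℕ.≤-reflexive eq) (ℕ.≤-trans a≤ (ℕ.+-monoʳ-≤ 2 a′≤))
  back : 2 + (h′ + 2 * d′) ≤ h + 2 * d
  back = ℕ.≤-trans (ℕ.≤-reflexive shift) (ℕ.≤-trans (ℕ.+-monoˡ-≤ (2 * suc d′) h′≤h) lower)

module MixedGraphRank {n} (M : MixedGraph n) where

  G : Graph n
  G = underlying M

  isEdge-false : ∀ {e} → isEdge e ≡ false → e ≡ none
  isEdge-false {none} _ = refl

  H-hermitian : VertexDeletion.Hermitian ℚi-field (H M)
  H-hermitian u v = trans (conj-entry (ent M u v)) (cong hermEntry (sym (consistent M u v)))
    where
    conj-entry : ∀ e → Gaussian.conjugate (hermEntry e) ≡ hermEntry (flipE e)
    conj-entry none = refl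
    conj-entry undir = refl
    conj-entry arc = refl
    conj-entry rev = refl

  H-unit : ∀ u v → Adj G u v → H M u v ≢ 0ℚ +i 0ℚ
  H-unit u v uv = nonzero (ent M u v) uv
    where
    nonzero : ∀ e → isEdge e ≡ true → hermEntry e ≢ 0ℚ +i 0ℚ
    nonzero undir _ ()
    nonzero arc _ ()
    nonzero rev _ ()

  module RA = Restriction ℚ-field G (A G) (λ u v → cong (if_then 1ℚ else 0ℚ) (adj-sym G u v))
    (λ u v uv → cong (if_then 1ℚ else 0ℚ) uv)
    (λ u v uv eq → case trans (sym (cong (if_then 1ℚ else 0ℚ) uv)) eq of λ ())
  module RH = Restriction ℚi-field G (H M) H-hermitian (λ u v uv → cong hermEntry (isEdge-false uv)) H-unit
  open InducedSubgraphs G public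

  -- The constructive form of the statement about forests. Deleting a pendant pair lowers both ranks
  -- by two; without pendant vertices, either an edge starts a walk that closes a cycle, or both
  -- matrices are zero.
  cycle⊎rank≡ : ∀ m S → count S ≤ m → (∃[ C ] Within {G = G} C S) ⊎ RH.rank S ≡ RA.rank S
  cycle⊎rank≡ m S le with pendant? G S | edge? G S
  ... | no noPendant | yes (u , v , Su , Sv , uv) =
        inj₁ (cycle-from Su Sv uv , cycle-from-within Su Sv uv)
        where open PlainWalk G S (λ u p → noPendant (u , p))
  ... | no _ | no noEdge = inj₂ (trans (RH.rank-no-edges S edgeless) (sym (RA.rank-no-edges S edgeless)))
        where
        edgeless : ∀ u v → In S u → In S v → ¬ Adj G u v
        edgeless u v Su Sv uv = noEdge (u , v , Su , Sv , uv)
  cycle⊎rank≡ zero S le | yes (u , Su , _) | _ = ⊥-elim (count-zero S Su le)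
  cycle⊎rank≡ (suc m) S le | yes (u , p) | _ with pendant-neighbour G S p
  ... | v , Sv , uv with cycle⊎rank≡ m (remove (remove S u) v)
                          (count-remove-≤ (remove S u) (remove⁺ S Sv (adj⇒≢ G uv ∘ sym))
                            (ℕ.≤-trans (count-remove-≤ S (proj₁ p) le) (ℕ.n≤1+n m)))
  ...   | inj₁ (C , within) = inj₁ (C , λ i → remove-⊆ₛ S u (remove-⊆ₛ (remove S u) v (within i)))
  ...   | inj₂ eq = inj₂ (trans (RH.rank-pendant S p Sv uv) (trans (cong (2 +_) eq) (sym (RA.rank-pendant S p Sv uv))))

  rank-inequality′ : ∀ m S → count S ≤ m → RA.rank S ≤ RH.rank S + 2 * d S
  rank-inequality′ m S le with cycle⊎rank≡ m S le
  ... | inj₂ eq = ℕ.≤-trans (ℕ.≤-reflexive (sym eq)) (ℕ.m≤m+n _ _)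
  rank-inequality′ zero S le | inj₁ (C , within) = ⊥-elim (count-zero S (within zero) le)
  rank-inequality′ (suc m) S le | inj₁ (C , within) = begin
    RA.rank S ≤⟨ RA.rank-remove-≥ S x ⟩
    2 + RA.rank S′ ≤⟨ ℕ.+-monoʳ-≤ 2 (rank-inequality′ m S′ (count-remove-≤ S (within zero) le)) ⟩
    2 + (RH.rank S′ + 2 * d S′) ≡⟨ trans (cong (2 +_) (ℕ.+-comm (RH.rank S′) _)) (trans (sym (ℕ.+-assoc 2 (2 * d S′) (RH.rank S′)))
        (trans (cong (_+ RH.rank S′) (sym (ℕ.*-suc 2 (d S′)))) (ℕ.+-comm _ (RH.rank S′)))) ⟩
    RH.rank S′ + 2 * suc (d S′) ≤⟨ ℕ.+-mono-≤ (RH.rank-remove-≤ S x) (ℕ.*-monoʳ-≤ 2 (d-remove-cycle S C within zero)) ⟩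
    RH.rank S + 2 * d S ∎
    where
    open ℕ.≤-Reasoning
    x : Fin n
    x = vert C zero
    S′ : Fin n → Bool
    S′ = remove S x

  rank-inequality : ∀ S → RA.rank S ≤ RH.rank S + 2 * d S
  rank-inequality S = rank-inequality′ (count S) S ℕ.≤-refl

  Extremal : (Fin n → Bool) → Set
  Extremal S = RH.rank S + 2 * d S ≡ RA.rank S

  module _ (S : Fin n → Bool) (extremal : Extremal S) where

    module _ (C : Cycle G) (within : Within C S) (i : Fin (len C)) where
      private
        x : Fin n
        x = vert C i
        all : RA.rank S ≡ 2 + RA.rank (remove S x) × Extremal (remove S x) ×
              RH.rank S ≡ RH.rank (remove S x) × d S ≡ suc (d (remove S x))
        all = squeeze (RA.rank-remove-≥ S x) (rank-inequality (remove S x)) (RH.rank-remove-≤ S x)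
          (d-remove-cycle S C within i) extremal

      abstract
        extremal-remove : Extremal (remove S x)
        extremal-remove = proj₁ (proj₂ all)

        extremal-d : d S ≡ suc (d (remove S x))
        extremal-d = proj₂ (proj₂ (proj₂ all))

        extremal-solves : ∃[ φ ] VertexDeletion.Solves ℚ-field x (RA.restrict S) φ × φ x ≡ 0ℚ
        extremal-solves = RA.rank-drops⇒solves S x (proj₁ all)

        extremal-kernel : VertexDeletion.KernelAt ℚi-field x (RH.restrict S)
        extremal-kernel = RH.rank-same⇒kernel S x (proj₁ (proj₂ (proj₂ all)))

        extremal-rankH : RH.rank S ≡ RH.rank (remove S x)
        extremal-rankH = proj₁ (proj₂ (proj₂ all))

    extremal-local : (C C′ : Cycle G) → Within C S → Within C′ S →
      ∀ {x y} → OnCycle C x → CycleEdge C′ x y → CycleEdge C x y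
    extremal-local C C′ within within′ {x} {y} (i , refl) e
      with y Fin.≟ around C i 1 | y Fin.≟ around C i (2 + k C)
    ... | yes refl | _ = around-edge C i 0
    ... | no _ | yes refl = last-edge C i
    ... | no y≢a | no y≢b with cycleEdge-on C′ e
    ...   | i′ , eq = ⊥-elim (ℕ.1+n≰n (ℕ.≤-trans (d-remove-branch S C within i C′ within′ i′ eq e y≢a y≢b)
            (ℕ.≤-reflexive (extremal-d C within i))))

    extremal-disjoint : (C C′ : Cycle G) → Within C S → Within C′ S →
      (∃[ v ] OnCycle C v × OnCycle C′ v) → SameCycle C C′
    extremal-disjoint C C′ within within′ (v , on , on′) u w = mk⇔
      (sameCycle-⊆ C′ C (extremal-local C′ C within′ within) (v , on′ , on))
      (sameCycle-⊆ C C′ (extremal-local C C′ within within′) (v , on , on′))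

    module _ {u v} (p : Pendant G S u) (Sv : In S v) (uv : Adj G u v) where

      cycles-avoid-pendant : (C : Cycle G) → Within C S → ∀ i → vert C i ≢ u × vert C i ≢ v
      cycles-avoid-pendant C within i = avoids-u , avoids-v
        where
        avoids-u : vert C i ≢ u
        avoids-u refl = two⇒count≢1 (λ w → S w ∧ adj G u w) (last≢first C i)
          (∧-true (within _) (cycleEdge-adj C (last-edge C i))) (∧-true (within _) (around-adj C i 0)) (proj₂ p)
        avoids-v : vert C i ≢ v
        avoids-v refl = ℕ.m≢1+n+m (RH.rank (remove S v)) {1}
          (trans (sym (extremal-rankH C within i)) (RH.rank-pendant-neighbour S p Sv uv))

      -- Both ranks drop by two and `d` does not grow, which is one inequality; the other one is
      -- `rank-inequality`. The change of `d` need not be computed.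
      extremal-pendant : Extremal (remove (remove S u) v)
      extremal-pendant = ℕ.≤-antisym
        (ℕ.+-cancelˡ-≤ 2 _ _ (begin
          2 + (RH.rank S′ + 2 * d S′) ≤⟨ ℕ.+-monoʳ-≤ 2 (ℕ.+-monoʳ-≤ (RH.rank S′) (ℕ.*-monoʳ-≤ 2 (d-mono {S} {S′} sub))) ⟩
          2 + (RH.rank S′ + 2 * d S) ≡⟨ cong (_+ 2 * d S) (sym (RH.rank-pendant S p Sv uv)) ⟩
          RH.rank S + 2 * d S ≡⟨ extremal ⟩
          RA.rank S ≡⟨ RA.rank-pendant S p Sv uv ⟩
          2 + RA.rank S′ ∎))
        (rank-inequality S′)
        where
        open ℕ.≤-Reasoning
        S′ : Fin n → Bool
        S′ = remove (remove S u) v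
        sub : S′ ⊆ₛ S
        sub = λ e → remove-⊆ₛ S u (remove-⊆ₛ (remove S u) v e)

-- Extremal induced subgraphs without pendant vertices

module NoPendantExtremal {n} (M : MixedGraph n) (S : Fin n → Bool)
  (extremal : MixedGraphRank.Extremal M S) (noPendant : NoPendant (underlying M) S) where
  open MixedGraphRank M
  open Vectors ℚ-field using (Vect; sum-at; sum-zero; basis-self; basis-other; ⊗-zero-product; 1≢0)
  open VertexDeletion ℚ-field using (Solves; InKernel; solves⇒kernel-vanishes; deleted-dot; IsDeletion)

  local : (C C′ : Cycle G) → Within C S → Within C′ S → ∀ {x y} → OnCycle C x → CycleEdge C′ x y → CycleEdge C x y
  local = extremal-local S extremal

  module _ {x : Fin n} (Sx : In S x) {φ : Vect n} (solves : Solves x (RA.restrict S) φ) (φx≡0 : φ x ≡ 0ℚ) where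

    -- After the deletion of `x` the cycle `C` is still present and the subgraph still extremal, so
    -- e_c lies in the image of the smaller matrix for every `c` on `C`. Since `φ x` is zero, `φ` is
    -- in the kernel of that matrix and hence vanishes at `c`.
    solution-vanishes : (C : Cycle G) → Within C S → (∀ j → vert C j ≢ x) → Extremal (remove S x) → ∀ i → φ (vert C i) ≡ 0ℚ
    solution-vanishes C within avoids extremal′ i =
      solves⇒kernel-vanishes (RA.restrict-hermitian (remove S x)) {vert C i} {χ} χ-solves {φ} kernel
      where
      within′ : Within C (remove S x)
      within′ j = remove⁺ S (within j) (avoids j)
      χ : Vect n
      χ = proj₁ (extremal-solves (remove S x) extremal′ C within′ i)
      χ-solves : Solves (vert C i) (RA.restrict (remove S x)) χ
      χ-solves = proj₁ (proj₂ (extremal-solves (remove S x) extremal′ C within′ i))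
      kernel : InKernel (RA.restrict (remove S x)) φ
      kernel u = case u Fin.≟ x of λ where
        (yes refl) → sum-zero (λ v → trans (cong (Q._* φ v) (IsDeletion.row (RA.restrict-deletion S x) v)) (Q.*-zeroˡ (φ v)))
        (no u≢x) → trans (deleted-dot (RA.restrict-deletion S x) u u≢x φ φx≡0)
          (trans (solves u) (basis-other u≢x))

    -- The two nonzero phases alternate, as every other vertex carries a nonzero value. `free` is
    -- entered only after passing through `x`, where the equation is no longer homogeneous; it keeps
    -- the walk total.
    data Phase (a b : Fin n) : Set where
      toNonzero : φ b ≢ 0ℚ → Phase a b
      fromNonzero : φ a ≢ 0ℚ → Phase a b
      free : Phase a b

    -- Row `b` of the equation sums to zero, so the nonzero term of `a` must be compensated by
    -- another neighbour of `b`.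
    balance : ∀ {a b} → b ≢ x → In S a → In S b → Adj G a b → φ a ≢ 0ℚ →
      ∃[ c ] c ≢ a × In S c × Adj G b c × φ c ≢ 0ℚ
    balance {a} {b} b≢x Sa Sb ab φa≢0
      with Fin.any? (λ c → ¬? (c Fin.≟ a) ×-dec ¬? ((RA.restrict S b c Q.* φ c) Q.≟ 0ℚ))
    ... | yes (c , c≢a , nz) = c , c≢a , proj₁ (proj₂ nbr) , proj₂ (proj₂ nbr) ,
          λ φc≡0 → nz (trans (cong (RA.restrict S b c Q.*_) φc≡0) (Q.*-zeroʳ (RA.restrict S b c)))
      where
      nbr : In S b × In S c × Adj G b c
      nbr = RA.restrict-nonzero S {b} {c} (λ z → nz (trans (cong (Q._* φ c) z) (Q.*-zeroˡ (φ c))))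
    ... | no others = ⊥-elim (φa≢0 (⊗-zero-product {RA.restrict S b a} {φ a} entry≢0
          (trans (sym (sum-at a (λ c c≢a → zero-term c c≢a))) (trans (solves b) (basis-other b≢x)))))
      where
      zero-term : ∀ c → c ≢ a → RA.restrict S b c Q.* φ c ≡ 0ℚ
      zero-term c c≢a with (RA.restrict S b c Q.* φ c) Q.≟ 0ℚ
      ... | yes z = z
      ... | no nz = ⊥-elim (others (c , c≢a , nz))
      entry≢0 : RA.restrict S b a ≢ 0ℚ
      entry≢0 z = 1≢0 (trans (sym (trans (RA.restrict-in S Sb Sa) (cong (if_then 1ℚ else 0ℚ) (adj-symm G ab)))) z)

    turn : ∀ {a b} → In S a → In S b → Adj G a b → Phase a b →
      ∃[ c ] c ≢ a × In S c × Adj G b c × Phase b c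
    turn {a} {b} Sa Sb ab ph with onward G {S} noPendant Sa Sb ab
    turn {a} {b} Sa Sb ab (toNonzero nz) | c , c≢a , Sc , bc = c , c≢a , Sc , bc , fromNonzero nz
    turn {a} {b} Sa Sb ab free | c , c≢a , Sc , bc = c , c≢a , Sc , bc , free
    turn {a} {b} Sa Sb ab (fromNonzero nz) | c , c≢a , Sc , bc with b Fin.≟ x
    ... | yes _ = c , c≢a , Sc , bc , free
    ... | no b≢x with balance b≢x Sa Sb ab nz
    ...   | c′ , c′≢a , Sc′ , bc′ , nz′ = c′ , c′≢a , Sc′ , bc′ , toNonzero nz′

    open Walk G S Phase turn

    IsFree : ∀ {a b} → Phase a b → Set
    IsFree free = ⊤
    IsFree _ = ⊥

    turn-free : ∀ {a b} Sa Sb ab (ph : Phase a b) → b ≢ x → ¬ IsFree ph →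
      ¬ IsFree (proj₂ (proj₂ (proj₂ (proj₂ (turn Sa Sb ab ph)))))
    turn-free {a} {b} Sa Sb ab ph b≢x notFree with onward G {S} noPendant Sa Sb ab
    turn-free Sa Sb ab (toNonzero nz) b≢x notFree | _ = λ ()
    turn-free Sa Sb ab free b≢x notFree | _ = ⊥-elim (notFree tt)
    turn-free {a} {b} Sa Sb ab (fromNonzero nz) b≢x notFree | _ with b Fin.≟ x
    ... | yes b≡x = ⊥-elim (b≢x b≡x)
    ... | no b≢x′ with balance b≢x′ Sa Sb ab nz
    ...   | _ = λ ()

    record Return (p u : Fin n) : Set where
      field
        C : Cycle G
        within : Within C S
        at-x : vert C zero ≡ x
        first : around C zero 1 ≡ p
        second : around C zero 2 ≡ u
        last-nonzero : φ (around C zero (2 + k C)) ≢ 0ℚ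

    abstract
      -- Along the walk every other vertex has a nonzero value, until x is reached again.
      -- A cycle closed before that would avoid x, where the solution vanishes.
      return : Extremal (remove S x) → ∀ {p u} → In S p → In S u → Adj G x p → Adj G p u → u ≢ x → φ p ≢ 0ℚ → Return p u
      return extremal′ {p} {u} Sp Su xp pu u≢x φp≢0 = conclude (first-repetition G f f-adj f-forward)
        where
        s₁ : State
        s₁ = record { tail = p ; head = u ; tail-in = Sp ; head-in = Su ; edge = pu ; phase = fromNonzero φp≢0 }
        f : ℕ → Fin n
        f zero = x
        f (suc t) = trace s₁ t
        f-adj : ∀ t → Adj G (f t) (f (suc t))
        f-adj zero = xp
        f-adj (suc t) = trace-adj s₁ t
        f-forward : ∀ t → f (suc (suc t)) ≢ f t
        f-forward zero = u≢x
        f-forward (suc t) = trace-forward s₁ t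
        f-in : ∀ t → In S (f t)
        f-in zero = Sx
        f-in (suc t) = tail-in (run s₁ t)
        notFree : ∀ t → (∀ r → r < t → head (run s₁ r) ≢ x) → ¬ IsFree (phase (run s₁ t))
        notFree zero _ ()
        notFree (suc t) h = turn-free (tail-in r) (head-in r) (edge r) (phase r) (h t ℕ.≤-refl)
          (notFree t (λ r r<t → h r (ℕ.≤-trans r<t (ℕ.n≤1+n t))))
          where
          r : State
          r = run s₁ t
        conclude : FirstRepetition f → Return p u
        conclude rep = byStart (FirstRepetition.start rep) refl
          where
          open FirstRepetition rep
          C : Cycle G
          C = cycleOf G f f-adj rep
          -- `head (run s₁ r)` is `f (2 + r)`, which before the first repetition differs from `f 0`,
          -- that is, from `x`. Hence the free phase has not been entered.
          phase-at : ∀ t → 1 + t < start + (3 + rest) → ¬ IsFree (phase (run s₁ t))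
          phase-at t t< = notFree t (λ r r<t eq → case distinct {suc (suc r)} {0}
            (ℕ.≤-trans (s≤s (s≤s r<t)) t<) (ℕ.≤-trans (s≤s z≤n) t<) eq of λ ())
          byStart : ∀ s → start ≡ s → Return p u
          byStart zero refl = record
            { C = C ; within = λ i → f-in (start + toℕ i) ; at-x = refl ; first = refl ; second = refl
            ; last-nonzero = subst (λ j → φ (f j) ≢ 0ℚ) (sym position) (nonzero (phase (run s₁ (1 + rest))) (phase-at (1 + rest) ℕ.≤-refl)) }
            where
            position : toℕ (rot {2 + rest} zero (2 + rest)) ≡ 2 + rest
            position = trans (toℕ-rot {2 + rest} zero (2 + rest)) (ℕ.m<n⇒m%n≡m ℕ.≤-refl)
            -- The last edge ends at `x`, where `φ` vanishes, so the nonzero value promised by its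
            -- phase sits at its tail.
            nonzero : (ph : Phase (f (2 + rest)) (f (3 + rest))) → ¬ IsFree ph → φ (f (2 + rest)) ≢ 0ℚ
            nonzero (fromNonzero nz) _ = nz
            nonzero (toNonzero nz) _ = ⊥-elim (nz (trans (cong φ closes) φx≡0))
            nonzero free notFree′ = ⊥-elim (notFree′ tt)
          byStart (suc s) refl = ⊥-elim (contradictory (phase (run s₁ s)) (phase-at s (s≤s (ℕ.m<m+n s (s≤s z≤n)))))
            where
            vanish : ∀ i → φ (vert C i) ≡ 0ℚ
            vanish = solution-vanishes C (λ i → f-in (start + toℕ i)) avoids extremal′
              where
              avoids : ∀ j → vert C j ≢ x
              avoids j eq with distinct {start + toℕ j} {0} (ℕ.+-monoʳ-< start (Fin.toℕ<n j)) (s≤s z≤n) eq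
              ... | ()
            contradictory : (ph : Phase (f (1 + s)) (f (2 + s))) → ¬ IsFree ph → ⊥
            contradictory (fromNonzero nz) _ = nz (trans (cong (φ ∘ f) (sym (ℕ.+-identityʳ (suc s)))) (vanish zero))
            contradictory (toNonzero nz) _ = nz (trans (cong (φ ∘ f ∘ suc) (ℕ.+-comm 1 s)) (vanish (suc zero)))
            contradictory free notFree′ = notFree′ tt

  component : (C : Cycle G) → Within C S → RA.Component S C
  component C within i {u} Su pu = byCase (u Fin.≟ x)
    where
    p x : Fin n
    p = vert C i
    x = vert C (next i)
    Sx : In S x
    Sx = within (next i)
    φ : Vect n
    φ = proj₁ (extremal-solves S extremal C within (next i))
    solves : Solves x (RA.restrict S) φ
    solves = proj₁ (proj₂ (extremal-solves S extremal C within (next i)))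
    φx≡0 : φ x ≡ 0ℚ
    φx≡0 = proj₂ (proj₂ (extremal-solves S extremal C within (next i)))
    extremal′ : Extremal (remove S x)
    extremal′ = extremal-remove S extremal C within (next i)
    px : CycleEdge C p x
    px = around-edge C i 0
    -- Row `x` of the equation sums to one, so not all of its terms vanish. The neighbour found need
    -- not be `p`.
    start-neighbour : ∃[ y ] In S y × Adj G x y × φ y ≢ 0ℚ
    start-neighbour with Fin.any? (λ y → ¬? ((RA.restrict S x y Q.* φ y) Q.≟ 0ℚ))
    ... | yes (y , nz) = y , proj₁ (proj₂ nbr) , proj₂ (proj₂ nbr) ,
          λ φy≡0 → nz (trans (cong (RA.restrict S x y Q.*_) φy≡0) (Q.*-zeroʳ (RA.restrict S x y)))
      where
      nbr : In S x × In S y × Adj G x y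
      nbr = RA.restrict-nonzero S {x} {y} (λ z → nz (trans (cong (Q._* φ y) z) (Q.*-zeroˡ (φ y))))
    ... | no absent = ⊥-elim (1≢0 (trans (sym (trans (solves x) (basis-self x))) (sum-zero λ y → term y)))
      where
      term : ∀ y → RA.restrict S x y Q.* φ y ≡ 0ℚ
      term y with (RA.restrict S x y Q.* φ y) Q.≟ 0ℚ
      ... | yes z = z
      ... | no nz = ⊥-elim (absent (y , nz))
    -- The walk from the neighbour `y` returns to `x` along a cycle on which both neighbours of `x`
    -- carry nonzero values. This cycle shares the edges of `C` at `x`, so `p` is one of those two
    -- neighbours.
    φp≢0 : φ p ≢ 0ℚ
    φp≢0 with start-neighbour
    ... | y , Sy , xy , φy≢0 with onward G {S} noPendant Sx Sy xy
    ...   | z , z≢x , Sz , yz with return Sx solves φx≡0 extremal′ Sy Sz xy yz z≢x φy≢0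
    ...     | r with cycleEdge-neighbour (Return.C r) zero (subst (λ w → CycleEdge (Return.C r) w p) (sym (Return.at-x r))
                      (local (Return.C r) C (Return.within r) within {x} {p} (zero , Return.at-x r) (cycleEdge-sym C px)))
    ...       | inj₁ p≡first = subst (λ w → φ w ≢ 0ℚ) (sym (trans p≡first (Return.first r))) φy≢0
    ...       | inj₂ p≡last = subst (λ w → φ w ≢ 0ℚ) (sym p≡last) (Return.last-nonzero r)
    byCase : Dec (u ≡ x) → CycleEdge C p u
    byCase (yes refl) = px
    -- The cycle `D` begins with `x`, `p`, `u`. It meets `C` in `p`, so its edge from `p` to `u` is
    -- an edge of `C`.
    byCase (no u≢x) = local C D within (Return.within r) (i , refl)
      (subst₂ (CycleEdge D) (Return.first r) (Return.second r) (around-edge D zero 1))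
      where
      r : Return Sx solves φx≡0 p u
      r = return Sx solves φx≡0 extremal′ (within i) Su (adj-symm G (step C i)) pu u≢x φp≢0
      D : Cycle G
      D = Return.C r

  abstract
    -- A walk starting with the given edge closes a cycle. If vertices preceded it, the edge
    -- entering the cycle would belong to it, since the cycle is a component. The vertex before the
    -- entry would then be a cycle neighbour of the entry, which is either a step back or an earlier
    -- repetition.
    edge-on-cycle : ∀ {u v} → In S u → In S v → Adj G u v → ∃[ C ] Within {G = G} C S × CycleEdge C u v
    edge-on-cycle {u} {v} Su Sv uv = C , within , byStart (FirstRepetition.start rep) refl
      where
      open PlainWalk G S noPendant
      rep : FirstRepetition (trace (start-state Su Sv uv))
      rep = repetition-from Su Sv uv
      open FirstRepetition rep
      f : ℕ → Fin n
      f = trace (start-state Su Sv uv)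
      C : Cycle G
      C = cycle-from Su Sv uv
      within : Within C S
      within = cycle-from-within Su Sv uv
      byStart : ∀ s → start ≡ s → CycleEdge C u v
      byStart zero eq = zero , inj₁ (cong f (trans (ℕ.+-identityʳ start) eq) , cong f (trans (ℕ.+-comm start 1) (cong suc eq)))
      byStart (suc s) eq = ⊥-elim (impossible (cycleEdge-neighbour C zero
        (component C within zero (tail-in (run (start-state Su Sv uv) s))
          (adj-symm G (subst (λ e → Adj G (f s) (f e)) (sym (trans (ℕ.+-identityʳ start) eq)) (trace-adj (start-state Su Sv uv) s))))))
        where
        position : toℕ (rot {2 + rest} zero (2 + rest)) ≡ 2 + rest
        position = trans (toℕ-rot {2 + rest} zero (2 + rest)) (ℕ.m<n⇒m%n≡m ℕ.≤-refl)
        impossible : ¬ (f s ≡ around C zero 1 ⊎ f s ≡ around C zero (2 + rest))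
        impossible (inj₁ back) = trace-forward (start-state Su Sv uv) s
          (sym (trans back (cong f (trans (ℕ.+-comm start 1) (cong suc eq)))))
        impossible (inj₂ back) = ℕ.<⇒≢ s<last (distinct s<end (ℕ.+-monoʳ-< start ℕ.≤-refl)
          (trans back (cong (λ e → f (start + e)) position)))
          where
          s<last : s < start + (2 + rest)
          s<last = ℕ.≤-trans (ℕ.≤-reflexive (sym eq)) (ℕ.m≤m+n start (2 + rest))
          s<end : s < start + (3 + rest)
          s<end = ℕ.≤-trans (ℕ.≤-reflexive (sym eq)) (ℕ.m≤m+n start (3 + rest))

-- Parity along a cycle

half : ∀ m → ∃[ s ] (m ≡ s * 2 ⊎ m ≡ suc (s * 2))
half zero = 0 , inj₁ refl
half (suc m) with half m
... | s , inj₁ eq = s , inj₂ (cong suc eq)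
... | s , inj₂ eq = suc s , inj₁ (cong suc eq)

-- The shape exhibits `m` as an odd number of double steps, each of which contributes one change of
-- sign.
2mod4 : ∀ {m} → m % 4 ≡ 2 → ∃[ j ] m ≡ suc (j * 2) * 2
2mod4 {m} eq = m / 4 , trans (ℕ.m≡m%n+[m/n]*n m 4) (cong₂ _+_ eq (sym (ℕ.*-assoc (m / 4) 2 2)))

2mod4⁻ : ∀ j → (suc (j * 2) * 2) % 4 ≡ 2
2mod4⁻ j = trans (cong (λ e → (2 + e) % 4) (ℕ.*-assoc j 2 2)) (ℕ.[m+kn]%n≡m%n 2 j 4)

module Signs (F : FieldWithConj) where
  open Vectors F

  sign : ℕ → Carrier
  sign zero = 1#
  sign (suc s) = ⊖ sign s

  sign-even : ∀ j → sign (j * 2) ≡ 1#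
  sign-even zero = refl
  sign-even (suc j) = trans (RP.-‿involutive _) (sign-even j)

  sign-odd : ∀ j → sign (suc (j * 2)) ≡ ⊖ 1#
  sign-odd j = cong ⊖_ (sign-even j)

  sign-square : ∀ s → sign s ⊗ sign s ≡ 1#
  sign-square zero = R.*-identityˡ 1#
  sign-square (suc s) = trans (solve 1 (λ x → (:- x) :* (:- x) := x :* x) refl (sign s)) (sign-square s)

  sign-cancel : ∀ s {x} → sign s ⊗ x ≡ 0# → x ≡ 0#
  sign-cancel s {x} eq = ⊗-zero-product {sign s} (λ z → 1≢0 (trans (sym (sign-square s)) (trans (cong (_⊗ sign s) z) (R.zeroˡ _)))) eq

  opposite : ∀ {a b} → a ⊕ b ≡ 0# → a ≡ ⊖ b
  opposite {a} {b} eq = RP.x∙y⁻¹≈ε⇒x≈y a (⊖ b) (trans (cong (a ⊕_) (RP.-‿involutive b)) eq)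

module ImaginaryPowers where
  open Vectors ℚi-field
  open Signs ℚi-field

  i-unit : ℚi
  i-unit = 0ℚ +i 1ℚ

  iPow : ℕ → ℚi
  iPow zero = 1#
  iPow (suc m) = i-unit ⊗ iPow m

  iPow-+ : ∀ a b → iPow (a + b) ≡ iPow a ⊗ iPow b
  iPow-+ zero b = sym (R.*-identityˡ _)
  iPow-+ (suc a) b = trans (cong (i-unit ⊗_) (iPow-+ a b)) (sym (R.*-assoc i-unit (iPow a) (iPow b)))

  iPow-4* : ∀ q → iPow (q * 4) ≡ 1#
  iPow-4* zero = refl
  iPow-4* (suc q) = trans (iPow-+ 4 (q * 4)) (trans (cong (iPow 4 ⊗_) (iPow-4* q)) refl)

  iPow-% : ∀ m → iPow m ≡ iPow (m % 4)
  iPow-% m = trans (cong iPow (ℕ.m≡m%n+[m/n]*n m 4)) (trans (iPow-+ (m % 4) (m / 4 * 4))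
    (trans (cong (iPow (m % 4) ⊗_) (iPow-4* (m / 4))) (R.*-identityʳ _)))

  iPow≡-1⇒ : ∀ m → iPow m ≡ ⊖ 1# → m % 4 ≡ 2
  iPow≡-1⇒ m eq = residue (m % 4) (ℕ.m%n<n m 4) (trans (sym (iPow-% m)) eq)
    where
    residue : ∀ r → r < 4 → iPow r ≡ ⊖ 1# → r ≡ 2
    residue 0 _ ()
    residue 1 _ ()
    residue 2 _ _ = refl
    residue 3 _ ()
    residue (suc (suc (suc (suc r)))) (s≤s (s≤s (s≤s (s≤s ())))) _

  iPow≡-1⇐ : ∀ m → m % 4 ≡ 2 → iPow m ≡ ⊖ 1#
  iPow≡-1⇐ m eq = trans (iPow-% m) (cong iPow eq)

  -- A reverse arc has weight -i, the third power of i, so exponents stay natural numbers. The value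
  -- at `none` is arbitrary, as no edge of a cycle has this entry.
  exponent : Entry → ℕ
  exponent none = 0
  exponent undir = 0
  exponent arc = 1
  exponent rev = 3

  hermEntry-iPow : ∀ e → isEdge e ≡ true → hermEntry e ≡ iPow (exponent e)
  hermEntry-iPow undir _ = refl
  hermEntry-iPow arc _ = refl
  hermEntry-iPow rev _ = refl

  hermEntry-unit : ∀ e → isEdge e ≡ true → hermEntry e ⊗ conj (hermEntry e) ≡ 1#
  hermEntry-unit undir _ = refl
  hermEntry-unit arc _ = refl
  hermEntry-unit rev _ = refl

  total : ℕ → (ℕ → Entry) → ℕ
  total zero e = 0
  total (suc m) e = exponent (e 0) + total m (e ∘ suc)

  total-suc : ∀ m e → total (suc m) e ≡ total m e + exponent (e m)
  total-suc zero e = ℕ.+-comm (exponent (e 0)) 0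
  total-suc (suc m) e = trans (cong (exponent (e 0) +_) (total-suc m (e ∘ suc))) (sym (ℕ.+-assoc (exponent (e 0)) _ _))

  total-count : ∀ m e → total m e ≡ count {m} (λ i → isArc (e (toℕ i))) + 3 * count {m} (λ i → isRev (e (toℕ i)))
  total-count zero e = refl
  total-count (suc m) e = trans (cong (exponent (e 0) +_) (total-count m (e ∘ suc))) (absorb (e 0) _ _)
    where
    absorb : ∀ x f b → exponent x + (f + 3 * b) ≡
      (if isArc x then 1 else 0) + f + 3 * ((if isRev x then 1 else 0) + b)
    absorb none f b = refl
    absorb undir f b = refl
    absorb arc f b = refl
    absorb rev f b = trans (sym (ℕ.+-assoc 3 f (3 * b))) (trans (cong (_+ 3 * b) (ℕ.+-comm 3 f))
      (trans (ℕ.+-assoc f 3 (3 * b)) (cong (f +_) (sym (ℕ.*-suc 3 b)))))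

  triple-residue : ∀ δ → (3 * δ) % 4 ≡ 2 ⇔ δ % 4 ≡ 2
  triple-residue δ = mk⇔ (λ eq → to (δ % 4) (ℕ.m%n<n δ 4) (trans (sym reduce) eq)) (λ eq → trans reduce (cong (λ r → (3 * r) % 4) eq))
    where
    reduce : (3 * δ) % 4 ≡ (3 * (δ % 4)) % 4
    reduce = ℕ.%-distribˡ-* 3 δ 4
    to : ∀ r → r < 4 → (3 * r) % 4 ≡ 2 → r ≡ 2
    to 0 _ ()
    to 1 _ ()
    to 2 _ _ = refl
    to 3 _ ()
    to (suc (suc (suc (suc r)))) (s≤s (s≤s (s≤s (s≤s ())))) _

  -- Modulo 4, `f + 3 * b` is f - b, hence the distance up to sign. The residue 2 is its own
  -- negative, so the sign is irrelevant; `triple-residue` treats the case of the negative sign.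
  signature-residue : ∀ f b → (f + 3 * b) % 4 ≡ 2 ⇔ ∣ f - b ∣ % 4 ≡ 2
  signature-residue f b with ℕ.≤-total f b
  ... | inj₁ f≤b = mk⇔
        (λ eq → trans (cong (_% 4) dist) (Equivalence.to (triple-residue (b ∸ f)) (trans (sym shift) eq)))
        (λ eq → trans shift (Equivalence.from (triple-residue (b ∸ f)) (trans (sym (cong (_% 4) dist)) eq)))
    where
    dist : ∣ f - b ∣ ≡ b ∸ f
    dist = ℕ.m≤n⇒∣m-n∣≡n∸m f≤b
    shift : (f + 3 * b) % 4 ≡ (3 * (b ∸ f)) % 4
    shift = trans (cong (_% 4) (begin
      f + 3 * b ≡⟨ cong (λ e → f + 3 * e) (sym (ℕ.m∸n+n≡m f≤b)) ⟩
      f + 3 * (b ∸ f + f) ≡⟨ cong (f +_) (ℕ.*-distribˡ-+ 3 (b ∸ f) f) ⟩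
      f + (3 * (b ∸ f) + 3 * f) ≡⟨ ℕ.+-comm f _ ⟩
      3 * (b ∸ f) + 3 * f + f ≡⟨ ℕ.+-assoc (3 * (b ∸ f)) (3 * f) f ⟩
      3 * (b ∸ f) + (3 * f + f) ≡⟨ cong (3 * (b ∸ f) +_) (trans (ℕ.+-comm (3 * f) f) (ℕ.*-comm 4 f)) ⟩
      3 * (b ∸ f) + f * 4 ∎)) (ℕ.[m+kn]%n≡m%n (3 * (b ∸ f)) f 4)
      where open ≡-Reasoning
  ... | inj₂ b≤f = mk⇔ (λ eq → trans (cong (_% 4) dist) (trans (sym shift) eq)) (λ eq → trans shift (trans (sym (cong (_% 4) dist)) eq))
    where
    dist : ∣ f - b ∣ ≡ f ∸ b
    dist = trans (ℕ.∣-∣-comm f b) (ℕ.m≤n⇒∣m-n∣≡n∸m b≤f)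
    shift : (f + 3 * b) % 4 ≡ (f ∸ b) % 4
    shift = trans (cong (_% 4) (begin
      f + 3 * b ≡⟨ cong (_+ 3 * b) (sym (ℕ.m∸n+n≡m b≤f)) ⟩
      f ∸ b + b + 3 * b ≡⟨ ℕ.+-assoc (f ∸ b) b (3 * b) ⟩
      f ∸ b + 4 * b ≡⟨ cong (f ∸ b +_) (ℕ.*-comm 4 b) ⟩
      f ∸ b + b * 4 ∎)) (ℕ.[m+kn]%n≡m%n (f ∸ b) b 4)
      where open ≡-Reasoning

module CycleParity {n} (M : MixedGraph n) (S : Fin n → Bool) (C : Cycle (underlying M))
  (within : Within C S) (component : MixedGraphRank.RA.Component M S C) where
  open MixedGraphRank M
  module CA = RA.CycleComponent S C within component
  module CH = RH.CycleComponent S C within component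
  open CA using (p)

  L : ℕ
  L = len C

  p-full : p L ≡ p 0
  p-full = around-full C zero

  p-full′ : p (suc L) ≡ p 1
  p-full′ = cong (vert C ∘ next) (rot-full zero)

  interior≢ : ∀ {t} → suc t < L → p (suc t) ≢ p 0
  interior≢ t<L eq with around-injective C zero t<L (s≤s z≤n) eq
  ... | ()

  module Adjacency where
    open Vectors ℚ-field
    open VertexDeletion ℚ-field
    open Signs ℚ-field

    row : ∀ φ t → dot (RA.restrict S (p (suc t))) φ ≡ φ (p (2 + t)) ⊕ φ (p t)
    row φ t = trans (CA.row-sum φ t) (cong₂ _⊕_
      (trans (cong (_⊗ φ (p (2 + t))) (cong (if_then 1# else 0#) (around-adj C zero (suc t)))) (R.*-identityˡ (φ (p (2 + t)))))
      (trans (cong (_⊗ φ (p t)) (cong (if_then 1# else 0#) (adj-symm G (around-adj C zero t)))) (R.*-identityˡ (φ (p t)))))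

    -- Values two apart are opposite, so `q` is zero at even positions and plus or minus `q 1` at
    -- odd ones. The row at `p 0` requires `q 1` and `q (2 + k C)` to add up to one. For odd length
    -- both are zero, and for length divisible by four they are opposite.
    length-residue : ∀ {φ} → Solves (p 0) (RA.restrict S) φ → φ (p 0) ≡ 0# → L % 4 ≡ 2
    length-residue {φ} solves φ₀≡0 with half (2 + k C)
    ... | s , parity = byParity parity
      where
      q : ℕ → Carrier
      q t = φ (p t)
      alternate : ∀ t → suc t < L → q (2 + t) ≡ ⊖ q t
      alternate t t<L = opposite (trans (sym (row φ t)) (trans (solves (p (suc t))) (basis-other (interior≢ t<L))))
      closing : q 1 ⊕ q (2 + k C) ≡ 1#
      closing = trans (cong (_⊕ q (2 + k C)) (cong φ (sym p-full′))) (trans (sym (row φ (2 + k C)))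
        (trans (solves (p L)) (trans (cong (basis (p 0)) p-full) (basis-self (p 0)))))
      even : ∀ j → j * 2 ≤ L → q (j * 2) ≡ 0#
      even zero _ = φ₀≡0
      even (suc j) le = trans (alternate (j * 2) le)
        (trans (cong ⊖_ (even j (ℕ.≤-trans (ℕ.≤-trans (ℕ.n≤1+n _) (ℕ.n≤1+n _)) le))) RP.-0#≈0#)
      odd : ∀ j → suc (j * 2) ≤ L → q (suc (j * 2)) ≡ sign j ⊗ q 1
      odd zero _ = sym (R.*-identityˡ _)
      odd (suc j) le = trans (alternate (suc (j * 2)) le)
        (trans (cong ⊖_ (odd j (ℕ.≤-trans (ℕ.≤-trans (ℕ.n≤1+n _) (ℕ.n≤1+n _)) le))) (RP.-‿distribˡ-* (sign j) (q 1)))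
      byParity : 2 + k C ≡ s * 2 ⊎ 2 + k C ≡ suc (s * 2) → L % 4 ≡ 2
      byParity (inj₁ eq) = ⊥-elim (1≢0 (trans (sym closing) (trans (cong₂ _⊕_ q₁≡0 q-last≡0) 0⊕0≡0)))
        where
        q₁≡0 : q 1 ≡ 0#
        q₁≡0 = sign-cancel s (trans (sym (odd s (ℕ.≤-reflexive (cong suc (sym eq)))))
          (trans (cong (q ∘ suc) (sym eq)) (trans (cong φ p-full) φ₀≡0)))
        q-last≡0 : q (2 + k C) ≡ 0#
        q-last≡0 = trans (cong q eq) (even s (ℕ.≤-trans (ℕ.≤-reflexive (sym eq)) (ℕ.n≤1+n _)))
      byParity (inj₂ eq) with half s
      ... | j , inj₁ refl = trans (cong (λ e → suc e % 4) eq) (2mod4⁻ j)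
      ... | j , inj₂ refl = ⊥-elim (1≢0 (trans (sym closing) (trans (cong (q 1 ⊕_) (trans (cong q eq)
            (trans (odd s′ (ℕ.≤-trans (ℕ.≤-reflexive (sym eq)) (ℕ.n≤1+n _)))
              (trans (cong (_⊗ q 1) (sign-odd j)) (RP.-1*x≈-x (q 1)))))) (R.-‿inverseʳ (q 1)))))
        where
        s′ : ℕ
        s′ = suc (j * 2)

    ½ : ℚ
    ½ = Q.½

    -- The two neighbours of `p 0` share the right-hand side one equally, which explains `½`. They
    -- get the same sign exactly because half the length is odd.
    alternating : ℕ → Carrier
    alternating zero = 0#
    alternating (suc zero) = ½
    alternating (suc (suc t)) = ⊖ alternating t

    alternating-odd : ∀ j → alternating (suc (j * 2)) ≡ sign j ⊗ ½
    alternating-odd zero = sym (R.*-identityˡ _)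
    alternating-odd (suc j) = trans (cong ⊖_ (alternating-odd j)) (RP.-‿distribˡ-* (sign j) ½)

    solution : L % 4 ≡ 2 → ∃[ φ ] Solves (p 0) (RA.restrict S) φ × φ (p 0) ≡ 0#
    solution residue = φ , CA.rows alternating (basis (p 0)) on-rows off-rows , φ-at {0} (s≤s z≤n)
      where
      j : ℕ
      j = proj₁ (2mod4 {L} residue)
      last≡ : 2 + k C ≡ suc ((j * 2) * 2)
      last≡ = ℕ.suc-injective (proj₂ (2mod4 {L} residue))
      φ : Vect n
      φ = CA.spread alternating
      φ-at : ∀ {t} → t < L → φ (p t) ≡ alternating t
      φ-at = CA.spread-around alternating
      off-rows : ∀ w → ¬ OnCycle C w → basis (p 0) w ≡ 0#
      off-rows w off = basis-other (λ w≡ → off (zero , sym w≡))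
      on-rows : ∀ t → t < L → dot (RA.restrict S (p (suc t))) φ ≡ basis (p 0) (p (suc t))
      on-rows t t<L with ℕ.<-cmp (suc (suc t)) L
      ... | tri< t+2<L _ _ = trans (row φ t) (trans (cong₂ _⊕_ (φ-at t+2<L) (φ-at t<L))
            (trans (R.-‿inverseˡ (alternating t)) (sym (basis-other (interior≢ (ℕ.≤-trans (ℕ.n≤1+n _) t+2<L))))))
      ... | tri≈ _ refl _ = trans (row φ t) (trans (cong₂ _⊕_ (CA.spread-full alternating) (φ-at t<L))
            (trans (cong (0# ⊕_) (trans (cong alternating t≡) (alternating-even (j * 2)))) (trans 0⊕0≡0 (sym (basis-other (interior≢ ℕ.≤-refl))))))
        where
        t≡ : t ≡ (j * 2) * 2
        t≡ = ℕ.suc-injective last≡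
        alternating-even : ∀ i → alternating (i * 2) ≡ 0#
        alternating-even zero = refl
        alternating-even (suc i) = trans (cong ⊖_ (alternating-even i)) RP.-0#≈0#
      -- The row of `p 0` itself, written as `p L`: its neighbours are at positions 1 and `2 + k C`,
      -- and the sum of the two halves computes to one.
      ... | tri> _ _ L<t+2 with ℕ.≤-antisym t<L (ℕ.s≤s⁻¹ L<t+2)
      ...   | refl = trans (row φ t) (trans (cong₂ _⊕_ (trans (cong φ p-full′) (φ-at {1} (s≤s (s≤s z≤n)))) (φ-at t<L))
            (trans (cong (½ ⊕_) (trans (cong alternating last≡) (trans (alternating-odd (j * 2))
              (trans (cong (_⊗ ½) (sign-even j)) (R.*-identityˡ ½))))) (sym (trans (cong (basis (p 0)) p-full) (basis-self (p 0))))))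

  module HermitianWeights where
    open Vectors ℚi-field
    open VertexDeletion ℚi-field
    open Signs ℚi-field
    open ImaginaryPowers

    e : ℕ → Entry
    e t = ent M (p t) (p (suc t))

    h : ℕ → Carrier
    h t = hermEntry (e t)

    W : ℕ → Carrier
    W zero = 1#
    W (suc t) = W t ⊗ h t

    h-unit : ∀ t → h t ⊗ conj (h t) ≡ 1#
    h-unit t = hermEntry-unit (e t) (around-adj C zero t)

    row : ∀ ψ t → dot (RH.restrict S (p (suc t))) ψ ≡ h (suc t) ⊗ ψ (p (2 + t)) ⊕ conj (h t) ⊗ ψ (p t)
    row ψ t = trans (CH.row-sum ψ t) (cong (λ z → h (suc t) ⊗ ψ (p (2 + t)) ⊕ z ⊗ ψ (p t))
      (sym (H-hermitian (p t) (p (suc t)))))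

    Recurrence : (ℕ → Carrier) → Set
    Recurrence r = ∀ t → h (suc t) ⊗ r (2 + t) ⊕ conj (h t) ⊗ r t ≡ 0#

    -- Multiplication by `W`, the product of the weights passed so far, gauges the orientation away:
    -- all weights have modulus one, so the recurrence becomes a mere change of sign.
    weighted-step : ∀ {r} → Recurrence r → ∀ t → r (2 + t) ⊗ W (2 + t) ≡ ⊖ (r t ⊗ W t)
    weighted-step {r} rec t = begin
      r (2 + t) ⊗ (W t ⊗ h t ⊗ h (suc t))
        ≡⟨ solve 4 (λ r w h h′ → r :* (w :* h :* h′) := w :* h :* (h′ :* r)) refl (r (2 + t)) (W t) (h t) (h (suc t)) ⟩
      W t ⊗ h t ⊗ (h (suc t) ⊗ r (2 + t)) ≡⟨ cong (W t ⊗ h t ⊗_) (opposite (rec t)) ⟩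
      W t ⊗ h t ⊗ (⊖ (conj (h t) ⊗ r t))
        ≡⟨ solve 4 (λ w h c r → w :* h :* (:- (c :* r)) := :- (h :* c :* (r :* w))) refl (W t) (h t) (conj (h t)) (r t) ⟩
      ⊖ (h t ⊗ conj (h t) ⊗ (r t ⊗ W t)) ≡⟨ cong ⊖_ (trans (cong (_⊗ (r t ⊗ W t)) (h-unit t)) (R.*-identityˡ _)) ⟩
      ⊖ (r t ⊗ W t) ∎
      where open ≡-Reasoning

    weighted-even : ∀ {r} → Recurrence r → ∀ j → r (j * 2) ⊗ W (j * 2) ≡ sign j ⊗ r 0
    weighted-even {r} rec zero = R.*-comm (r 0) 1#
    weighted-even {r} rec (suc j) = trans (weighted-step {r} rec (j * 2))
      (trans (cong ⊖_ (weighted-even {r} rec j)) (RP.-‿distribˡ-* (sign j) (r 0)))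

    weighted-full : ∀ {r} → Recurrence r → L % 4 ≡ 2 → r L ⊗ W L ≡ ⊖ r 0
    weighted-full {r} rec residue = trans (cong (λ l → r l ⊗ W l) (proj₂ (2mod4 {L} residue)))
      (trans (weighted-even {r} rec (suc (j * 2))) (trans (cong (_⊗ r 0) (sign-odd j)) (RP.-1*x≈-x (r 0))))
      where
      j : ℕ
      j = proj₁ (2mod4 {L} residue)

    W-iPow : ∀ t → W t ≡ iPow (total t e)
    W-iPow zero = refl
    W-iPow (suc t) = trans (cong₂ _⊗_ (W-iPow t) (hermEntry-iPow (e t) (around-adj C zero t)))
      (trans (sym (iPow-+ (total t e) (exponent (e t)))) (cong iPow (sym (total-suc t e))))

    f b : ℕ
    f = count (λ i → isArc (ent M (vert C i) (vert C (next i))))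
    b = count (λ i → isRev (ent M (vert C i) (vert C (next i))))

    total-full : total L e ≡ f + 3 * b
    total-full = trans (total-count L e) (cong₂ (λ x y → x + 3 * y)
      (count-cong {L} (λ i → cong isArc (entry i))) (count-cong {L} (λ i → cong isRev (entry i))))
      where
      entry : ∀ i → e (toℕ i) ≡ ent M (vert C i) (vert C (next i))
      entry i = cong (λ j → ent M (vert C j) (vert C (next j)))
        (Fin.toℕ-injective (trans (toℕ-rot zero (toℕ i)) (ℕ.m<n⇒m%n≡m (Fin.toℕ<n i))))

    weight⇔signature : W L ≡ ⊖ 1# ⇔ signature M C % 4 ≡ 2
    weight⇔signature = mk⇔
      (λ eq → Equivalence.to (signature-residue f b) (trans (cong (_% 4) (sym total-full))
        (iPow≡-1⇒ (total L e) (trans (sym (W-iPow L)) eq))))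
      (λ eq → trans (W-iPow L) (iPow≡-1⇐ (total L e)
        (trans (cong (_% 4) total-full) (Equivalence.from (signature-residue f b) eq))))

    -- After one turn `ψ` is back at its initial value while the weighted sequence has changed sign.
    -- Cancelling the nonzero value at `p 0` leaves `W L` equal to -1.
    signature-residue-from-kernel : L % 4 ≡ 2 → KernelAt (p 0) (RH.restrict S) → signature M C % 4 ≡ 2
    signature-residue-from-kernel residue (ψ , kernel , ψ₀≢0) = Equivalence.to weight⇔signature
      (RP.x∙y⁻¹≈ε⇒x≈y (W L) (⊖ 1#) (⊗-zero-product ψ₀≢0 (begin
        r 0 ⊗ (W L ⊕ (⊖ (⊖ 1#))) ≡⟨ solve 3 (λ r w o → r :* (w :+ :- (:- o)) := r :* w :+ r :* o) refl (r 0) (W L) 1# ⟩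
        r 0 ⊗ W L ⊕ r 0 ⊗ 1# ≡⟨ cong₂ _⊕_ (trans (cong (λ v → ψ v ⊗ W L) (sym p-full)) (weighted-full {r} rec residue)) (R.*-identityʳ (r 0)) ⟩
        (⊖ r 0) ⊕ r 0 ≡⟨ R.-‿inverseˡ (r 0) ⟩
        0# ∎)))
      where
      open ≡-Reasoning
      r : ℕ → Carrier
      r t = ψ (p t)
      rec : Recurrence r
      rec t = trans (sym (row ψ t)) (kernel (p (suc t)))

    -- The recurrence solved for its outer term; the conjugate is the inverse of a weight. The start
    -- 1, 0 puts the vector on the even positions, which form a class of their own because the
    -- length is even.
    propagated : ℕ → Carrier
    propagated zero = 1#
    propagated (suc zero) = 0#
    propagated (suc (suc t)) = ⊖ (conj (h (suc t)) ⊗ (conj (h t) ⊗ propagated t))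

    propagated-rec : Recurrence propagated
    propagated-rec t = trans
      (solve 3 (λ h c x → h :* (:- (c :* x)) :+ x := (:- (h :* c :* x)) :+ x) refl (h (suc t)) (conj (h (suc t))) (conj (h t) ⊗ propagated t))
      (trans (cong (λ z → (⊖ (z ⊗ (conj (h t) ⊗ propagated t))) ⊕ conj (h t) ⊗ propagated t) (h-unit (suc t)))
        (trans (cong (λ z → (⊖ z) ⊕ conj (h t) ⊗ propagated t) (R.*-identityˡ (conj (h t) ⊗ propagated t)))
          (R.-‿inverseˡ (conj (h t) ⊗ propagated t))))

    propagated-odd : ∀ i → propagated (suc (i * 2)) ≡ 0#
    propagated-odd zero = refl
    propagated-odd (suc i) = trans (cong (λ z → ⊖ (conj (h (suc (suc (i * 2)))) ⊗ (conj (h (suc (i * 2))) ⊗ z))) (propagated-odd i))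
      (trans (cong (λ z → ⊖ (conj (h (suc (suc (i * 2)))) ⊗ z)) (R.zeroʳ (conj (h (suc (i * 2))))))
        (trans (cong ⊖_ (R.zeroʳ (conj (h (suc (suc (i * 2))))))) RP.-0#≈0#))

    kernel-vector : L % 4 ≡ 2 → signature M C % 4 ≡ 2 → KernelAt (p 0) (RH.restrict S)
    kernel-vector residue sig = ψ , CH.rows propagated (λ _ → 0#) on-rows (λ _ _ → refl) ,
      λ eq → 1≢0 (trans (sym (CH.spread-around propagated {0} (s≤s z≤n))) eq)
      where
      ψ : Vect n
      ψ = CH.spread propagated
      propagated-full : propagated L ≡ 1#
      propagated-full = RP.-‿injective (begin
        ⊖ propagated L ≡⟨ sym (RP.-1*x≈-x (propagated L)) ⟩
        (⊖ 1#) ⊗ propagated L ≡⟨ R.*-comm (⊖ 1#) (propagated L) ⟩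
        propagated L ⊗ (⊖ 1#) ≡⟨ cong (propagated L ⊗_) (sym (Equivalence.from weight⇔signature sig)) ⟩
        propagated L ⊗ W L ≡⟨ weighted-full {propagated} propagated-rec residue ⟩
        ⊖ 1# ∎)
        where open ≡-Reasoning
      propagated-full′ : propagated (suc L) ≡ 0#
      propagated-full′ = trans (cong (propagated ∘ suc) (proj₂ (2mod4 {L} residue))) (propagated-odd (suc (proj₁ (2mod4 {L} residue) * 2)))
      -- The last row reads position `suc L`, so the sequence has to match at both wrapped
      -- positions, `L` and `suc L`. The first of them is where the signature enters.
      ψ-at : ∀ t → t ≤ suc L → ψ (p t) ≡ propagated t
      ψ-at t t≤ with ℕ.<-cmp t L
      ... | tri< t<L _ _ = CH.spread-around propagated t<L
      ... | tri≈ _ refl _ = trans (CH.spread-full propagated) (sym propagated-full)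
      ... | tri> _ _ L<t with ℕ.≤-antisym t≤ L<t
      ...   | refl = trans (cong ψ p-full′) (trans (CH.spread-around propagated {1} (s≤s (s≤s z≤n))) (sym propagated-full′))
      on-rows : ∀ t → t < L → dot (RH.restrict S (p (suc t))) ψ ≡ 0#
      on-rows t t<L = trans (row ψ t) (trans (cong₂ (λ x y → h (suc t) ⊗ x ⊕ conj (h t) ⊗ y)
        (ψ-at (2 + t) (s≤s t<L)) (ψ-at t (ℕ.≤-trans (ℕ.<⇒≤ t<L) (ℕ.n≤1+n _)))) (propagated-rec t))

-- From the equality to the three conditions

module Forward {n} (M : MixedGraph n) where
  open MixedGraphRank M

  -- `keeps` carries results back to `S`: the residues are established for cycles of the crucial
  -- subgraph, and no cycle is lost on the way to it.
  record Reduction (S : Fin n → Bool) : Set where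
    field
      crucial : Fin n → Bool
      steps : Star (Delta G) S crucial
      noPendant : NoPendant G crucial
      extremal : Extremal crucial
      same-d : d crucial ≡ d S
      keeps : (C : Cycle G) → Within C S → Within C crucial

  reduce : ∀ m S → count S ≤ m → Extremal S → Reduction S
  reduce m S le ext with pendant? G S
  ... | no noPendant = record
        { crucial = S ; steps = ε ; noPendant = λ u p → noPendant (u , p)
        ; extremal = ext ; same-d = refl ; keeps = λ _ within → within }
  reduce zero S le ext | yes (u , Su , _) = ⊥-elim (count-zero S Su le)
  reduce (suc m) S le ext | yes (u , p) with pendant-neighbour G S p
  ... | v , Sv , uv = record
        { crucial = crucial ; steps = (u , v , p , Sv , uv , λ w → Bool.∧-assoc (S w) _ _) ◅ steps
        ; noPendant = noPendant ; extremal = extremal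
        ; same-d = trans same-d (sym d-pendant)
        ; keeps = λ C within → keeps C (λ i → remove⁺ (remove S u)
            (remove⁺ S (within i) (proj₁ (cycles-avoid-pendant S ext p Sv uv C within i)))
            (proj₂ (cycles-avoid-pendant S ext p Sv uv C within i))) }
    where
    S′ : Fin n → Bool
    S′ = remove (remove S u) v
    ext′ : Extremal S′
    ext′ = extremal-pendant S ext p Sv uv
    open Reduction (reduce m S′ (count-remove-≤ (remove S u) (remove⁺ S Sv (adj⇒≢ G uv ∘ sym))
      (ℕ.≤-trans (count-remove-≤ S (proj₁ p) le) (ℕ.n≤1+n m))) ext′)
    -- Read off from extremality before and after the step, since both ranks drop by two.
    d-pendant : d S ≡ d S′
    d-pendant = ℕ.*-cancelˡ-≡ (d S) (d S′) 2 (ℕ.+-cancelˡ-≡ (2 + RH.rank S′) _ _ (begin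
      2 + RH.rank S′ + 2 * d S ≡⟨ cong (_+ 2 * d S) (sym (RH.rank-pendant S p Sv uv)) ⟩
      RH.rank S + 2 * d S ≡⟨ ext ⟩
      RA.rank S ≡⟨ RA.rank-pendant S p Sv uv ⟩
      2 + RA.rank S′ ≡⟨ cong (2 +_) (sym ext′) ⟩
      2 + RH.rank S′ + 2 * d S′ ∎))
      where open ≡-Reasoning

  record CycleSystem (T : Fin n → Bool) (c : ℕ) : Set where
    field
      cyc : Fin c → Cycle G
      within : ∀ j → Within (cyc j) T
      disjoint : ∀ j j′ v → j ≢ j′ → OnCycle (cyc j) v → ¬ OnCycle (cyc j′) v
      covers : (C : Cycle G) → Within C T → ∃[ j ] SameCycle C (cyc j)

  -- Each cycle chosen loses one vertex, which preserves extremality and lowers `d` by exactly one.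
  -- The recursion therefore finds exactly `d T` cycles; at `d` zero none is left.
  cycle-system : ∀ c T → Extremal T → d T ≡ c → CycleSystem T c
  cycle-system zero T ext dT = record
    { cyc = λ () ; within = λ () ; disjoint = λ ()
    ; covers = λ C within → case trans (sym dT) (extremal-d T ext C within zero) of λ () }
  cycle-system (suc c) T ext dT with cycle⊎rank≡ (count T) T ℕ.≤-refl
  -- Equal ranks are incompatible with extremality when `d` is positive.
  ... | inj₂ eq = ⊥-elim (ℕ.m≢1+m+n (RH.rank T) (trans eq (trans (sym ext) (trans (cong (λ e → RH.rank T + 2 * e) dT) (ℕ.+-suc _ _)))))
  ... | inj₁ (C , C-within) = record { cyc = cyc ; within = within ; disjoint = disjoint ; covers = covers }
    where
    x : Fin n
    x = vert C zero
    module Rest = CycleSystem (cycle-system c (remove T x) (extremal-remove T ext C C-within zero)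
      (ℕ.suc-injective (trans (sym (extremal-d T ext C C-within zero)) dT)))
    cyc : Fin (suc c) → Cycle G
    cyc zero = C
    cyc (suc j) = Rest.cyc j
    within : ∀ j → Within (cyc j) T
    within zero = C-within
    within (suc j) i = remove-⊆ₛ T x (Rest.within j i)
    avoids : ∀ j → ¬ OnCycle (Rest.cyc j) x
    avoids j (i , eq) = proj₂ (remove⁻ T (Rest.within j i)) eq
    -- A common vertex would make the two cycles equal, but the later cycle lives where `x` has been
    -- deleted.
    apart : ∀ j v → OnCycle C v → ¬ OnCycle (Rest.cyc j) v
    apart j v on on′ = avoids j (cycleEdge-on (Rest.cyc j) (Equivalence.to
      (extremal-disjoint T ext C (Rest.cyc j) C-within (within (suc j)) (v , on , on′) x (around C zero 1)) (around-edge C zero 0)))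
    disjoint : ∀ j j′ v → j ≢ j′ → OnCycle (cyc j) v → ¬ OnCycle (cyc j′) v
    disjoint zero zero v j≢j′ = ⊥-elim (j≢j′ refl)
    disjoint zero (suc j′) v _ = apart j′ v
    disjoint (suc j) zero v _ on on′ = apart j v on′ on
    disjoint (suc j) (suc j′) v j≢j′ = Rest.disjoint j j′ v (j≢j′ ∘ cong suc)
    covers : (C′ : Cycle G) → Within C′ T → ∃[ j ] SameCycle C′ (cyc j)
    covers C′ within′ with onCycle? C′ x
    ... | yes on = zero , extremal-disjoint T ext C′ C within′ C-within (x , on , zero , refl)
    ... | no off with Rest.covers C′ (λ i → remove⁺ T (within′ i) (λ eq → off (i , eq)))
    ...   | j , same = suc j , same

  module _ (ext : Extremal full) where
    private
      red : Reduction full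
      red = reduce (count (full {n})) full ℕ.≤-refl ext
      open Reduction red
      open NoPendantExtremal M crucial extremal noPendant using (component; edge-on-cycle)

    forward-disjoint : CyclesVertexDisjoint G
    forward-disjoint C C′ = extremal-disjoint full ext C C′ (λ _ → refl) (λ _ → refl)

    forward-residues : CycleCondition M
    forward-residues C = length , HermitianWeights.signature-residue-from-kernel length
      (extremal-kernel crucial extremal C within zero)
      where
      within : Within C crucial
      within = keeps C (λ _ → refl)
      open CycleParity M crucial C within (component C within)
      length : len C % 4 ≡ 2
      length = let φ , solves , φ₀≡0 = extremal-solves crucial extremal C within zero in
        Adjacency.length-residue {φ} solves φ₀≡0

    forward-crucial : CrucialCondition G (d full)
    forward-crucial = crucial , steps , noPendant , cyc , within , disjoint , edges
      where
      open CycleSystem (cycle-system (d full) crucial extremal same-d)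
      edges : ∀ u v → In crucial u → In crucial v → Adj G u v → ∃[ j ] CycleEdge (cyc j) u v
      edges u v Su Sv uv with edge-on-cycle Su Sv uv
      ... | C , C-within , e with covers C C-within
      ...   | j , same = j , Equivalence.to (same u v) e

-- From the conditions to the equality

module Backward {n} (M : MixedGraph n) (residues : CycleCondition M) where
  open MixedGraphRank M

  ranks-along : ∀ {S S′} → Star (Delta G) S S′ →
    ∃[ s ] RH.rank S ≡ s + RH.rank S′ × RA.rank S ≡ s + RA.rank S′
  ranks-along ε = 0 , refl , refl
  ranks-along {S} ((u , v , p , Sv , uv , S₁≗) ◅ rest) with ranks-along rest
  ... | s , eqH , eqA = 2 + s ,
        trans (RH.rank-pendant S p Sv uv) (cong (2 +_) (trans (sym (RH.rank-≗ same)) eqH)) ,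
        trans (RA.rank-pendant S p Sv uv) (cong (2 +_) (trans (sym (RA.rank-≗ same)) eqA))
    where
    same : ∀ w → _ ≡ remove (remove S u) v w
    same w = trans (S₁≗ w) (sym (Bool.∧-assoc (S w) _ _))

  -- Deleting the base vertex of a listed cycle keeps the Hermitian rank, by the kernel vector, and
  -- lowers the other rank by two, by the solution. The last hypothesis, that every cycle passes
  -- through some base vertex, survives the deletion and excludes cycles once the list is exhausted.
  rank-of-cycles : ∀ c T (cyc : Fin c → Cycle G) → (∀ j → Within (cyc j) T) →
    (∀ j j′ v → j ≢ j′ → OnCycle (cyc j) v → ¬ OnCycle (cyc j′) v) →
    (∀ j → RA.Component T (cyc j)) →
    ((C : Cycle G) → Within C T → ∃[ j ] OnCycle C (vert (cyc j) zero)) →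
    RH.rank T + 2 * c ≡ RA.rank T
  rank-of-cycles zero T cyc within disjoint component covers with cycle⊎rank≡ (count T) T ℕ.≤-refl
  ... | inj₁ (C , C-within) = case covers C C-within of λ ()
  ... | inj₂ eq = trans (ℕ.+-identityʳ _) eq
  rank-of-cycles (suc c) T cyc within disjoint component covers = begin
    RH.rank T + 2 * suc c ≡⟨ cong₂ _+_ (RH.kernel⇒rank-same T x kernel) (ℕ.*-suc 2 c) ⟩
    RH.rank T′ + (2 + 2 * c) ≡⟨ trans (sym (ℕ.+-assoc (RH.rank T′) 2 (2 * c))) (trans (cong (_+ 2 * c) (ℕ.+-comm (RH.rank T′) 2))
        (ℕ.+-assoc 2 (RH.rank T′) (2 * c))) ⟩
    2 + (RH.rank T′ + 2 * c) ≡⟨ cong (2 +_) IH ⟩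
    2 + RA.rank T′ ≡⟨ sym drops ⟩
    RA.rank T ∎
    where
    open ≡-Reasoning
    C : Cycle G
    C = cyc zero
    x : Fin n
    x = vert C zero
    T′ : Fin n → Bool
    T′ = remove T x
    open CycleParity M T C (within zero) (component zero)
    kernel : VertexDeletion.KernelAt ℚi-field x (RH.restrict T)
    kernel = HermitianWeights.kernel-vector (proj₁ (residues C)) (proj₂ (residues C))
    drops : RA.rank T ≡ 2 + RA.rank T′
    drops = let φ , solves , φx≡0 = Adjacency.solution (proj₁ (residues C)) in RA.solves⇒rank-drops T x {φ} solves φx≡0
    IH : RH.rank T′ + 2 * c ≡ RA.rank T′
    IH = rank-of-cycles c T′ (cyc ∘ suc)
      (λ j i → remove⁺ T (within (suc j) i) (λ eq → disjoint zero (suc j) x (λ ()) (zero , refl) (i , eq)))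
      (λ j j′ v j≢j′ → disjoint (suc j) (suc j′) v (j≢j′ ∘ Fin.suc-injective))
      (λ j i Tw → component (suc j) i (remove-⊆ₛ T x Tw))
      covers′
      where
      covers′ : (D : Cycle G) → Within D T′ → ∃[ j ] OnCycle D (vert (cyc (suc j)) zero)
      covers′ D D-within with covers D (λ i → remove-⊆ₛ T x (D-within i))
      ... | zero , (i , eq) = ⊥-elim (proj₂ (remove⁻ T (D-within i)) eq)
      ... | suc j , on = j , on

  rank-of-crucial : ∀ S c → UnionOfCyclesAndIsolated G S c → RH.rank S + 2 * c ≡ RA.rank S
  rank-of-crucial S c (cyc , within , disjoint , edges) = rank-of-cycles c S cyc within disjoint component covers
    where
    component : ∀ j → RA.Component S (cyc j)
    component j i {w} Sw vw with edges (vert (cyc j) i) w (within j i) Sw vw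
    ... | j′ , e with j Fin.≟ j′
    ...   | yes refl = e
    ...   | no j≢j′ = ⊥-elim (disjoint j j′ _ j≢j′ (i , refl) (cycleEdge-on (cyc j′) e))
    -- An edge of `C` lies on some listed cycle `D`. At each vertex of `D` the only edges are the
    -- two of `D`, so at common vertices `C` and `D` use the same pair and therefore share all
    -- vertices.
    covers : (C : Cycle G) → Within C S → ∃[ j ] OnCycle C (vert (cyc j) zero)
    covers C C-within with edges (vert C zero) (vert C (next zero)) (C-within zero) (C-within (next zero)) (step C zero)
    ... | j , e = j , cycleEdge-on C (sameCycle-⊆ C D local (vert C zero , (zero , refl) , cycleEdge-on D e) (around-edge D zero 0))
      where
      D : Cycle G
      D = cyc j
      pigeonhole : ∀ {a b y d₁ d₂ : Fin n} → b ≢ a → a ≡ d₁ ⊎ a ≡ d₂ → b ≡ d₁ ⊎ b ≡ d₂ → y ≡ d₁ ⊎ y ≡ d₂ → y ≡ a ⊎ y ≡ b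
      pigeonhole b≢a (inj₁ a≡) _ (inj₁ y≡) = inj₁ (trans y≡ (sym a≡))
      pigeonhole b≢a (inj₂ a≡) _ (inj₂ y≡) = inj₁ (trans y≡ (sym a≡))
      pigeonhole b≢a _ (inj₁ b≡) (inj₁ y≡) = inj₂ (trans y≡ (sym b≡))
      pigeonhole b≢a _ (inj₂ b≡) (inj₂ y≡) = inj₂ (trans y≡ (sym b≡))
      pigeonhole b≢a (inj₁ a≡) (inj₁ b≡) (inj₂ _) = ⊥-elim (b≢a (trans b≡ (sym a≡)))
      pigeonhole b≢a (inj₂ a≡) (inj₂ b≡) (inj₁ _) = ⊥-elim (b≢a (trans b≡ (sym a≡)))
      local : ∀ {x y} → OnCycle C x → CycleEdge D x y → CycleEdge C x y
      local {x} {y} (i , refl) e with cycleEdge-on D e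
      ... | i′ , eq = conclude (pigeonhole (last≢first C i)
              (neighbour (C-within _) (around-adj C i 0)) (neighbour (C-within _) (cycleEdge-adj C (last-edge C i)))
              (cycleEdge-neighbour D i′ (subst (λ z → CycleEdge D z y) (sym eq) e)))
        where
        neighbour : ∀ {z} → In S z → Adj G x z → z ≡ around D i′ 1 ⊎ z ≡ around D i′ (2 + k D)
        neighbour {z} Sz xz = cycleEdge-neighbour D i′ (component j i′ Sz (subst (λ w → Adj G w z) (sym eq) xz))
        conclude : y ≡ around C i 1 ⊎ y ≡ around C i (2 + k C) → CycleEdge C x y
        conclude (inj₁ refl) = around-edge C i 0
        conclude (inj₂ refl) = last-edge C i

  backward : ∀ c → CrucialCondition G c → RH.rank full + 2 * c ≡ RA.rank full
  backward c (S , steps , _ , union) with ranks-along steps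
  ... | s , eqH , eqA = trans (cong (_+ 2 * c) eqH) (trans (ℕ.+-assoc s (RH.rank S) (2 * c))
        (trans (cong (s +_) (rank-of-crucial S c union)) (sym eqA)))

-- The equivalence for ranks given by minors

theorem1p3 : ∀ (n : ℕ) (M : MixedGraph n) (rk r ω : ℕ) →
    ℚiDet.IsRank (H M) rk → ℚDet.IsRank (A (underlying M)) r →
    NumComponents (underlying M) ω →
    (rk + 2 * dim (underlying M) ω ≡ r) ⇔
    (CyclesVertexDisjoint (underlying M) × CycleCondition M ×
    CrucialCondition (underlying M) (dim (underlying M) ω))
theorem1p3 n M rk r ω isRk isR comps = mk⇔
  (λ eq → let ext = extremal eq in forward-disjoint ext , forward-residues ext ,
    subst (CrucialCondition G) (sym dim≡d) (forward-crucial ext))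
  (λ (_ , residues , crucial) → trans (cong (_+ 2 * dim G ω) rk≡)
    (trans (Backward.backward M residues (dim G ω) crucial) (sym r≡)))
  where
  open MixedGraphRank M
  open Forward M
  -- Restriction to `full` unfolds to the given matrix, so both certificates speak of the same rank.
  rk≡ : rk ≡ RH.rank full
  rk≡ = Vectors.rank-unique ℚi-field {M = H M} (Determinants.isRank⇒rank ℚi-field {M = H M} isRk) (RH.rank-spec full)
  r≡ : r ≡ RA.rank full
  r≡ = Vectors.rank-unique ℚ-field {M = A G} (Determinants.isRank⇒rank ℚ-field {M = A G} isR) (RA.rank-spec full)
  dim≡d : dim G ω ≡ d full
  dim≡d with d-spec full
  -- `induced full` has the adjacency of `G` by computation. The equation in `Cyclomatic` shows that
  -- the truncated subtraction in `dim` loses nothing.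
  ... | κ , comps′ , eq = trans (cong (_∸ n) (trans (cong (numEdges G +_)
        (ℕ.≤-antisym (components-unique {G = G} {induced full} (λ u v → mk⇔ (λ z → z) (λ z → z)) comps comps′)
                     (components-unique {G = induced full} {G} (λ u v → mk⇔ (λ z → z) (λ z → z)) comps′ comps))) eq))
        (ℕ.m+n∸m≡n n (d full))
  extremal : rk + 2 * dim G ω ≡ r → Extremal full
  extremal eq = trans (cong₂ (λ x y → x + 2 * y) (sym rk≡) (sym dim≡d)) (trans eq r≡)
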